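{- Let $d$, $n$, $r$ be positive integers with $\gcd(d,n)=1$ and $n$ odd. Then, modulo $(1-aq^{r+d\langle -r/d\rangle_n})(1-bq^{d-r+d\langle (r-d)/d\rangle_n})$, $$ \sum_{k=0}^{n-1}\frac{(aq^r;q^d)_k\,(bq^{d-r};q^d)_k\,(x;q^{d})_k\, q^{dk}}{(q^d;q^d)_k\,(abq^{2d};q^{2d})_k} \equiv (-1)^{\langle -r/d\rangle_n}\sum_{k=0}^{n-1}\frac{(aq^r;q^d)_k\,(bq^{d-r};q^d)_k\,(-x;q^{d})_k\, q^{dk}}{(q^d;q^d)_k\,(abq^{2d};q^{2d})_k}. $$
   Context: $a,b,q,x$ are indeterminates. The $q$-shifted factorial is $(y;q)_0=1$ and $(y;q)_m=(1-y)(1-yq)\cdots(1-yq^{m-1})$ for $m\geqslant1$. $\langle y\rangle_m$ denotes the least non-negative residue modulo $m$ of a rational number $y$ whose denominator is coprime to $m$. For rational functions $A,B$ and a polynomial $P$, $A\equiv B\pmod P$ means $A-B=P\cdot C/D$ for polynomials $C,D$ with $D$ coprime to $P$. -}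

module Defs where

open import Algebra.Bundles using (CommutativeRing; Semiring)
import Algebra.Definitions.RawSemiring as RawSemiringDefinitions
import Algebra.Properties.Group as GroupProperties
import Algebra.Properties.Monoid.Sum as MonoidSum
import Algebra.Properties.Ring as RingProperties
import Algebra.Solver.Ring.NaturalCoefficients.Default as SemiringSolver
open import Data.Integer.Base as ℤ using (ℤ; +_; -[1+_])
open import Data.List.Base using (List; []; _∷_; map; filter; upTo)
open import Data.Nat.Base as ℕ using (ℕ; zero; suc)
import Data.Nat.Divisibility as ℕ
open import Data.Product.Base using (∃-syntax; _×_; _,_)
open import Data.Rational.Base as ℚ using (ℚ; ↥_; ↧_)
import Data.Rational.Properties as ℚ
open import Data.Sum.Base as Sum using (_⊎_; inj₁; inj₂; [_,_]′)
open import Level using (_⊔_; 0ℓ) renaming (suc to lsuc)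
open import Relation.Binary.PropositionalEquality as ≡ using (_≡_)
import Relation.Binary.Reasoning.Setoid as SetoidReasoning
open import Relation.Nullary using (¬_; Dec; yes; no; contradiction)

record IntegralDomain c ℓ : Set (lsuc (c ⊔ ℓ)) where
  field
    commutativeRing : CommutativeRing c ℓ
  open CommutativeRing commutativeRing public
  field
    1≉0      : ¬ (1# ≈ 0#)
    integral : ∀ {x y} → x * y ≈ 0# → x ≈ 0# ⊎ y ≈ 0#
    zero?    : ∀ x → Dec (x ≈ 0#)

  open RingProperties ring using ([y-z]x≈yx-zx)
  open GroupProperties +-group using (x≈y⇒x∙y⁻¹≈ε; x∙y⁻¹≈ε⇒x≈y)

  *-nonzero : ∀ {x y} → ¬ (x ≈ 0#) → ¬ (y ≈ 0#) → ¬ (x * y ≈ 0#)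
  *-nonzero x≉0 y≉0 xy≈0 with integral xy≈0
  ... | inj₁ x≈0 = x≉0 x≈0
  ... | inj₂ y≈0 = y≉0 y≈0

  *-cancelʳ-nonzero : ∀ {x y} z → ¬ (z ≈ 0#) → x * z ≈ y * z → x ≈ y
  *-cancelʳ-nonzero {x} {y} z z≉0 eq
    with integral (trans ([y-z]x≈yx-zx z x y) (x≈y⇒x∙y⁻¹≈ε eq))
  ... | inj₁ x-y≈0 = x∙y⁻¹≈ε⇒x≈y _ _ x-y≈0
  ... | inj₂ z≈0   = contradiction z≈0 z≉0

ℚ-integralDomain : IntegralDomain 0ℓ 0ℓ
ℚ-integralDomain = record
  { commutativeRing = ℚ.+-*-commutativeRing
  ; 1≉0      = λ ()
  ; integral = integral
  ; zero?    = λ x → x ℚ.≟ ℚ.0ℚ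
  }
  where
  integral : ∀ {x y} → x ℚ.* y ≡ ℚ.0ℚ → x ≡ ℚ.0ℚ ⊎ y ≡ ℚ.0ℚ
  integral {x} {y} xy≡0 with x ℚ.≟ ℚ.0ℚ
  ... | yes x≡0 = inj₁ x≡0
  ... | no  x≢0 = inj₂ (begin
    y                     ≡⟨ ℚ.*-identityˡ y ⟨
    ℚ.1ℚ ℚ.* y            ≡⟨ ≡.cong (ℚ._* y) (ℚ.*-inverseˡ x) ⟨
    (ℚ.1/ x) ℚ.* x ℚ.* y  ≡⟨ ℚ.*-assoc (ℚ.1/ x) x y ⟩
    (ℚ.1/ x) ℚ.* (x ℚ.* y) ≡⟨ ≡.cong ((ℚ.1/ x) ℚ.*_) xy≡0 ⟩
    (ℚ.1/ x) ℚ.* ℚ.0ℚ     ≡⟨ ℚ.*-zeroʳ (ℚ.1/ x) ⟩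
    ℚ.0ℚ                  ∎)
    where
    open ≡.≡-Reasoning
    instance
      x-nonZero : ℚ.NonZero x
      x-nonZero = ℚ.≢-nonZero x≢0

-- Univariate polynomials as lists of coefficients, constant term first.
-- Trailing zeros are allowed; equality compares all coefficients.
module Polynomial {c ℓ} (R : IntegralDomain c ℓ) where
  private
    module R = IntegralDomain R
    open R using (0#; 1#; zero?) renaming (Carrier to A; _≈_ to _≈ᴿ_)

  Poly : Set c
  Poly = List A

  coeff : Poly → ℕ → A
  coeff []      _       = 0#
  coeff (x ∷ p) zero    = x
  coeff (x ∷ p) (suc i) = coeff p i

  infix 4 _≈_
  record _≈_ (p p′ : Poly) : Set ℓ where
    constructor coeffwise
    field
      at : ∀ i → coeff p i ≈ᴿ coeff p′ i
  open _≈_ public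

  infixl 6 _+_
  infixl 7 _*_ _·_
  infix  8 -_

  _+_ : Poly → Poly → Poly
  []      + q       = q
  (x ∷ p) + []      = x ∷ p
  (x ∷ p) + (y ∷ q) = (x R.+ y) ∷ (p + q)

  -_ : Poly → Poly
  -_ = map (R.-_)

  _·_ : A → Poly → Poly
  x · p = map (x R.*_) p

  _*_ : Poly → Poly → Poly
  []      * q = []
  (x ∷ p) * q = x · q + (0# ∷ p * q)

  const : A → Poly
  const x = x ∷ []

  var : Poly
  var = 0# ∷ 1# ∷ []

  private
    variable
      p p′ q q′ s : Poly
      x y : A

    refl : p ≈ p
    at refl i = R.refl

    sym : p ≈ q → q ≈ p
    at (sym eq) i = R.sym (at eq i)

    trans : p ≈ q → q ≈ s → p ≈ s
    at (trans eq eq′) i = R.trans (at eq i) (at eq′ i)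

    coeff-+ : ∀ p q i → coeff (p + q) i ≈ᴿ coeff p i R.+ coeff q i
    coeff-+ []      q       i       = R.sym (R.+-identityˡ _)
    coeff-+ (x ∷ p) []      i       = R.sym (R.+-identityʳ _)
    coeff-+ (x ∷ p) (y ∷ q) zero    = R.refl
    coeff-+ (x ∷ p) (y ∷ q) (suc i) = coeff-+ p q i

    -0≈0 : R.- 0# ≈ᴿ 0#
    -0≈0 = R.trans (R.sym (R.+-identityʳ _)) (R.-‿inverseˡ 0#)

    coeff-neg : ∀ p i → coeff (- p) i ≈ᴿ R.- coeff p i
    coeff-neg []      i       = R.sym -0≈0
    coeff-neg (x ∷ p) zero    = R.refl
    coeff-neg (x ∷ p) (suc i) = coeff-neg p i

    coeff-· : ∀ x p i → coeff (x · p) i ≈ᴿ x R.* coeff p i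
    coeff-· x []      i       = R.sym (R.zeroʳ x)
    coeff-· x (y ∷ p) zero    = R.refl
    coeff-· x (y ∷ p) (suc i) = coeff-· x p i

    ∷-cong : x ≈ᴿ y → p ≈ q → x ∷ p ≈ y ∷ q
    at (∷-cong x≈y p≈q) zero    = x≈y
    at (∷-cong x≈y p≈q) (suc i) = at p≈q i

    0∷[] : 0# ∷ [] ≈ []
    at 0∷[] zero    = R.refl
    at 0∷[] (suc i) = R.refl

    +-cong : p ≈ p′ → q ≈ q′ → p + q ≈ p′ + q′
    at (+-cong {p} {p′} {q} {q′} e f) i = R.trans (coeff-+ p q i)
      (R.trans (R.+-cong (at e i) (at f i)) (R.sym (coeff-+ p′ q′ i)))

    +-comm : ∀ p q → p + q ≈ q + p
    at (+-comm p q) i = R.trans (coeff-+ p q i)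
      (R.trans (R.+-comm _ _) (R.sym (coeff-+ q p i)))

    +-assoc : ∀ p q s → (p + q) + s ≈ p + (q + s)
    at (+-assoc p q s) i = R.trans (coeff-+ (p + q) s i)
      (R.trans (R.+-congʳ (coeff-+ p q i)) (R.trans (R.+-assoc _ _ _)
      (R.trans (R.+-congˡ (R.sym (coeff-+ q s i))) (R.sym (coeff-+ p (q + s) i)))))

    +-identityʳ : ∀ p → p + [] ≈ p
    +-identityʳ p = +-comm p []

    -‿cong : p ≈ q → - p ≈ - q
    at (-‿cong {p} {q} e) i = R.trans (coeff-neg p i)
      (R.trans (R.-‿cong (at e i)) (R.sym (coeff-neg q i)))

    -‿inverseˡ : ∀ p → - p + p ≈ []
    at (-‿inverseˡ p) i = R.trans (coeff-+ (- p) p i)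
      (R.trans (R.+-congʳ (coeff-neg p i)) (R.-‿inverseˡ _))

    +-interchange : ∀ p q s t → (p + q) + (s + t) ≈ (p + s) + (q + t)
    +-interchange p q s t =
      trans (+-assoc p q (s + t))
      (trans (+-cong (refl {p}) (trans (sym (+-assoc q s t))
        (trans (+-cong (+-comm q s) refl) (+-assoc s q t))))
      (sym (+-assoc p s (q + t))))

    ·-cong : x ≈ᴿ y → p ≈ q → x · p ≈ y · q
    at (·-cong {x} {y} {p} {q} e f) i = R.trans (coeff-· x p i)
      (R.trans (R.*-cong e (at f i)) (R.sym (coeff-· y q i)))

    ·-distribˡ-+ : ∀ x p q → x · (p + q) ≈ x · p + x · q
    at (·-distribˡ-+ x p q) i = R.trans (coeff-· x (p + q) i)
      (R.trans (R.*-congˡ (coeff-+ p q i)) (R.trans (R.distribˡ x _ _)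
      (R.trans (R.+-cong (R.sym (coeff-· x p i)) (R.sym (coeff-· x q i)))
      (R.sym (coeff-+ (x · p) (x · q) i)))))

    ·-distribʳ-+ : ∀ x y p → (x R.+ y) · p ≈ x · p + y · p
    at (·-distribʳ-+ x y p) i = R.trans (coeff-· (x R.+ y) p i)
      (R.trans (R.distribʳ _ x y)
      (R.trans (R.+-cong (R.sym (coeff-· x p i)) (R.sym (coeff-· y p i)))
      (R.sym (coeff-+ (x · p) (y · p) i))))

    ·-assoc : ∀ x y p → (x R.* y) · p ≈ x · (y · p)
    at (·-assoc x y p) i = R.trans (coeff-· (x R.* y) p i)
      (R.trans (R.*-assoc x y _)
      (R.trans (R.*-congˡ (R.sym (coeff-· y p i))) (R.sym (coeff-· x (y · p) i))))

    0· : ∀ p → 0# · p ≈ []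
    at (0· p) i = R.trans (coeff-· 0# p i) (R.zeroˡ _)

    1· : ∀ p → 1# · p ≈ p
    at (1· p) i = R.trans (coeff-· 1# p i) (R.*-identityˡ _)

    shift-+ : ∀ p q → 0# ∷ (p + q) ≈ (0# ∷ p) + (0# ∷ q)
    shift-+ p q = ∷-cong (R.sym (R.+-identityˡ 0#)) refl

    shift-· : ∀ x p → x · (0# ∷ p) ≈ 0# ∷ (x · p)
    shift-· x p = ∷-cong (R.zeroʳ x) refl

    *-congˡ : ∀ p → q ≈ q′ → p * q ≈ p * q′
    *-congˡ []      e = refl
    *-congˡ (x ∷ p) e = +-cong (·-cong R.refl e) (∷-cong R.refl (*-congˡ p e))

    *-zeroʳ : ∀ p → p * [] ≈ []
    *-zeroʳ []      = refl
    *-zeroʳ (x ∷ p) = trans (∷-cong R.refl (*-zeroʳ p)) 0∷[]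

    *-∷ : ∀ p x q → p * (x ∷ q) ≈ x · p + (0# ∷ p * q)
    *-∷ []      x q = sym 0∷[]
    *-∷ (y ∷ p) x q = ∷-cong (R.+-congʳ (R.*-comm y x))
      (trans (+-cong refl (*-∷ p x q))
      (trans (sym (+-assoc (y · q) (x · p) (0# ∷ p * q)))
      (trans (+-cong (+-comm (y · q) (x · p)) refl)
      (+-assoc (x · p) (y · q) (0# ∷ p * q)))))

    *-comm : ∀ p q → p * q ≈ q * p
    *-comm []      q = sym (*-zeroʳ q)
    *-comm (x ∷ p) q = trans
      (+-cong refl (∷-cong R.refl (*-comm p q))) (sym (*-∷ q x p))

    *-cong : p ≈ p′ → q ≈ q′ → p * q ≈ p′ * q′
    *-cong {p} {p′} {q} {q′} e f = trans (*-congˡ p f)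
      (trans (*-comm p q′) (trans (*-congˡ q′ e) (*-comm q′ p′)))

    distribˡ : ∀ p q s → p * (q + s) ≈ p * q + p * s
    distribˡ []      q s = refl
    distribˡ (x ∷ p) q s = trans
      (+-cong (·-distribˡ-+ x q s)
        (trans (∷-cong R.refl (distribˡ p q s)) (shift-+ (p * q) (p * s))))
      (+-interchange (x · q) (x · s) (0# ∷ p * q) (0# ∷ p * s))

    distribʳ : ∀ p q s → (q + s) * p ≈ q * p + s * p
    distribʳ p q s = trans (*-comm (q + s) p)
      (trans (distribˡ p q s) (+-cong (*-comm p q) (*-comm p s)))

    ·-* : ∀ x p q → (x · p) * q ≈ x · (p * q)
    ·-* x []      q = refl
    ·-* x (y ∷ p) q = trans
      (+-cong (·-assoc x y q)
        (trans (∷-cong R.refl (·-* x p q)) (sym (shift-· x (p * q)))))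
      (sym (·-distribˡ-+ x (y · q) (0# ∷ p * q)))

    shift-* : ∀ p q → (0# ∷ p) * q ≈ 0# ∷ (p * q)
    shift-* p q = +-cong (0· q) refl

    *-assoc : ∀ p q s → (p * q) * s ≈ p * (q * s)
    *-assoc []      q s = refl
    *-assoc (x ∷ p) q s = trans (distribʳ s (x · q) (0# ∷ p * q))
      (+-cong (·-* x q s)
        (trans (shift-* (p * q) s) (∷-cong R.refl (*-assoc p q s))))

    *-identityˡ : ∀ p → const 1# * p ≈ p
    *-identityˡ p = trans (+-cong (1· p) 0∷[]) (+-identityʳ p)

    ∷-zero : x ≈ᴿ 0# → p ≈ [] → x ∷ p ≈ []
    ∷-zero x≈0 p≈0 = trans (∷-cong x≈0 p≈0) 0∷[]

    tail-zero : x ∷ p ≈ [] → p ≈ []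
    at (tail-zero e) i = at e (suc i)

    integral : ∀ p q → p * q ≈ [] → p ≈ [] ⊎ q ≈ []
    integral []      q       e = inj₁ refl
    integral (x ∷ p) []      e = inj₂ refl
    integral (x ∷ p) (y ∷ q) e =
      [ (λ x≈0 → Sum.map₁ (∷-zero x≈0)
          (integral p (y ∷ q) (tail-zero (trans (sym (tailˡ x≈0)) e))))
      , (λ y≈0 → Sum.map₂ (∷-zero y≈0)
          (integral (x ∷ p) q (tail-zero (trans (sym (tailʳ y≈0)) e))))
      ]′ (R.integral (R.trans (R.sym (R.+-identityʳ _)) (at e zero)))
      where
      tailˡ : x ≈ᴿ 0# → (x ∷ p) * (y ∷ q) ≈ 0# ∷ (p * (y ∷ q))
      tailˡ x≈0 = trans (*-cong (∷-cong x≈0 (refl {p})) (refl {y ∷ q})) (shift-* p (y ∷ q))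

      tailʳ : y ≈ᴿ 0# → (x ∷ p) * (y ∷ q) ≈ 0# ∷ ((x ∷ p) * q)
      tailʳ y≈0 = trans (*-∷ (x ∷ p) y q)
        (+-cong (trans (·-cong y≈0 refl) (0· (x ∷ p))) refl)

    ≈[]? : ∀ p → Dec (p ≈ [])
    ≈[]? []      = yes refl
    ≈[]? (x ∷ p) with zero? x | ≈[]? p
    ... | yes x≈0 | yes p≈0 = yes (∷-zero x≈0 p≈0)
    ... | no  x≉0 | _       = no λ e → x≉0 (at e zero)
    ... | _       | no p≉0  = no λ e → p≉0 (tail-zero e)

  commutativeRing : CommutativeRing c ℓ
  commutativeRing = record
    { Carrier = Poly
    ; _≈_ = _≈_
    ; _+_ = _+_
    ; _*_ = _*_
    ; -_  = -_
    ; 0#  = []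
    ; 1#  = const 1#
    ; isCommutativeRing = record
      { isRing = record
        { +-isAbelianGroup = record
          { isGroup = record
            { isMonoid = record
              { isSemigroup = record
                { isMagma = record
                  { isEquivalence = record
                    { refl  = refl
                    ; sym   = sym
                    ; trans = trans
                    }
                  ; ∙-cong = +-cong
                  }
                ; assoc = +-assoc
                }
              ; identity = (λ _ → refl) , +-identityʳ
              }
            ; inverse = -‿inverseˡ , λ p → trans (+-comm p (- p)) (-‿inverseˡ p)
            ; ⁻¹-cong = -‿cong
            }
          ; comm = +-comm
          }
        ; *-cong = *-cong
        ; *-assoc = *-assoc
        ; *-identity = *-identityˡ , λ p → trans (*-comm p (const 1#)) (*-identityˡ p)
        ; distrib = distribˡ , distribʳ
        }
      ; *-comm = *-comm
      }
    }

  integralDomain : IntegralDomain c ℓ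
  integralDomain = record
    { commutativeRing = commutativeRing
    ; 1≉0      = λ e → R.1≉0 (at e zero)
    ; integral = λ {p} {q} → integral p q
    ; zero?    = ≈[]?
    }

module Fraction {c ℓ} (R : IntegralDomain c ℓ) where
  private
    module R = IntegralDomain R
    open R using (0#; 1#; zero?) renaming (Carrier to A; _≈_ to _≈ᴿ_)
    open SemiringSolver R.commutativeSemiring using (solve; _:=_; _:+_; _:*_)
    open SetoidReasoning R.setoid
    open RingProperties R.ring using (-‿distribˡ-*)

  infix 5 _/_[_]
  record Frac : Set (c ⊔ ℓ) where
    constructor _/_[_]
    field
      num   : A
      den   : A
      den≉0 : ¬ (den ≈ᴿ 0#)
  open Frac public

  infix 4 _≈_
  record _≈_ (f g : Frac) : Set ℓ where
    constructor cross
    field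
      uncross : num f R.* den g ≈ᴿ num g R.* den f

  ι : A → Frac
  ι x = x / 1# [ R.1≉0 ]

  infixl 6 _+_
  infixl 7 _*_
  infix  8 -_ _⁻¹

  _+_ : Frac → Frac → Frac
  f + g = (num f R.* den g R.+ num g R.* den f) / den f R.* den g
    [ R.*-nonzero (den≉0 f) (den≉0 g) ]

  _*_ : Frac → Frac → Frac
  f * g = num f R.* num g / den f R.* den g [ R.*-nonzero (den≉0 f) (den≉0 g) ]

  -_ : Frac → Frac
  - f = R.- num f / den f [ den≉0 f ]

  -- Total, with 0 ⁻¹ = 0.
  _⁻¹ : Frac → Frac
  f ⁻¹ with zero? (num f)
  ... | yes _  = ι 0#
  ... | no n≉0 = den f / num f [ n≉0 ]

  private
    trans : ∀ {f g h} → f ≈ g → g ≈ h → f ≈ h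
    trans {n / d [ _ ]} {n′ / d′ [ d′≉0 ]} {n″ / d″ [ _ ]} (cross e) (cross e′) = cross
      (R.*-cancelʳ-nonzero d′ d′≉0 (begin
        (n R.* d″) R.* d′  ≈⟨ swap n d″ d′ ⟩
        (n R.* d′) R.* d″  ≈⟨ R.*-congʳ e ⟩
        (n′ R.* d) R.* d″  ≈⟨ swap n′ d d″ ⟩
        (n′ R.* d″) R.* d  ≈⟨ R.*-congʳ e′ ⟩
        (n″ R.* d′) R.* d  ≈⟨ swap n″ d′ d ⟩
        (n″ R.* d) R.* d′  ∎))
      where
      swap : ∀ x y z → (x R.* y) R.* z ≈ᴿ (x R.* z) R.* y
      swap = solve 3 (λ x y z → ((x :* y) :* z) := ((x :* z) :* y)) R.refl

    +-cong : ∀ {f f′ g g′} → f ≈ f′ → g ≈ g′ → f + g ≈ f′ + g′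
    +-cong {n / d [ _ ]} {n′ / d′ [ _ ]} {m / e [ _ ]} {m′ / e′ [ _ ]} (cross p) (cross q) = cross (begin
      (n R.* e R.+ m R.* d) R.* (d′ R.* e′)
        ≈⟨ solve 6 (λ n d d′ m e e′ → (n :* e :+ m :* d) :* (d′ :* e′)
             := ((n :* d′) :* (e :* e′) :+ (m :* e′) :* (d :* d′))) R.refl n d d′ m e e′ ⟩
      (n R.* d′) R.* (e R.* e′) R.+ (m R.* e′) R.* (d R.* d′)
        ≈⟨ R.+-cong (R.*-congʳ p) (R.*-congʳ q) ⟩
      (n′ R.* d) R.* (e R.* e′) R.+ (m′ R.* e) R.* (d R.* d′)
        ≈⟨ solve 6 (λ n′ d d′ m′ e e′ → ((n′ :* d) :* (e :* e′) :+ (m′ :* e) :* (d :* d′))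
             := ((n′ :* e′ :+ m′ :* d′) :* (d :* e))) R.refl n′ d d′ m′ e e′ ⟩
      (n′ R.* e′ R.+ m′ R.* d′) R.* (d R.* e) ∎)

    interchange : ∀ x y z w → (x R.* y) R.* (z R.* w) ≈ᴿ (x R.* z) R.* (y R.* w)
    interchange = solve 4 (λ x y z w → ((x :* y) :* (z :* w)) := ((x :* z) :* (y :* w))) R.refl

    *-cong : ∀ {f f′ g g′} → f ≈ f′ → g ≈ g′ → f * g ≈ f′ * g′
    *-cong {n / d [ _ ]} {n′ / d′ [ _ ]} {m / e [ _ ]} {m′ / e′ [ _ ]} (cross p) (cross q) = cross (begin
      (n R.* m) R.* (d′ R.* e′)   ≈⟨ interchange n m d′ e′ ⟩
      (n R.* d′) R.* (m R.* e′)   ≈⟨ R.*-cong p q ⟩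
      (n′ R.* d) R.* (m′ R.* e)   ≈⟨ interchange n′ d m′ e ⟩
      (n′ R.* m′) R.* (d R.* e)   ∎)

    -‿cong : ∀ {f g} → f ≈ g → - f ≈ - g
    -‿cong {n / d [ _ ]} {m / e [ _ ]} (cross p) = cross (begin
      (R.- n) R.* e    ≈⟨ -‿distribˡ-* n e ⟨
      R.- (n R.* e)    ≈⟨ R.-‿cong p ⟩
      R.- (m R.* d)    ≈⟨ -‿distribˡ-* m d ⟩
      (R.- m) R.* d    ∎)

    +-assoc : ∀ f g h → (f + g) + h ≈ f + (g + h)
    +-assoc (n / d [ _ ]) (m / e [ _ ]) (l / c [ _ ]) = cross
      (solve 6 (λ n d m e l c →
          (((n :* e :+ m :* d) :* c) :+ (l :* (d :* e))) :* (d :* (e :* c))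
        := ((n :* (e :* c)) :+ ((m :* c :+ l :* e) :* d)) :* ((d :* e) :* c))
        R.refl n d m e l c)

    +-comm : ∀ f g → f + g ≈ g + f
    +-comm (n / d [ _ ]) (m / e [ _ ]) = cross
      (solve 4 (λ n d m e →
        (n :* e :+ m :* d) :* (e :* d) := (m :* d :+ n :* e) :* (d :* e)) R.refl n d m e)

    +-identityˡ : ∀ f → ι 0# + f ≈ f
    +-identityˡ (n / d [ _ ]) = cross (begin
      (0# R.* d R.+ n R.* 1#) R.* d
        ≈⟨ R.*-congʳ (R.trans (R.+-cong (R.zeroˡ d) (R.*-identityʳ n)) (R.+-identityˡ n)) ⟩
      n R.* d           ≈⟨ R.*-congˡ (R.*-identityˡ d) ⟨
      n R.* (1# R.* d)  ∎)

    -‿inverseˡ : ∀ f → - f + f ≈ ι 0#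
    -‿inverseˡ (n / d [ _ ]) = cross (begin
      ((R.- n) R.* d R.+ n R.* d) R.* 1#  ≈⟨ R.*-identityʳ _ ⟩
      (R.- n) R.* d R.+ n R.* d           ≈⟨ R.distribʳ d (R.- n) n ⟨
      (R.- n R.+ n) R.* d                 ≈⟨ R.*-congʳ (R.-‿inverseˡ n) ⟩
      0# R.* d                            ≈⟨ R.zeroˡ d ⟩
      0#                                  ≈⟨ R.zeroˡ _ ⟨
      0# R.* (d R.* d)                    ∎)

    *-assoc : ∀ f g h → (f * g) * h ≈ f * (g * h)
    *-assoc (n / d [ _ ]) (m / e [ _ ]) (l / c [ _ ]) = cross
      (solve 6 (λ n d m e l c →
        ((n :* m) :* l) :* (d :* (e :* c)) := (n :* (m :* l)) :* ((d :* e) :* c))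
        R.refl n d m e l c)

    *-comm : ∀ f g → f * g ≈ g * f
    *-comm (n / d [ _ ]) (m / e [ _ ]) = cross
      (solve 4 (λ n d m e → (n :* m) :* (e :* d) := (m :* n) :* (d :* e)) R.refl n d m e)

    *-identityˡ : ∀ f → ι 1# * f ≈ f
    *-identityˡ (n / d [ _ ]) = cross (begin
      (1# R.* n) R.* d  ≈⟨ R.*-congʳ (R.*-identityˡ n) ⟩
      n R.* d           ≈⟨ R.*-congˡ (R.*-identityˡ d) ⟨
      n R.* (1# R.* d)  ∎)

    distribˡ : ∀ f g h → f * (g + h) ≈ f * g + f * h
    distribˡ (n / d [ _ ]) (m / e [ _ ]) (l / c [ _ ]) = cross
      (solve 6 (λ n d m e l c →
          (n :* (m :* c :+ l :* e)) :* ((d :* e) :* (d :* c))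
        := ((n :* m) :* (d :* c) :+ (n :* l) :* (d :* e)) :* (d :* (e :* c)))
        R.refl n d m e l c)

    distribʳ : ∀ f g h → (g + h) * f ≈ g * f + h * f
    distribʳ f g h = trans (*-comm (g + h) f)
      (trans (distribˡ f g h) (+-cong (*-comm f g) (*-comm f h)))

    +-identityʳ : ∀ f → f + ι 0# ≈ f
    +-identityʳ f = trans (+-comm f (ι 0#)) (+-identityˡ f)

    -‿inverseʳ : ∀ f → f + - f ≈ ι 0#
    -‿inverseʳ f = trans (+-comm f (- f)) (-‿inverseˡ f)

    *-identityʳ : ∀ f → f * ι 1# ≈ f
    *-identityʳ f = trans (*-comm f (ι 1#)) (*-identityˡ f)

  ⁻¹-inverseʳ : ∀ f → ¬ (f ≈ ι 0#) → f * f ⁻¹ ≈ ι 1#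
  ⁻¹-inverseʳ f f≉0 with zero? (num f)
  ... | yes n≈0 = contradiction
    (cross (R.trans (R.*-identityʳ _) (R.trans n≈0 (R.sym (R.zeroˡ _))))) f≉0
  ... | no  _   = cross (R.trans (R.*-identityʳ _)
    (R.trans (R.*-comm _ _) (R.sym (R.*-identityˡ _))))

  commutativeRing : CommutativeRing (c ⊔ ℓ) ℓ
  commutativeRing = record
    { Carrier = Frac
    ; _≈_ = _≈_
    ; _+_ = _+_
    ; _*_ = _*_
    ; -_  = -_
    ; 0#  = ι 0#
    ; 1#  = ι 1#
    ; isCommutativeRing = record
      { isRing = record
        { +-isAbelianGroup = record
          { isGroup = record
            { isMonoid = record
              { isSemigroup = record
                { isMagma = record
                  { isEquivalence = record
                    { refl  = cross R.refl
                    ; sym   = λ (cross e) → cross (R.sym e)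
                    ; trans = trans
                    }
                  ; ∙-cong = +-cong
                  }
                ; assoc = +-assoc
                }
              ; identity = +-identityˡ , +-identityʳ
              }
            ; inverse = -‿inverseˡ , -‿inverseʳ
            ; ⁻¹-cong = -‿cong
            }
          ; comm = +-comm
          }
        ; *-cong = *-cong
        ; *-assoc = *-assoc
        ; *-identity = *-identityˡ , *-identityʳ
        ; distrib = distribˡ , distribʳ
        }
      ; *-comm = *-comm
      }
    }

module ℚ[x]          = Polynomial ℚ-integralDomain
module ℚ[x][q]       = Polynomial ℚ[x].integralDomain
module ℚ[x][q][a]    = Polynomial ℚ[x][q].integralDomain
module ℚ[x][q][a][b] = Polynomial ℚ[x][q][a].integralDomain

module P = IntegralDomain ℚ[x][q][a][b].integralDomain
open RawSemiringDefinitions (Semiring.rawSemiring P.semiring) public using (Coprime)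

module Rational = Fraction ℚ[x][q][a][b].integralDomain
open Rational public using (ι; _⁻¹)
open CommutativeRing Rational.commutativeRing public
  using (_≈_; _+_; _*_; -_; _-_; 0#; 1#)
open RawSemiringDefinitions (Semiring.rawSemiring (CommutativeRing.semiring Rational.commutativeRing)) public
  using (_^_)
open MonoidSum (CommutativeRing.+-monoid Rational.commutativeRing) public
  using (sum-syntax)

𝕂 : Set
𝕂 = CommutativeRing.Carrier Rational.commutativeRing

a b q x : 𝕂
x = ι (ℚ[x][q][a][b].const (ℚ[x][q][a].const (ℚ[x][q].const ℚ[x].var)))
q = ι (ℚ[x][q][a][b].const (ℚ[x][q][a].const ℚ[x][q].var))
a = ι (ℚ[x][q][a][b].const ℚ[x][q][a].var)
b = ι ℚ[x][q][a][b].var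

infixl 7 _÷_
_÷_ : 𝕂 → 𝕂 → 𝕂
f ÷ g = f * g ⁻¹

infixr 8 _^ᶻ_
_^ᶻ_ : 𝕂 → ℤ → 𝕂
f ^ᶻ (+ n)    = f ^ n
f ^ᶻ -[1+ n ] = (f ⁻¹) ^ suc n

-- The q-shifted factorial (y;p)ₘ with base p.
⟦_⨾_⟧ : 𝕂 → 𝕂 → ℕ → 𝕂
⟦ y ⨾ p ⟧ zero    = 1#
⟦ y ⨾ p ⟧ (suc m) = ⟦ y ⨾ p ⟧ m * (1# - y * p ^ m)

infix 4 _≡_[mod_]
_≡_[mod_] : 𝕂 → 𝕂 → P.Carrier → Set
A ≡ B [mod M ] = ∃[ C ] ∃[ D ] ¬ (D P.≈ P.0#) × Coprime D M × A - B ≈ ι M * (ι C ÷ ι D)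

-- Congruence modulo a rational function M is congruence modulo its numerator in
-- lowest terms.  For a polynomial M this numerator is M up to a unit.
infix 4 _≡_[mod′_]
_≡_[mod′_] : 𝕂 → 𝕂 → 𝕂 → Set
A ≡ B [mod′ M ] = ∃[ N ] ∃[ D ] ¬ (D P.≈ P.0#) × Coprime N D × M ≈ ι N ÷ ι D × A ≡ B [mod N ]

-- The least s < m with y ≡ s (mod m), that is, with m dividing ↥ y - s ↧ y, the
-- numerator of y - s in lowest terms.  Such an s exists when the denominator of y
-- is coprime to m > 0; if there is none, the value is 0.
⟨_⟩ : ℚ → ℕ → ℕ
⟨ y ⟩ m = first (filter (λ s → m ℕ.∣? ℤ.∣ ↥ y ℤ.- + s ℤ.* ↧ y ∣) (upTo m))
  where
  first : List ℕ → ℕ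
  first []      = 0
  first (s ∷ _) = s

{-# OPTIONS --safe #-}
-- Put p = q^d, A = a q^r, B = b q^(d-r) and w = A B p, so that the denominators are
-- (p;p)_k (w;p²)_k.  If A = p^(-s), the sum terminates and is a polynomial of degree s in y,
-- a big q-Jacobi polynomial with symmetric parameters: for fixed w the sums F_s satisfy
--   (1 - w p^(s-1)) F_(s+1) = (1 - w p^(2s-1)) y F_s - w p^(s-1) (1 - p^s) F_(s-1),
-- whence F_s(-y) = (-1)^s F_s(y).  This is the congruence modulo 1 - a q^(r+ds).  By the
-- symmetry in A and B, the same argument with B = p^(-t) gives it modulo 1 - b q^(d-r+dt),
-- with sign (-1)^t.  The residues satisfy s + t = n - 1, which is even, so the signs agree.
--
-- The two factors are prime and not associated, and the denominators avoid both.  All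
-- non-divisibilities are detected by two specialisations to ℚ: q = 2 with 1 - a q^(r+ds) = 0
-- and b = 0, and q = 2 with a = 0 and 1 - b q^(d-r+dt) = 0.
module Submission where

open import Algebra.Bundles using (CommutativeRing; RawRing; Semiring)
open import Algebra.Definitions.RawMagma using () renaming (_,_ to _,∣_)
import Algebra.Definitions.RawSemiring as RawSemiringDefinitions
import Algebra.Morphism.Construct.Composition as Composition
import Algebra.Morphism.RingMonomorphism as RingMonomorphism
open import Algebra.Morphism.Structures using (module RingMorphisms)
import Algebra.Properties.AbelianGroup as AbelianGroupProperties
import Algebra.Properties.CommutativeSemiring.Exp as CommutativeExp
import Algebra.Properties.Group as GroupProperties
import Algebra.Properties.Monoid.Sum as MonoidSum
import Algebra.Properties.Ring as RingProperties
import Algebra.Properties.Semiring.Exp as Exp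
import Algebra.Properties.Semiring.Mult.TCOptimised as Mult
import Algebra.Solver.Ring
open import Algebra.Solver.Ring.AlmostCommutativeRing using (fromCommutativeRing; _-Raw-AlmostCommutative⟶_)
open import Data.Fin.Base using (toℕ)
open import Data.Integer.Base as ℤ using (ℤ; +_; -[1+_]; _⊖_)
import Data.Integer.DivMod as ℤ
import Data.Integer.Divisibility.Signed as ℤˢ
import Data.Integer.GCD as ℤ
import Data.Integer.Properties as ℤ
open import Data.List.Base using ([]; _∷_; filter; upTo)
open import Data.List.Membership.Propositional using (_∈_)
open import Data.List.Membership.Propositional.Properties using (∈-filter⁺; ∈-filter⁻; ∈-upTo⁺; ∈-upTo⁻)
open import Data.List.Relation.Unary.Any using (here)
open import Data.Maybe.Base using (map)
open import Data.Nat.Base as ℕ using (ℕ; zero; suc; _<_; s≤s; z≤n; NonZero)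
import Data.Nat.Coprimality as ℕ
import Data.Nat.Divisibility as ℕ
import Data.Nat.GCD as ℕ
import Data.Nat.Properties as ℕ
open import Data.Product.Base using (∃-syntax; _×_; _,_; proj₁; proj₂)
open import Data.Rational.Base as ℚ using (ℚ; ↥_; ↧_; ↧ₙ_)
import Data.Rational.Properties as ℚ
import Data.Sign.Base as Sign
open import Data.Sum.Base as Sum using (_⊎_; inj₁; inj₂; [_,_]′)
open import Defs using (IntegralDomain; module Polynomial; module Fraction; ⟨_⟩)
open import Function.Base using (_∘_)
open import Level using (Level; _⊔_) renaming (suc to lsuc)
open import Relation.Binary.PropositionalEquality as ≡ using (_≡_)
import Relation.Binary.Reasoning.Setoid as SetoidReasoning
open import Relation.Nullary using (¬_; contradiction)
open import Relation.Nullary.Decidable using (dec⇒maybe)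

-- Congruence modulo one factor `u` has to become an equation in a ring. That ring is the quotient
-- by `u` of the fractions whose denominators are nonzero at both specialisations: there `a q^r` is
-- `p^(-s)`, and an equality unpacks into an identity of fractions with an explicit cofactor.
-- Division in it is available only by explicit units, so the parity argument receives the inverse
-- of `p`, the inverted denominators and the cancellability of `1 - w p^(j-1)` as data. Setting one
-- variable to 0 sends every `1 - a b q^e` to 1, and `q = 2` keeps `q^e` and, for `e > 0`, `1 - q^e`
-- nonzero; so all denominators survive. Nonvanishing under a homomorphism into a domain passes to
-- products and to divisors. Together with the primality of the two factors it gives coprimality
-- without any gcd of polynomials. Primality of a factor comes from substituting its root, which
-- lies in the fraction field. The exponent `d - r + d t` may be negative, say `-N`; then the second
-- factor is `q^N - b` over `q^N`, and `q^N - b` takes its place.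

private
  variable
    c ℓ c′ ℓ′ c″ ℓ″ : Level

-- Ring solver with integer coefficients

module IntegerSolver (R : CommutativeRing c ℓ) where
  open CommutativeRing R
  open RingProperties ring using (-‿distribˡ-*; -‿distribʳ-*; -‿involutive; -0#≈0#)
  open AbelianGroupProperties +-abelianGroup using (⁻¹-∙-comm)
  open Mult semiring using (1+×; ×-homo-+; ×1-homo-*) renaming (_×_ to _×′_)
  open SetoidReasoning setoid

  -- Integer coefficients let `solve` cancel and subtract in any commutative ring, including the
  -- quotients below, for which no decision procedure for equality is at hand.
  ⟦_⟧ℤ : ℤ → Carrier
  ⟦ + n ⟧ℤ      = n ×′ 1#
  ⟦ -[1+ n ] ⟧ℤ = - (suc n ×′ 1#)

  private
    cancel-1 : ∀ x y → x - y ≈ (1# + x) - (1# + y)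
    cancel-1 x y = begin
      x - y                       ≈⟨ +-identityˡ _ ⟨
      0# + (x - y)                ≈⟨ +-congʳ (-‿inverseʳ 1#) ⟨
      (1# - 1#) + (x - y)         ≈⟨ +-assoc _ _ _ ⟩
      1# + (- 1# + (x - y))       ≈⟨ +-congˡ (+-assoc _ _ _) ⟨
      1# + ((- 1# + x) - y)       ≈⟨ +-congˡ (+-congʳ (+-comm _ _)) ⟩
      1# + ((x - 1#) - y)         ≈⟨ +-congˡ (+-assoc _ _ _) ⟩
      1# + (x + (- 1# - y))       ≈⟨ +-assoc _ _ _ ⟨
      (1# + x) + (- 1# - y)       ≈⟨ +-congˡ (⁻¹-∙-comm 1# y) ⟩
      (1# + x) - (1# + y)         ∎

    ⊖-homo : ∀ m n → ⟦ m ⊖ n ⟧ℤ ≈ m ×′ 1# - n ×′ 1#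
    ⊖-homo m       zero    = sym (trans (+-congˡ -0#≈0#) (+-identityʳ _))
    ⊖-homo zero    (suc n) = sym (+-identityˡ _)
    ⊖-homo (suc m) (suc n) = begin
      ⟦ suc m ⊖ suc n ⟧ℤ                 ≡⟨ ≡.cong ⟦_⟧ℤ (ℤ.[1+m]⊖[1+n]≡m⊖n m n) ⟩
      ⟦ m ⊖ n ⟧ℤ                         ≈⟨ ⊖-homo m n ⟩
      m ×′ 1# - n ×′ 1#                  ≈⟨ cancel-1 _ _ ⟩
      (1# + m ×′ 1#) - (1# + n ×′ 1#)    ≈⟨ +-cong (1+× m 1#) (-‿cong (1+× n 1#)) ⟨
      suc m ×′ 1# - suc n ×′ 1#          ∎

    +-homo : ∀ i j → ⟦ i ℤ.+ j ⟧ℤ ≈ ⟦ i ⟧ℤ + ⟦ j ⟧ℤ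
    +-homo (+ m)      (+ n)      = ×-homo-+ 1# m n
    +-homo (+ m)      -[1+ n ]   = ⊖-homo m (suc n)
    +-homo -[1+ m ]   (+ n)      = trans (⊖-homo n (suc m)) (+-comm _ _)
    +-homo -[1+ m ]   -[1+ n ]   = begin
      - (suc (suc (m ℕ.+ n)) ×′ 1#)       ≡⟨ ≡.cong (λ k → - (suc k ×′ 1#)) (ℕ.+-suc m n) ⟨
      - ((suc m ℕ.+ suc n) ×′ 1#)         ≈⟨ -‿cong (×-homo-+ 1# (suc m) (suc n)) ⟩
      - (suc m ×′ 1# + suc n ×′ 1#)       ≈⟨ ⁻¹-∙-comm _ _ ⟨
      - (suc m ×′ 1#) - suc n ×′ 1#       ∎

    -◃-homo : ∀ n → ⟦ Sign.- ℤ.◃ n ⟧ℤ ≈ - (n ×′ 1#)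
    -◃-homo zero    = sym -0#≈0#
    -◃-homo (suc n) = refl

    +◃-homo : ∀ n → ⟦ Sign.+ ℤ.◃ n ⟧ℤ ≈ n ×′ 1#
    +◃-homo n = reflexive (≡.cong ⟦_⟧ℤ (ℤ.+◃n≡+n n))

    *-homo : ∀ i j → ⟦ i ℤ.* j ⟧ℤ ≈ ⟦ i ⟧ℤ * ⟦ j ⟧ℤ
    *-homo (+ m)    (+ n)    = trans (+◃-homo (m ℕ.* n)) (×1-homo-* m n)
    *-homo (+ m)    -[1+ n ] = trans (-◃-homo (m ℕ.* suc n))
      (trans (-‿cong (×1-homo-* m (suc n))) (-‿distribʳ-* _ _))
    *-homo -[1+ m ] (+ n)    = trans (-◃-homo (suc m ℕ.* n))
      (trans (-‿cong (×1-homo-* (suc m) n)) (-‿distribˡ-* _ _))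
    *-homo -[1+ m ] -[1+ n ] = begin
      (suc m ℕ.* suc n) ×′ 1#                ≈⟨ ×1-homo-* (suc m) (suc n) ⟩
      (suc m ×′ 1#) * (suc n ×′ 1#)          ≈⟨ -‿involutive _ ⟨
      - - ((suc m ×′ 1#) * (suc n ×′ 1#))    ≈⟨ -‿cong (-‿distribˡ-* _ _) ⟩
      - (- (suc m ×′ 1#) * (suc n ×′ 1#))    ≈⟨ -‿distribʳ-* _ _ ⟩
      - (suc m ×′ 1#) * - (suc n ×′ 1#)      ∎

    -‿homo : ∀ i → ⟦ ℤ.- i ⟧ℤ ≈ - ⟦ i ⟧ℤ
    -‿homo (+ zero)   = sym -0#≈0#
    -‿homo (+ suc n)  = refl
    -‿homo -[1+ n ]   = sym (-‿involutive _)

    morphism : ℤ.+-*-rawRing -Raw-AlmostCommutative⟶ fromCommutativeRing R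
    morphism = record
      { ⟦_⟧    = ⟦_⟧ℤ
      ; +-homo = +-homo
      ; *-homo = *-homo
      ; -‿homo = -‿homo
      ; 0-homo = refl
      ; 1-homo = refl
      }

  open Algebra.Solver.Ring ℤ.+-*-rawRing (fromCommutativeRing R) morphism
    (λ i j → map (λ eq → reflexive (≡.cong ⟦_⟧ℤ eq)) (dec⇒maybe (i ℤ.≟ j))) public
    using (Polynomial; solve; _:=_; _:+_; _:*_; _:-_; :-_; con)

  :1 : ∀ {n} → Polynomial n
  :1 = con (+ 1)

-- The parity of the terminating sum

module FiniteSeries (K : CommutativeRing c ℓ) where
  open CommutativeRing K
  open Exp semiring using (_^_) public
  open MonoidSum +-monoid using (sum-syntax)

  poch : Carrier → Carrier → ℕ → Carrier
  poch p x zero    = 1#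
  poch p x (suc k) = poch p x k * (1# - x * p ^ k)

  -- Splits off the last term, as the induction on the number of terms in `recurrence` needs; the
  -- library sum splits off the first, and `∑≈Σ<` converts.
  Σ< : ℕ → (ℕ → Carrier) → Carrier
  Σ< zero    f = 0#
  Σ< (suc n) f = Σ< n f + f n

  Σ<-cong : ∀ n {f g} → (∀ k → f k ≈ g k) → Σ< n f ≈ Σ< n g
  Σ<-cong zero    f≈g = refl
  Σ<-cong (suc n) f≈g = +-cong (Σ<-cong n f≈g) (f≈g n)

  Σ<-front : ∀ n f → Σ< (suc n) f ≈ f 0 + Σ< n (f ∘ suc)
  Σ<-front zero    f = +-comm _ _
  Σ<-front (suc n) f = trans (+-congʳ (Σ<-front n f)) (+-assoc _ _ _)

  ∑≈Σ< : ∀ n f → ∑[ k < n ] f (toℕ k) ≈ Σ< n f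
  ∑≈Σ< zero    f = refl
  ∑≈Σ< (suc n) f = trans (+-congˡ (∑≈Σ< n (f ∘ suc))) (sym (Σ<-front n f))

module Signs (K : CommutativeRing c ℓ) where
  open CommutativeRing K
  open Exp semiring using (_^_; ^-homo-*; ^-assocʳ)
  open IntegerSolver K
  open SetoidReasoning setoid

  sign² : ∀ s → (- 1#) ^ s * (- 1#) ^ s ≈ 1#
  sign² zero    = *-identityˡ 1#
  sign² (suc s) = trans (solve 1 (λ e → (:- :1 :* e) :* (:- :1 :* e) := e :* e) refl _) (sign² s)

  -- Since `(-1)^t` squares to 1, `(-1)^s = (-1)^(s+t) (-1)^t`, and an even power of `-1` is 1.
  sign-parity : ∀ s t → 2 ℕ.∣ s ℕ.+ t → (- 1#) ^ s ≈ (- 1#) ^ t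
  sign-parity s t (ℕ.divides j s+t≡j*2) = begin
    ε s                      ≈⟨ *-identityʳ _ ⟨
    ε s * 1#                 ≈⟨ *-congˡ (sign² t) ⟨
    ε s * (ε t * ε t)        ≈⟨ *-assoc _ _ _ ⟨
    ε s * ε t * ε t          ≈⟨ *-congʳ (^-homo-* (- 1#) s t) ⟨
    ε (s ℕ.+ t) * ε t        ≡⟨ ≡.cong (λ k → ε k * ε t) s+t≡j*2 ⟩
    ε (j ℕ.* 2) * ε t        ≈⟨ *-congʳ (^-assocʳ (- 1#) j 2) ⟨
    ε j * (ε j * 1#) * ε t   ≈⟨ *-congʳ (trans (*-congˡ (*-identityʳ _)) (sign² j)) ⟩
    1# * ε t                 ≈⟨ *-identityˡ _ ⟩
    ε t                      ∎
    where
    ε : ℕ → Carrier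
    ε = (- 1#) ^_

module Parity (K : CommutativeRing c ℓ) where
  open CommutativeRing K
  open FiniteSeries K

  -- Data in place of division: `m` is the inverse of `p`, and `I k` stands for the inverse of
  -- `(p;p)_k (w;p²)_k`, given through the ratio of consecutive values.
  module _ (p m w : Carrier) (pm≈1 : p * m ≈ 1#)
    (I : ℕ → Carrier)
    (I-step : ∀ k → I k ≈ I (suc k) * ((1# - p * p ^ k) * (1# - w * (p * p) ^ k)))
    (cancel : ∀ j {x y} → (1# - w * m * p ^ j) * x ≈ (1# - w * m * p ^ j) * y → x ≈ y)
    where

    open CommutativeExp commutativeSemiring using (^-distrib-*)
    open IntegerSolver K
    open SetoidReasoning setoid

    private
      [_]_ : Carrier → ℕ → Carrier
      [ x ] k = poch p x k

      infix 9 [_]_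

    poch-cong : ∀ {x y} k → x ≈ y → [ x ] k ≈ [ y ] k
    poch-cong zero    x≈y = refl
    poch-cong (suc k) x≈y = *-cong (poch-cong k x≈y) (+-congˡ (-‿cong (*-congʳ x≈y)))

    poch-front : ∀ x k → [ x ] (suc k) ≈ (1# - x) * [ x * p ] k
    poch-front x zero    = solve 1 (λ x → :1 :* (:1 :- x :* :1) := (:1 :- x) :* :1) refl x
    poch-front x (suc k) = trans (*-congʳ (poch-front x k))
      (solve 4 (λ x p Q α → ((:1 :- x) :* α) :* (:1 :- x :* (p :* Q))
        := (:1 :- x) :* (α :* (:1 :- x :* p :* Q))) refl x p (p ^ k) ([ x * p ] k))

    poch-front₂ : ∀ x k → [ x ] (suc (suc k)) ≈ (1# - x) * ((1# - x * p) * [ x * p * p ] k)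
    poch-front₂ x k = trans (poch-front x (suc k)) (*-congˡ (poch-front (x * p) k))

    -- In the notation of the header, Z = p^(-s-1) and U = w p^(s-2).
    coefficient : ∀ Z U → w ≈ U * Z * (p * p * p) → ∀ k →
      Z * (1# - U * p) * ([ Z ] (suc k) * [ U * p * p ] (suc k)) * p ^ suc k
      ≈ (Z - U) * ([ Z * p ] (suc k) * [ U * p ] (suc k)
                   - [ Z * p ] k * [ U * p ] k * ((1# - p * p ^ k) * (1# - w * (p * p) ^ k)))
        + U * (1# - Z * p) * ([ Z * p * p ] (suc k) * [ U ] (suc k)) * p ^ suc k
    -- Here `(Z;p)_(k+1)` has a single factor, so the two front factors that are split off in the
    -- other case do not exist.
    coefficient Z U eq zero = trans
      (solve 3 (λ Z U p →
          Z :* (:1 :- U :* p) :* ((:1 :* (:1 :- Z :* :1)) :* (:1 :* (:1 :- U :* p :* p :* :1))) :* (p :* :1)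
       := (Z :- U) :* ((:1 :* (:1 :- Z :* p :* :1)) :* (:1 :* (:1 :- U :* p :* :1))
                :- :1 :* :1 :* ((:1 :- p :* :1) :* (:1 :- U :* Z :* (p :* p :* p) :* :1)))
          :+ U :* (:1 :- Z :* p) :* ((:1 :* (:1 :- Z :* p :* p :* :1)) :* (:1 :* (:1 :- U :* :1))) :* (p :* :1))
        refl Z U p)
      (+-congʳ (*-congˡ (+-congˡ (-‿cong (*-congˡ (*-congˡ (+-congˡ (-‿cong (*-congʳ (sym eq))))))))))
    -- Each shifted factorial is `α` or `β` times linear factors; once these are split off, the
    -- claim is a polynomial identity in six unknowns.
    coefficient Z U eq (suc k) = begin
      Z * (1# - U * p) * ([ Z ] (2+ k) * [ U * p * p ] (2+ k)) * (p * (p * Q))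
        ≈⟨ *-congʳ (*-congˡ (*-congʳ (poch-front₂ Z k))) ⟩
      Z * (1# - U * p) * (((1# - Z) * ((1# - Z * p) * α))
        * (β * (1# - U * p * p * Q) * (1# - U * p * p * (p * Q)))) * (p * (p * Q))
        ≈⟨ solve 6 (λ Z U p Q α β →
            Z :* (:1 :- U :* p) :* (((:1 :- Z) :* ((:1 :- Z :* p) :* α))
            :* (β :* (:1 :- U :* p :* p :* Q) :* (:1 :- U :* p :* p :* (p :* Q)))) :* (p :* (p :* Q))
         := (Z :- U) :* (((:1 :- Z :* p) :* α) :* (:1 :- Z :* p :* (p :* Q))
                         :* (((:1 :- U :* p) :* β) :* (:1 :- U :* p :* (p :* Q)))
                  :- ((:1 :- Z :* p) :* α) :* ((:1 :- U :* p) :* β) :*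
                      ((:1 :- p :* (p :* Q)) :* (:1 :- U :* Z :* (p :* p :* p) :* ((p :* Q) :* (p :* Q)))))
            :+ U :* (:1 :- Z :* p) :* ((α :* (:1 :- Z :* p :* p :* Q) :* (:1 :- Z :* p :* p :* (p :* Q)))
              :* ((:1 :- U) :* ((:1 :- U :* p) :* β))) :* (p :* (p :* Q)))
            refl Z U p Q α β ⟩
      (Z - U) * (((1# - Z * p) * α) * (1# - Z * p * (p * Q))
                 * (((1# - U * p) * β) * (1# - U * p * (p * Q)))
            - ((1# - Z * p) * α) * ((1# - U * p) * β) *
                ((1# - p * (p * Q)) * (1# - U * Z * (p * p * p) * ((p * Q) * (p * Q)))))
        + U * (1# - Z * p) * ((α * (1# - Z * p * p * Q) * (1# - Z * p * p * (p * Q)))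
              * ((1# - U) * ((1# - U * p) * β))) * (p * (p * Q))
        ≈⟨ +-cong (*-congˡ (+-cong (*-cong (*-congʳ (poch-front (Z * p) k)) (*-congʳ (poch-front (U * p) k)))
             (-‿cong (*-cong (*-cong (poch-front (Z * p) k) (poch-front (U * p) k))
               (*-congˡ (+-congˡ (-‿cong (*-cong eq (^-distrib-* p p (suc k))))))))))
             (*-congʳ (*-congˡ (*-congˡ (poch-front₂ U k)))) ⟨
      _ ∎
      where
      2+ : ℕ → ℕ
      2+ k = suc (suc k)
      Q α β : Carrier
      Q = p ^ k
      α = [ Z * p * p ] k
      β = [ U * p * p ] k

    -- The recurrence relates the pairs `(Z, U p²)`, `(Z p, U p)` and `(Z p², U)`. They have the
    -- same product, which is `w / p²` times `p`, so one `w` and one `I` serve all three sums.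
    term : Carrier → Carrier → Carrier → ℕ → Carrier
    term A B y k = [ A ] k * [ B ] k * [ y ] k * p ^ k * I k

    -- Multiplication by y acts through y p^k (y;p)_k = (y;p)_k - (y;p)_(k+1); the truncation of the
    -- sums leaves a boundary term, which vanishes once n > s.
    recurrence : ∀ Z U → w ≈ U * Z * (p * p * p) → ∀ y n →
      Z * (1# - U * p) * Σ< (suc n) (term Z (U * p * p) y)
      ≈ (Z - U) * (y * Σ< (suc n) (term (Z * p) (U * p) y)
                   + [ Z * p ] n * [ U * p ] n * I n * [ y ] (suc n))
        + U * (1# - Z * p) * Σ< (suc n) (term (Z * p * p) U y)
    recurrence Z U eq y zero =
      solve 5 (λ Z U p y i → let one = :1 :* :1 :* :1 :* :1 :* i; o = con (+ 0) in
           Z :* (:1 :- U :* p) :* (o :+ one)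
        := (Z :- U) :* (y :* (o :+ one) :+ :1 :* :1 :* i :* (:1 :* (:1 :- y :* :1)))
           :+ U :* (:1 :- Z :* p) :* (o :+ one))
        refl Z U p y (I 0)
    recurrence Z U eq y (suc n) = begin
      Z * (1# - U * p) * (S₁ + X₁ * Y₁ * y′ * P * I′)
        ≈⟨ solve 7 (λ c S X Y y P I → c :* (S :+ X :* Y :* y :* P :* I) := c :* S :+ c :* (X :* Y) :* P :* (y :* I))
             refl (Z * (1# - U * p)) S₁ X₁ Y₁ y′ P I′ ⟩
      Z * (1# - U * p) * S₁ + Z * (1# - U * p) * (X₁ * Y₁) * P * (y′ * I′)
        ≈⟨ +-cong (recurrence Z U eq y n) (*-congʳ (coefficient Z U eq n)) ⟩
      (Z - U) * (y * S₂ + e * I n * y′) + U * (1# - Z * p) * S₃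
        + ((Z - U) * (e₂ - e * δ) + U * (1# - Z * p) * e₃ * P) * (y′ * I′)
        -- Over the denominator of `I (suc n)` the old boundary term cancels against `e * δ`; the
        -- remaining `e₂` is split by `1 = y P + (1 - y P)` into a new summand and the new boundary
        -- term.
        ≈⟨ +-congʳ (+-congʳ (*-congˡ (+-congˡ (*-congʳ (*-congˡ (I-step n)))))) ⟩
      (Z - U) * (y * S₂ + e * (I′ * δ) * y′) + U * (1# - Z * p) * S₃
        + ((Z - U) * (e₂ - e * δ) + U * (1# - Z * p) * e₃ * P) * (y′ * I′)
        ≈⟨ solve 12 (λ D C y S₂ S₃ e δ y′ P I′ e₂ e₃ →
             D :* (y :* S₂ :+ e :* (I′ :* δ) :* y′) :+ C :* S₃
               :+ (D :* (e₂ :- e :* δ) :+ C :* e₃ :* P) :* (y′ :* I′)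
          := D :* (y :* (S₂ :+ e₂ :* y′ :* P :* I′) :+ e₂ :* I′ :* (y′ :* (:1 :- y :* P)))
               :+ C :* (S₃ :+ e₃ :* y′ :* P :* I′))
             refl (Z - U) (U * (1# - Z * p)) y S₂ S₃ e δ y′ P I′ e₂ e₃ ⟩
      _ ∎
      where
      S₁ S₂ S₃ X₁ Y₁ y′ P I′ e e₂ e₃ δ : Carrier
      S₁ = Σ< (suc n) (term Z (U * p * p) y)
      S₂ = Σ< (suc n) (term (Z * p) (U * p) y)
      S₃ = Σ< (suc n) (term (Z * p * p) U y)
      X₁ = [ Z ] (suc n)
      Y₁ = [ U * p * p ] (suc n)
      y′ = [ y ] (suc n)
      P  = p ^ suc n
      I′ = I (suc n)
      e  = [ Z * p ] n * [ U * p ] n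
      e₂ = [ Z * p ] (suc n) * [ U * p ] (suc n)
      e₃ = [ Z * p * p ] (suc n) * [ U ] (suc n)
      δ  = (1# - p * p ^ n) * (1# - w * (p * p) ^ n)

    term-cong : ∀ {A A′ B B′} y → A ≈ A′ → B ≈ B′ → ∀ k → term A B y k ≈ term A′ B′ y k
    term-cong y A≈ B≈ k = *-congʳ (*-congʳ (*-congʳ (*-cong (poch-cong k A≈) (poch-cong k B≈))))

    m^k*p^k≈1 : ∀ k → m ^ k * p ^ k ≈ 1#
    m^k*p^k≈1 zero    = *-identityˡ 1#
    m^k*p^k≈1 (suc k) = begin
      m * m ^ k * (p * p ^ k)      ≈⟨ solve 4 (λ m M p P → m :* M :* (p :* P) := p :* m :* (M :* P)) refl m (m ^ k) p (p ^ k) ⟩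
      p * m * (m ^ k * p ^ k)      ≈⟨ *-cong pm≈1 (m^k*p^k≈1 k) ⟩
      1# * 1#                      ≈⟨ *-identityˡ 1# ⟩
      1#                           ∎

    -- The factor of index `s` is `1 - m^s p^s = 0`; this is the termination of the sum.
    poch-vanishes : ∀ {s k} → s < k → [ m ^ s ] k ≈ 0#
    poch-vanishes {s} {suc k} (s≤s s≤k) with ℕ.m≤n⇒m<n∨m≡n s≤k
    ... | inj₁ s<k    = trans (*-congʳ (poch-vanishes s<k)) (zeroˡ _)
    ... | inj₂ ≡.refl = trans (*-congˡ (trans (+-congˡ (-‿cong (m^k*p^k≈1 k))) (-‿inverseʳ 1#))) (zeroʳ _)

    Alternates : ℕ → (Carrier → Carrier) → Set (c ⊔ ℓ)
    Alternates s f = ∀ y → f (- y) ≈ (- 1#) ^ s * f y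

    -- `m ^ s` is `p^(-s)`, and the second parameter is the `B` that `w = A B p` then forces.
    F : ℕ → ℕ → Carrier → Carrier
    F n s y = Σ< n (term (m ^ s) (w * m * p ^ s) y)

    -- For `s = 0` only the term `k = 0` can survive, and it does not contain `y`.
    F₀-alternates : ∀ n → Alternates 0 (F n 0)
    F₀-alternates n y = trans (Σ<-cong n agree) (sym (*-identityˡ _))
      where
      vanish : ∀ z k → term (m ^ 0) (w * m * p ^ 0) z (suc k) ≈ 0#
      vanish z k = trans (*-congʳ (*-congʳ (*-congʳ (*-congʳ (poch-vanishes {0} {suc k} (s≤s z≤n))))))
        (solve 4 (λ b y P I → con (+ 0) :* b :* y :* P :* I := con (+ 0)) refl _ _ _ _)
      agree : ∀ k → term (m ^ 0) (w * m * p ^ 0) (- y) k ≈ term (m ^ 0) (w * m * p ^ 0) y k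
      agree zero    = refl
      agree (suc k) = trans (vanish (- y) k) (sym (vanish y k))

    -- Multiplication by `y` contributes one more sign. The premise on the sum of index `s - 1`
    -- includes its coefficient, so that it also makes sense for `s = 0`, where `1 - Z p` vanishes.
    step : ∀ {n s} → s < n → Alternates s (F (suc n) s) →
      let Z = m * m ^ s; U = w * m * m * p ^ s in
      Alternates (suc s) (λ y → U * (1# - Z * p) * Σ< (suc n) (term (Z * p * p) U y)) →
      Alternates (suc s) (F (suc n) (suc s))
    step {n} {s} s<n F-alt G-alt y = cancel s (begin
      D * F (suc n) (suc s) (- y)
        ≈⟨ unit (F (suc n) (suc s) (- y)) ⟩
      p ^ suc s * (Z * (1# - U * p) * F (suc n) (suc s) (- y))
        ≈⟨ *-congˡ (rec (- y)) ⟩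
      p ^ suc s * ((Z - U) * (- y * F (suc n) s (- y)) + G (- y))
        ≈⟨ *-congˡ (+-cong (*-congˡ (*-congˡ (F-alt y))) (G-alt y)) ⟩
      p ^ suc s * ((Z - U) * (- y * (ε * F (suc n) s y)) + - 1# * ε * G y)
        ≈⟨ solve 6 (λ P D y ε f g → P :* (D :* (:- y :* (ε :* f)) :+ :- :1 :* ε :* g)
             := :- :1 :* ε :* (P :* (D :* (y :* f) :+ g))) refl (p ^ suc s) (Z - U) y ε (F (suc n) s y) (G y) ⟩
      - 1# * ε * (p ^ suc s * ((Z - U) * (y * F (suc n) s y) + G y))
        ≈⟨ *-congˡ (*-congˡ (rec y)) ⟨
      - 1# * ε * (p ^ suc s * (Z * (1# - U * p) * F (suc n) (suc s) y))
        ≈⟨ *-congˡ (unit (F (suc n) (suc s) y)) ⟨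
      - 1# * ε * (D * F (suc n) (suc s) y)
        ≈⟨ solve 3 (λ e D f → e :* (D :* f) := D :* (e :* f)) refl (- 1# * ε) D (F (suc n) (suc s) y) ⟩
      D * (- 1# * ε * F (suc n) (suc s) y) ∎)
      where
      Z U D ε : Carrier
      Z = m * m ^ s
      U = w * m * m * p ^ s
      D = 1# - w * m * p ^ s
      ε = (- 1#) ^ s
      G : Carrier → Carrier
      G y = U * (1# - Z * p) * Σ< (suc n) (term (Z * p * p) U y)

      Zp≈ : Z * p ≈ m ^ s
      Zp≈ = begin
        m * m ^ s * p   ≈⟨ solve 3 (λ m M p → m :* M :* p := p :* m :* M) refl m (m ^ s) p ⟩
        p * m * m ^ s   ≈⟨ *-congʳ pm≈1 ⟩
        1# * m ^ s      ≈⟨ *-identityˡ _ ⟩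
        m ^ s           ∎

      Up≈ : U * p ≈ w * m * p ^ s
      Up≈ = begin
        w * m * m * p ^ s * p     ≈⟨ solve 4 (λ w m P p → w :* m :* m :* P :* p := p :* m :* (w :* m :* P)) refl w m (p ^ s) p ⟩
        p * m * (w * m * p ^ s)   ≈⟨ *-congʳ pm≈1 ⟩
        1# * (w * m * p ^ s)      ≈⟨ *-identityˡ _ ⟩
        w * m * p ^ s             ∎

      Upp≈ : U * p * p ≈ w * m * p ^ suc s
      Upp≈ = trans (*-congʳ Up≈) (solve 4 (λ w m P p → w :* m :* P :* p := w :* m :* (p :* P)) refl w m (p ^ s) p)

      w≈ : w ≈ U * Z * (p * p * p)
      w≈ = sym (begin
        U * Z * (p * p * p)         ≈⟨ solve 3 (λ U Z p → U :* Z :* (p :* p :* p) := U :* p :* (Z :* p) :* p) refl U Z p ⟩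
        U * p * (Z * p) * p         ≈⟨ *-congʳ (*-cong Up≈ Zp≈) ⟩
        w * m * p ^ s * m ^ s * p   ≈⟨ solve 5 (λ w m P M p → w :* m :* P :* M :* p := (M :* P) :* (p :* m) :* w) refl w m (p ^ s) (m ^ s) p ⟩
        m ^ s * p ^ s * (p * m) * w ≈⟨ *-congʳ (*-cong (m^k*p^k≈1 s) pm≈1) ⟩
        1# * 1# * w                 ≈⟨ solve 1 (λ w → :1 :* :1 :* w := w) refl w ⟩
        w                           ∎)

      -- Multiplying by `p^(s+1)` clears the negative power `Z` and leaves `1 - w p^(s-1)`, which
      -- `cancel` can remove.
      unit : ∀ x → D * x ≈ p ^ suc s * (Z * (1# - U * p) * x)
      unit x = sym (begin
        p ^ suc s * (Z * (1# - U * p) * x)    ≈⟨ solve 4 (λ P Z d x → P :* (Z :* d :* x) := Z :* P :* (d :* x)) refl _ _ _ _ ⟩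
        Z * p ^ suc s * ((1# - U * p) * x)    ≈⟨ *-cong (m^k*p^k≈1 (suc s)) (*-congʳ (+-congˡ (-‿cong Up≈))) ⟩
        1# * (D * x)                          ≈⟨ *-identityˡ _ ⟩
        D * x                                 ∎)

      rec : ∀ y → Z * (1# - U * p) * F (suc n) (suc s) y ≈ (Z - U) * (y * F (suc n) s y) + G y
      rec y = begin
        Z * (1# - U * p) * F (suc n) (suc s) y
          ≈⟨ *-congˡ (Σ<-cong (suc n) (term-cong y refl (sym Upp≈))) ⟩
        Z * (1# - U * p) * Σ< (suc n) (term Z (U * p * p) y)
          ≈⟨ recurrence Z U w≈ y n ⟩
        (Z - U) * (y * Σ< (suc n) (term (Z * p) (U * p) y) + [ Z * p ] n * [ U * p ] n * I n * [ y ] (suc n)) + G y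
          -- The boundary term contains `(p^(-s);p)_n`, which is 0 because `s < n`.
          ≈⟨ +-congʳ (*-congˡ (+-cong (*-congˡ (Σ<-cong (suc n) (term-cong y Zp≈ Up≈)))
               (trans (*-congʳ (*-congʳ (*-congʳ (trans (poch-cong n Zp≈) (poch-vanishes s<n)))))
                 (solve 3 (λ u i y → con (+ 0) :* u :* i :* y := con (+ 0)) refl _ _ _)))) ⟩
        (Z - U) * (y * F (suc n) s y + 0#) + G y
          ≈⟨ +-congʳ (*-congˡ (+-identityʳ _)) ⟩
        (Z - U) * (y * F (suc n) s y) + G y ∎

    F-alternates : ∀ {n s} → s < n → Alternates s (F n s)
    F-alternates {suc n} {zero}        _         = F₀-alternates (suc n)
    F-alternates {suc n} {suc zero}    (s≤s 0<n) = step 0<n (F₀-alternates (suc n)) λ y →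
      trans (vanish (- y)) (sym (trans (*-congˡ (vanish y)) (zeroʳ _)))
      where
      vanish : ∀ y → w * m * m * 1# * (1# - m * 1# * p) * Σ< (suc n) (term (m * 1# * p * p) (w * m * m * 1#) y) ≈ 0#
      vanish y = trans (*-congʳ (*-congˡ (trans (+-congˡ (-‿cong
        (trans (solve 2 (λ m p → m :* :1 :* p := p :* m) refl m p) pm≈1))) (-‿inverseʳ 1#))))
        (solve 2 (λ u f → u :* con (+ 0) :* f := con (+ 0)) refl _ _)
    F-alternates {suc n} {suc (suc s)} (s≤s s<n) =
      step s<n (F-alternates (ℕ.m<n⇒m<1+n s<n)) λ y → begin
        C * Σ< (suc n) (term (Z * p * p) U (- y))  ≈⟨ *-congˡ (G≈F (- y)) ⟩
        C * F (suc n) s (- y)                      ≈⟨ *-congˡ (F-alternates (ℕ.<-trans (ℕ.n<1+n s) (ℕ.m<n⇒m<1+n s<n)) y) ⟩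
        C * (ε * F (suc n) s y)                    ≈⟨ solve 3 (λ C ε f → C :* (ε :* f) := :- :1 :* (:- :1 :* ε) :* (C :* f)) refl C ε (F (suc n) s y) ⟩
        - 1# * (- 1# * ε) * (C * F (suc n) s y)    ≈⟨ *-congˡ (*-congˡ (G≈F y)) ⟨
        - 1# * (- 1# * ε) * (C * Σ< (suc n) (term (Z * p * p) U y)) ∎
      where
      Z U C ε : Carrier
      Z = m * (m * m ^ s)
      U = w * m * m * (p * p ^ s)
      C = U * (1# - Z * p)
      ε = (- 1#) ^ s
      G≈F : ∀ y → Σ< (suc n) (term (Z * p * p) U y) ≈ F (suc n) s y
      G≈F y = Σ<-cong (suc n) (term-cong y
        (begin
          m * (m * m ^ s) * p * p      ≈⟨ solve 3 (λ m M p → m :* (m :* M) :* p :* p := (p :* m) :* (p :* m) :* M) refl m (m ^ s) p ⟩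
          (p * m) * (p * m) * m ^ s    ≈⟨ *-congʳ (*-cong pm≈1 pm≈1) ⟩
          1# * 1# * m ^ s              ≈⟨ solve 1 (λ w → :1 :* :1 :* w := w) refl (m ^ s) ⟩
          m ^ s                        ∎)
        (begin
          w * m * m * (p * p ^ s)      ≈⟨ solve 4 (λ w m P p → w :* m :* m :* (p :* P) := p :* m :* (w :* m :* P)) refl w m (p ^ s) p ⟩
          p * m * (w * m * p ^ s)      ≈⟨ *-congʳ pm≈1 ⟩
          1# * (w * m * p ^ s)         ≈⟨ *-identityˡ _ ⟩
          w * m * p ^ s                ∎))

    sum-alternates : ∀ {n s A B} → s < n → A * p ^ s ≈ 1# → w ≈ A * B * p →
      Alternates s (λ y → Σ< n (term A B y))
    sum-alternates {n} {s} {A} {B} s<n Ap^s≈1 w≈ABp y = begin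
      Σ< n (term A B (- y))        ≈⟨ Σ<-cong n (term-cong (- y) A≈ B≈) ⟩
      F n s (- y)                  ≈⟨ F-alternates s<n y ⟩
      (- 1#) ^ s * F n s y         ≈⟨ *-congˡ (Σ<-cong n (term-cong y A≈ B≈)) ⟨
      (- 1#) ^ s * Σ< n (term A B y) ∎
      where
      A≈ : A ≈ m ^ s
      A≈ = begin
        A                      ≈⟨ *-identityʳ A ⟨
        A * 1#                 ≈⟨ *-congˡ (m^k*p^k≈1 s) ⟨
        A * (m ^ s * p ^ s)    ≈⟨ solve 3 (λ A M P → A :* (M :* P) := A :* P :* M) refl A (m ^ s) (p ^ s) ⟩
        A * p ^ s * m ^ s      ≈⟨ *-congʳ Ap^s≈1 ⟩
        1# * m ^ s             ≈⟨ *-identityˡ _ ⟩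
        m ^ s                  ∎
      B≈ : B ≈ w * m * p ^ s
      B≈ = sym (begin
        w * m * p ^ s             ≈⟨ *-congʳ (*-congʳ w≈ABp) ⟩
        A * B * p * m * p ^ s     ≈⟨ solve 5 (λ A B p m P → A :* B :* p :* m :* P := (A :* P) :* (p :* m) :* B) refl A B p m (p ^ s) ⟩
        A * p ^ s * (p * m) * B   ≈⟨ *-congʳ (*-cong Ap^s≈1 pm≈1) ⟩
        1# * 1# * B               ≈⟨ solve 1 (λ w → :1 :* :1 :* w := w) refl B ⟩
        B                         ∎)

-- Homomorphisms and polynomial evaluation

IsHom : (R : CommutativeRing c ℓ) (T : CommutativeRing c′ ℓ′) →
  (CommutativeRing.Carrier R → CommutativeRing.Carrier T) → Set (c ⊔ ℓ ⊔ ℓ′)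
IsHom R T = RingMorphisms.IsRingHomomorphism (CommutativeRing.rawRing R) (CommutativeRing.rawRing T)

module _ (R : CommutativeRing c ℓ) (T : CommutativeRing c′ ℓ′) where
  private
    module R = CommutativeRing R
    module T = CommutativeRing T

  -- In a group, additivity already forces the values at 0 and at negatives.
  isHom : {f : R.Carrier → T.Carrier} → (∀ {x y} → x R.≈ y → f x T.≈ f y) →
    (∀ x y → f (x R.+ y) T.≈ f x T.+ f y) → (∀ x y → f (x R.* y) T.≈ f x T.* f y) →
    f R.1# T.≈ T.1# → IsHom R T f
  isHom {f} cong +-homo *-homo 1-homo = record
    { isSemiringHomomorphism = record
      { isNearSemiringHomomorphism = record
        { +-isMonoidHomomorphism = record
          { isMagmaHomomorphism = record
            { isRelHomomorphism = record { cong = cong }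
            ; homo = +-homo
            }
          ; ε-homo = 0-homo
          }
        ; *-homo = *-homo
        }
      ; 1#-homo = 1-homo
      }
    ; -‿homo = λ x → inverseˡ-unique _ _
        (T.trans (T.sym (+-homo (R.- x) x)) (T.trans (cong (R.-‿inverseˡ x)) 0-homo))
    }
    where
    open GroupProperties T.+-group using (identityˡ-unique; inverseˡ-unique)
    0-homo : f R.0# T.≈ T.0#
    0-homo = identityˡ-unique _ _ (T.trans (T.sym (+-homo R.0# R.0#)) (cong (R.+-identityˡ R.0#)))

∘-isHom : (R : CommutativeRing c ℓ) (S : CommutativeRing c′ ℓ′) (T : CommutativeRing c″ ℓ″) →
  ∀ {f g} → IsHom R S f → IsHom S T g → IsHom R T (g ∘ f)
∘-isHom R S T = Composition.isRingHomomorphism {R₁ = CommutativeRing.rawRing R}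
  {R₂ = CommutativeRing.rawRing S} {R₃ = CommutativeRing.rawRing T} (CommutativeRing.trans T)

module _ (R : CommutativeRing c ℓ) (T : CommutativeRing c′ ℓ′) {f} (f-isHom : IsHom R T f) where
  private
    module R = CommutativeRing R
    module T = CommutativeRing T
    module f = RingMorphisms.IsRingHomomorphism f-isHom

  ^-homo : ∀ x k → f (FiniteSeries._^_ R x k) T.≈ FiniteSeries._^_ T (f x) k
  ^-homo x zero    = f.1#-homo
  ^-homo x (suc k) = T.trans (f.*-homo x _) (T.*-congˡ (^-homo x k))

module Evaluation (R : IntegralDomain c ℓ) (T : CommutativeRing c′ ℓ′) where
  private
    module R = IntegralDomain R
    module T = CommutativeRing T
    module R[t] where
      open Polynomial R public
      open CommutativeRing commutativeRing public using (sym)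
  open R[t] using (Poly; at; _+_; _*_; _·_; const; var) renaming (_≈_ to _≈ᴾ_)

  module _ (φ : R.Carrier → T.Carrier) (φ-hom : IsHom R.commutativeRing T φ) (t : T.Carrier) where
    private module φ = RingMorphisms.IsRingHomomorphism φ-hom
    open IntegerSolver T
    open SetoidReasoning T.setoid

    eval : Poly → T.Carrier
    eval []      = T.0#
    eval (x ∷ p) = φ x T.+ t T.* eval p

    private
      eval-∷-zero : ∀ {x y} → φ x T.≈ T.0# → y T.≈ T.0# → φ x T.+ t T.* y T.≈ T.0#
      eval-∷-zero x≈0 y≈0 = T.trans (T.+-cong x≈0 (T.trans (T.*-congˡ y≈0) (T.zeroʳ t))) (T.+-identityˡ _)

      tail : ∀ {x p y q} → (x ∷ p) ≈ᴾ (y ∷ q) → p ≈ᴾ q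
      at (tail eq) i = at eq (suc i)

      eval-zero : ∀ p → p ≈ᴾ [] → eval p T.≈ T.0#
      eval-zero []      eq = T.refl
      eval-zero (x ∷ p) eq = eval-∷-zero (T.trans (φ.⟦⟧-cong (at eq zero)) φ.0#-homo)
        (eval-zero p (R[t].coeffwise λ i → at eq (suc i)))

    eval-cong : ∀ p q → p ≈ᴾ q → eval p T.≈ eval q
    eval-cong []      q       eq = T.sym (eval-zero q (R[t].sym {[]} {q} eq))
    eval-cong (x ∷ p) []      eq = eval-zero (x ∷ p) eq
    eval-cong (x ∷ p) (y ∷ q) eq =
      T.+-cong (φ.⟦⟧-cong (at eq zero)) (T.*-congˡ (eval-cong p q (tail {x} {p} {y} {q} eq)))

    eval-+ : ∀ p q → eval (p + q) T.≈ eval p T.+ eval q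
    eval-+ []      q       = T.sym (T.+-identityˡ _)
    eval-+ (x ∷ p) []      = T.sym (T.+-identityʳ _)
    eval-+ (x ∷ p) (y ∷ q) = T.trans (T.+-cong (φ.+-homo x y) (T.*-congˡ (eval-+ p q)))
      (solve 5 (λ x y t p q → (x :+ y) :+ t :* (p :+ q) := (x :+ t :* p) :+ (y :+ t :* q))
        T.refl (φ x) (φ y) t (eval p) (eval q))

    eval-· : ∀ x p → eval (x · p) T.≈ φ x T.* eval p
    eval-· x []      = T.sym (T.zeroʳ _)
    eval-· x (y ∷ p) = T.trans (T.+-cong (φ.*-homo x y) (T.*-congˡ (eval-· x p)))
      (solve 4 (λ x y t p → x :* y :+ t :* (x :* p) := x :* (y :+ t :* p)) T.refl (φ x) (φ y) t (eval p))

    eval-* : ∀ p q → eval (p * q) T.≈ eval p T.* eval q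
    eval-* []      q = T.sym (T.zeroˡ _)
    eval-* (x ∷ p) q = begin
      eval (x · q + (R.0# ∷ p * q))
        ≈⟨ eval-+ (x · q) (R.0# ∷ p * q) ⟩
      eval (x · q) T.+ (φ R.0# T.+ t T.* eval (p * q))
        ≈⟨ T.+-cong (eval-· x q) (T.+-cong φ.0#-homo (T.*-congˡ (eval-* p q))) ⟩
      φ x T.* eval q T.+ (T.0# T.+ t T.* (eval p T.* eval q))
        ≈⟨ solve 4 (λ x q t p → x :* q :+ (con (+ 0) :+ t :* (p :* q)) := (x :+ t :* p) :* q)
             T.refl (φ x) (eval q) t (eval p) ⟩
      (φ x T.+ t T.* eval p) T.* eval q ∎

    eval-const : ∀ x → eval (const x) T.≈ φ x
    eval-const x = T.trans (T.+-congˡ (T.zeroʳ t)) (T.+-identityʳ _)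

    eval-var : eval var T.≈ t
    eval-var = begin
      φ R.0# T.+ t T.* eval (const R.1#)  ≈⟨ T.+-cong φ.0#-homo (T.*-congˡ (T.trans (eval-const R.1#) φ.1#-homo)) ⟩
      T.0# T.+ t T.* T.1#                 ≈⟨ solve 1 (λ t → con (+ 0) :+ t :* :1 := t) T.refl t ⟩
      t                                   ∎

    eval-isHom : IsHom R[t].commutativeRing T eval
    eval-isHom = isHom R[t].commutativeRing T (λ {p} {q} → eval-cong p q) eval-+ eval-*
      (T.trans (eval-const R.1#) φ.1#-homo)

module PolynomialProperties (R : IntegralDomain c ℓ) where
  private
    module R = IntegralDomain R
  open Polynomial R
  open CommutativeRing commutativeRing
    using (setoid; refl; +-congˡ; +-congʳ; +-assoc; *-congʳ; *-identityˡ)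
  open SetoidReasoning setoid

  private
    ∷-cong : ∀ {x y p q} → x R.≈ y → p ≈ q → x ∷ p ≈ y ∷ q
    at (∷-cong x≈y p≈q) zero    = x≈y
    at (∷-cong x≈y p≈q) (suc i) = at p≈q i

    [0]≈[] : const R.0# ≈ []
    at [0]≈[] zero    = R.refl
    at [0]≈[] (suc i) = R.refl

    ∷-split : ∀ x p → const x + var * p ≈ x ∷ p
    ∷-split x p = begin
      const x + var * p
        ≈⟨ +-congˡ {const x} (+-congˡ {R.0# · p} (∷-cong (R.sym (R.+-identityˡ R.0#)) (*-identityˡ p))) ⟩
      const x + (R.0# · p + (const R.0# + (R.0# ∷ p)))
        ≈⟨ +-congˡ {const x} (+-assoc (R.0# · p) (const R.0#) (R.0# ∷ p)) ⟨
      const x + (const R.0# * p + (R.0# ∷ p))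
        ≈⟨ +-congˡ {const x} (+-congʳ {R.0# ∷ p} (*-congʳ {p} [0]≈[])) ⟩
      (x R.+ R.0#) ∷ p
        ≈⟨ ∷-cong (R.+-identityʳ x) (refl {p}) ⟩
      x ∷ p ∎

  const-isHom : IsHom R.commutativeRing commutativeRing const
  const-isHom = isHom R.commutativeRing commutativeRing (λ x≈y → ∷-cong x≈y (refl {[]})) (λ x y → refl {const (x R.+ y)})
    (λ x y → ∷-cong (R.sym (R.+-identityʳ _)) (refl {[]})) (refl {const R.1#})

  -- A list `x ∷ p` is `const x + var * p` only up to `≈`, hence the premise that `Q` respects `≈`.
  Poly-induction : ∀ {r} (Q : Poly → Set r) → (∀ {p p′} → p ≈ p′ → Q p → Q p′) →
    (∀ x → Q (const x)) → Q var → (∀ {p p′} → Q p → Q p′ → Q (p + p′)) →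
    (∀ {p p′} → Q p → Q p′ → Q (p * p′)) → ∀ p → Q p
  Poly-induction Q resp q-const q-var q-+ q-* []      = resp [0]≈[] (q-const R.0#)
  Poly-induction Q resp q-const q-var q-+ q-* (x ∷ p) = resp (∷-split x p)
    (q-+ (q-const x) (q-* q-var (Poly-induction Q resp q-const q-var q-+ q-* p)))

-- Quotients, fraction fields and kernels

module Quotient (R : CommutativeRing c ℓ) (u : CommutativeRing.Carrier R) where
  open CommutativeRing R
  open IntegerSolver R
  open SetoidReasoning setoid

  infix 4 _~_
  -- The carrier stays that of `R`, so a congruence unpacks into an equation of `R` together with
  -- its cofactor.
  record _~_ (x y : Carrier) : Set (c ⊔ ℓ) where
    constructor _by_
    field
      quotient : Carrier
      equality : x ≈ y + u * quotient

  ≈⇒~ : ∀ {x y} → x ≈ y → x ~ y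
  ≈⇒~ {x} {y} x≈y = 0# by trans x≈y (solve 2 (λ y u → y := y :+ u :* con (+ 0)) refl y u)

  u*k~0 : ∀ {x} k → x ≈ u * k → x ~ 0#
  u*k~0 k x≈uk = k by trans x≈uk (sym (+-identityˡ _))

  ~-sym : ∀ {x y} → x ~ y → y ~ x
  ~-sym {x} {y} (k by eq) = (- k) by (begin
    y                          ≈⟨ solve 3 (λ y u k → y := (y :+ u :* k) :+ u :* :- k) refl y u k ⟩
    (y + u * k) + u * - k      ≈⟨ +-congʳ eq ⟨
    x + u * - k                ∎)

  ~-trans : ∀ {x y z} → x ~ y → y ~ z → x ~ z
  ~-trans {x} {y} {z} (k by eq) (l by eq′) = (k + l) by (begin
    x                      ≈⟨ eq ⟩
    y + u * k              ≈⟨ +-congʳ eq′ ⟩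
    (z + u * l) + u * k    ≈⟨ solve 4 (λ z u k l → (z :+ u :* l) :+ u :* k := z :+ u :* (k :+ l)) refl z u k l ⟩
    z + u * (k + l)        ∎)

  commutativeRing : CommutativeRing c (c ⊔ ℓ)
  commutativeRing = record
    { Carrier = Carrier
    ; _≈_ = _~_
    ; _+_ = _+_
    ; _*_ = _*_
    ; -_  = -_
    ; 0#  = 0#
    ; 1#  = 1#
    ; isCommutativeRing = record
      { isRing = record
        { +-isAbelianGroup = record
          { isGroup = record
            { isMonoid = record
              { isSemigroup = record
                { isMagma = record
                  { isEquivalence = record
                    { refl  = ≈⇒~ refl
                    ; sym   = ~-sym
                    ; trans = ~-trans
                    }
                  ; ∙-cong = λ { {x} {y} {z} {w} (k by eq) (l by eq′) → (k + l) by
                      trans (+-cong eq eq′) (solve 5 (λ y w u k l →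
                        (y :+ u :* k) :+ (w :+ u :* l) := (y :+ w) :+ u :* (k :+ l)) refl y w u k l) }
                  }
                ; assoc = λ x y z → ≈⇒~ (+-assoc x y z)
                }
              ; identity = (λ x → ≈⇒~ (+-identityˡ x)) , λ x → ≈⇒~ (+-identityʳ x)
              }
            ; inverse = (λ x → ≈⇒~ (-‿inverseˡ x)) , λ x → ≈⇒~ (-‿inverseʳ x)
            ; ⁻¹-cong = λ { {x} {y} (k by eq) → (- k) by
                trans (-‿cong eq) (solve 3 (λ y u k → :- (y :+ u :* k) := :- y :+ u :* :- k) refl y u k) }
            }
          ; comm = λ x y → ≈⇒~ (+-comm x y)
          }
        ; *-cong = λ { {x} {y} {z} {w} (k by eq) (l by eq′) → (y * l + k * w + u * (k * l)) by
            trans (*-cong eq eq′) (solve 5 (λ y w u k l →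
              (y :+ u :* k) :* (w :+ u :* l) := y :* w :+ u :* (y :* l :+ k :* w :+ u :* (k :* l))) refl y w u k l) }
        ; *-assoc = λ x y z → ≈⇒~ (*-assoc x y z)
        ; *-identity = (λ x → ≈⇒~ (*-identityˡ x)) , λ x → ≈⇒~ (*-identityʳ x)
        ; distrib = (λ x y z → ≈⇒~ (distribˡ x y z)) , λ x y z → ≈⇒~ (distribʳ x y z)
        }
      ; *-comm = λ x y → ≈⇒~ (*-comm x y)
      }
    }

-- An interface instead of the construction, so that no later argument depends on how fractions are
-- represented.
record FractionField (D : IntegralDomain c ℓ) c′ ℓ′ : Set (c ⊔ ℓ ⊔ lsuc (c′ ⊔ ℓ′)) where
  private module D = IntegralDomain D
  field
    commutativeRing : CommutativeRing c′ ℓ′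
  open CommutativeRing commutativeRing public
  infix 8 _⁻¹
  field
    integral    : ∀ {f g} → f * g ≈ 0# → f ≈ 0# ⊎ g ≈ 0#
    _⁻¹         : Carrier → Carrier
    ⁻¹-inverseʳ : ∀ f → ¬ (f ≈ 0#) → f * f ⁻¹ ≈ 1#
    ι           : D.Carrier → Carrier
    ι-isHom     : IsHom D.commutativeRing commutativeRing ι
    ι-injective : ∀ {x y} → ι x ≈ ι y → x D.≈ y
  module ι = RingMorphisms.IsRingHomomorphism ι-isHom

  ι-nonzero : ∀ {x} → ¬ (x D.≈ D.0#) → ¬ (ι x ≈ 0#)
  ι-nonzero x≉0 eq = x≉0 (ι-injective (trans eq (sym ι.0#-homo)))

  *-cancelʳ : ∀ {f g} h → ¬ (h ≈ 0#) → f * h ≈ g * h → f ≈ g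
  *-cancelʳ {f} {g} h h≉0 eq = begin
    f                  ≈⟨ *-identityʳ f ⟨
    f * 1#             ≈⟨ *-congˡ (⁻¹-inverseʳ h h≉0) ⟨
    f * (h * h ⁻¹)     ≈⟨ *-assoc f h (h ⁻¹) ⟨
    f * h * h ⁻¹       ≈⟨ *-congʳ eq ⟩
    g * h * h ⁻¹       ≈⟨ *-assoc g h (h ⁻¹) ⟩
    g * (h * h ⁻¹)     ≈⟨ *-congˡ (⁻¹-inverseʳ h h≉0) ⟩
    g * 1#             ≈⟨ *-identityʳ g ⟩
    g                  ∎
    where open SetoidReasoning setoid

  ⁻¹-cong : ∀ {f g} → ¬ (g ≈ 0#) → f ≈ g → f ⁻¹ ≈ g ⁻¹
  ⁻¹-cong {f} {g} g≉0 f≈g = *-cancelʳ g g≉0 (begin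
    f ⁻¹ * g   ≈⟨ *-congˡ f≈g ⟨
    f ⁻¹ * f   ≈⟨ *-comm _ _ ⟩
    f * f ⁻¹   ≈⟨ ⁻¹-inverseʳ f (λ f≈0 → g≉0 (trans (sym f≈g) f≈0)) ⟩
    1#         ≈⟨ ⁻¹-inverseʳ g g≉0 ⟨
    g * g ⁻¹   ≈⟨ *-comm _ _ ⟩
    g ⁻¹ * g   ∎)
    where open SetoidReasoning setoid

fractionField : (D : IntegralDomain c ℓ) → FractionField D (c ⊔ ℓ) ℓ
fractionField D = record
  { commutativeRing = commutativeRing
  ; integral        = λ {f} {g} eq → Sum.map (≈0 f) (≈0 g) (D.integral (num≈0 (f * g) eq))
  ; _⁻¹             = _⁻¹
  ; ⁻¹-inverseʳ     = ⁻¹-inverseʳ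
  ; ι               = ι
  ; ι-isHom         = isHom D.commutativeRing commutativeRing (λ x≈y → cross (D.*-congʳ x≈y))
      (λ x y → cross (D.*-cong (D.sym (D.+-cong (D.*-identityʳ x) (D.*-identityʳ y))) (D.*-identityʳ _)))
      (λ x y → cross (D.*-congˡ (D.*-identityʳ _)))
      (cross D.refl)
  ; ι-injective     = λ (cross eq) → D.trans (D.sym (D.*-identityʳ _)) (D.trans eq (D.*-identityʳ _))
  }
  where
  module D = IntegralDomain D
  open Fraction D

  num≈0 : ∀ f → f ≈ ι D.0# → num f D.≈ D.0#
  num≈0 f (cross eq) = D.trans (D.sym (D.*-identityʳ _)) (D.trans eq (D.zeroˡ _))

  ≈0 : ∀ f → num f D.≈ D.0# → f ≈ ι D.0#
  ≈0 f n≈0 = cross (D.trans (D.*-identityʳ _) (D.trans n≈0 (D.sym (D.zeroˡ _))))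

-- `θ` substitutes a root of `u`. Its values lie in the fraction field because a root such as `1/h`
-- is not a polynomial.
module Kernel (D : IntegralDomain c ℓ) (𝔽 : FractionField D c′ ℓ′)
  (u : IntegralDomain.Carrier D) (θ : IntegralDomain.Carrier D → FractionField.Carrier 𝔽)
  (θ-hom : IsHom (IntegralDomain.commutativeRing D) (FractionField.commutativeRing 𝔽) θ)
  (θu≈0 : FractionField._≈_ 𝔽 (θ u) (FractionField.0# 𝔽)) where
  private
    module D = IntegralDomain D
    module 𝔽 = FractionField 𝔽
  open D using (0#; 1#; _*_; _+_)
  open 𝔽 using (ι; module ι; ι-injective)
  open RawSemiringDefinitions (Semiring.rawSemiring D.semiring) using (_∣_)
  private
    module θ = RingMorphisms.IsRingHomomorphism θ-hom
  open Quotient D.commutativeRing u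
  private
    module D/u = CommutativeRing commutativeRing
  open IntegerSolver commutativeRing

  Fixed : D.Carrier → Set ℓ′
  Fixed x = θ x 𝔽.≈ ι x

  -- Every f will turn out to be, modulo u and up to a unit modulo u, a polynomial fixed
  -- by θ; hence u generates the kernel of θ.
  record Representable (f : D.Carrier) : Set (c ⊔ ℓ ⊔ ℓ′) where
    field
      η ε g : D.Carrier
      ηε~1  : η * ε ~ 1#
      η-fixed : Fixed η
      g-fixed : Fixed g
      ηf~g : η * f ~ g
  open Representable

  Fixed-+ : ∀ {x y} → Fixed x → Fixed y → Fixed (x + y)
  Fixed-+ p q = 𝔽.trans (θ.+-homo _ _) (𝔽.trans (𝔽.+-cong p q) (𝔽.sym (ι.+-homo _ _)))

  Fixed-* : ∀ {x y} → Fixed x → Fixed y → Fixed (x * y)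
  Fixed-* p q = 𝔽.trans (θ.*-homo _ _) (𝔽.trans (𝔽.*-cong p q) (𝔽.sym (ι.*-homo _ _)))

  Fixed-1 : Fixed 1#
  Fixed-1 = 𝔽.trans θ.1#-homo (𝔽.sym ι.1#-homo)

  fixed : ∀ {f} → Fixed f → Representable f
  fixed {f} p = record
    { η = 1# ; ε = 1# ; g = f ; ηε~1 = D/u.*-identityˡ 1# ; η-fixed = Fixed-1
    ; g-fixed = p ; ηf~g = D/u.*-identityˡ f }

  Representable-resp : ∀ {f f′} → f D.≈ f′ → Representable f → Representable f′
  Representable-resp f≈f′ R = record
    { η = η R ; ε = ε R ; g = g R ; ηε~1 = ηε~1 R ; η-fixed = η-fixed R ; g-fixed = g-fixed R
    ; ηf~g = D/u.trans (≈⇒~ (D.*-congˡ (D.sym f≈f′))) (ηf~g R) }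

  private
    units : ∀ {f f′} (R : Representable f) (R′ : Representable f′) → (η R * η R′) * (ε R * ε R′) ~ 1#
    units R R′ = D/u.trans
      (solve 4 (λ a b c d → (a :* b) :* (c :* d) := (a :* c) :* (b :* d)) D/u.refl (η R) (η R′) (ε R) (ε R′))
      (D/u.trans (D/u.*-cong (ηε~1 R) (ηε~1 R′)) (D/u.*-identityˡ 1#))

  Representable-+ : ∀ {f f′} → Representable f → Representable f′ → Representable (f + f′)
  Representable-+ {f} {f′} R R′ = record
    { η = η R * η R′ ; ε = ε R * ε R′ ; g = η R′ * g R + η R * g R′
    ; ηε~1 = units R R′
    ; η-fixed = Fixed-* (η-fixed R) (η-fixed R′)
    ; g-fixed = Fixed-+ (Fixed-* (η-fixed R′) (g-fixed R)) (Fixed-* (η-fixed R) (g-fixed R′))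
    ; ηf~g = D/u.trans
        (solve 4 (λ a b f f′ → (a :* b) :* (f :+ f′) := b :* (a :* f) :+ a :* (b :* f′)) D/u.refl (η R) (η R′) f f′)
        (D/u.+-cong (D/u.*-congˡ (ηf~g R)) (D/u.*-congˡ (ηf~g R′)))
    }

  Representable-* : ∀ {f f′} → Representable f → Representable f′ → Representable (f * f′)
  Representable-* {f} {f′} R R′ = record
    { η = η R * η R′ ; ε = ε R * ε R′ ; g = g R * g R′
    ; ηε~1 = units R R′
    ; η-fixed = Fixed-* (η-fixed R) (η-fixed R′)
    ; g-fixed = Fixed-* (g-fixed R) (g-fixed R′)
    ; ηf~g = D/u.trans
        (solve 4 (λ a b f f′ → (a :* b) :* (f :* f′) := (a :* f) :* (b :* f′)) D/u.refl (η R) (η R′) f f′)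
        (D/u.*-cong (ηf~g R) (ηf~g R′))
    }

  θ-~ : ∀ {x y} → x ~ y → θ x 𝔽.≈ θ y
  θ-~ {x} {y} (k by eq) = begin
    θ x                  ≈⟨ θ.⟦⟧-cong eq ⟩
    θ (y + u * k)        ≈⟨ θ.+-homo y (u * k) ⟩
    θ y 𝔽.+ θ (u * k)    ≈⟨ 𝔽.+-congˡ (θ.*-homo u k) ⟩
    θ y 𝔽.+ θ u 𝔽.* θ k  ≈⟨ 𝔽.+-congˡ (𝔽.trans (𝔽.*-congʳ θu≈0) (𝔽.zeroˡ _)) ⟩
    θ y 𝔽.+ 𝔽.0#         ≈⟨ 𝔽.+-identityʳ _ ⟩
    θ y                  ∎
    where open SetoidReasoning 𝔽.setoid

  -- `θ g = θ η θ f = 0`, since `θ` kills `u`; but `g` is fixed, so `g = 0`. Then `η f ~ 0`, and `ε`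
  -- removes `η`.
  kernel : ∀ {f} → Representable f → θ f 𝔽.≈ 𝔽.0# → f ~ 0#
  kernel {f} R θf≈0 = D/u.trans
    (D/u.sym (D/u.trans (solve 3 (λ η ε f → ε :* (η :* f) := (η :* ε) :* f) D/u.refl (η R) (ε R) f)
      (D/u.trans (D/u.*-congʳ (ηε~1 R)) (D/u.*-identityˡ f))))
    (D/u.trans (D/u.*-congˡ (D/u.trans (ηf~g R) (≈⇒~ g≈0))) (D/u.zeroʳ (ε R)))
    where
    open SetoidReasoning 𝔽.setoid
    g≈0 : g R D.≈ 0#
    g≈0 = ι-injective (𝔽.trans (begin
      ι (g R)          ≈⟨ g-fixed R ⟨
      θ (g R)          ≈⟨ θ-~ (ηf~g R) ⟨
      θ (η R * f)      ≈⟨ θ.*-homo (η R) f ⟩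
      θ (η R) 𝔽.* θ f  ≈⟨ 𝔽.*-congˡ θf≈0 ⟩
      θ (η R) 𝔽.* 𝔽.0# ≈⟨ 𝔽.zeroʳ _ ⟩
      𝔽.0#             ∎) (𝔽.sym ι.0#-homo))

  -- One of `θ f`, `θ g` vanishes because `𝔽` is integral, and `kernel` turns this into
  -- divisibility. The choice comes from integrality, so divisibility is never decided.
  split-∣ : (∀ f → Representable f) → ∀ {f g} → u ∣ f * g → u ∣ f ⊎ u ∣ g
  split-∣ rep {f} {g} (k ,∣ ku≈fg) = Sum.map (divides f) (divides g) (𝔽.integral
    (𝔽.trans (𝔽.sym (θ.*-homo f g)) (𝔽.trans (θ-~ {f * g} {0#} (u*k~0 k
      (D.trans (D.sym ku≈fg) (D.*-comm k u)))) θ.0#-homo)))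
    where
    ~0⇒∣ : ∀ {f} → f ~ 0# → u ∣ f
    ~0⇒∣ (k by eq) = k ,∣ D.trans (D.*-comm k u) (D.sym (D.trans eq (D.+-identityˡ _)))
    divides : ∀ f → θ f 𝔽.≈ 𝔽.0# → u ∣ f
    divides f θf≈0 = ~0⇒∣ (kernel (rep f) θf≈0)

-- Primes of R[a][b]

module Bivariate (R : IntegralDomain c ℓ) where
  private
    module R = IntegralDomain R
    module R[a] = Polynomial R
    module R[a][b] = Polynomial R[a].integralDomain

  domain : IntegralDomain c ℓ
  domain = R[a][b].integralDomain

  open IntegralDomain domain
  open RawSemiringDefinitions (Semiring.rawSemiring semiring) using (_∣_)

  κ : R.Carrier → Carrier
  κ r = R[a][b].const (R[a].const r)

  κ-isHom : IsHom R.commutativeRing commutativeRing κ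
  κ-isHom = ∘-isHom R.commutativeRing R[a].commutativeRing commutativeRing
    (PolynomialProperties.const-isHom R) (PolynomialProperties.const-isHom R[a].integralDomain)

  𝑎 𝑏 : Carrier
  𝑎 = R[a][b].const R[a].var
  𝑏 = R[a][b].var

  generated : ∀ {r} (Q : Carrier → Set r) → (∀ {f g} → f ≈ g → Q f → Q g) →
    (∀ x → Q (κ x)) → Q 𝑎 → Q 𝑏 → (∀ {f g} → Q f → Q g → Q (f + g)) →
    (∀ {f g} → Q f → Q g → Q (f * g)) → ∀ f → Q f
  generated Q resp Q-κ Q-a Q-b Q-+ Q-* =
    Ind₂.Poly-induction Q resp
      (Ind₁.Poly-induction (λ p → Q (R[a][b].const p)) (λ p≈q → resp (const.⟦⟧-cong p≈q)) Q-κ Q-a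
        (λ {p} {q} Qp Qq → resp (sym {R[a][b].const (p R[a].+ q)} {R[a][b].const p + R[a][b].const q} (const.+-homo p q)) (Q-+ Qp Qq))
        (λ {p} {q} Qp Qq → resp (sym {R[a][b].const (p R[a].* q)} {R[a][b].const p * R[a][b].const q} (const.*-homo p q)) (Q-* Qp Qq)))
      Q-b Q-+ Q-*
    where
    module Ind₁ = PolynomialProperties R
    module Ind₂ = PolynomialProperties R[a].integralDomain
    module const = RingMorphisms.IsRingHomomorphism Ind₂.const-isHom

  module Substitution (T : CommutativeRing c′ ℓ′) (φ : R.Carrier → CommutativeRing.Carrier T)
    (φ-isHom : IsHom R.commutativeRing T φ) (α β : CommutativeRing.Carrier T) where
    private
      module T = CommutativeRing T
      module Eval₁ = Evaluation R T
      module Eval₂ = Evaluation R[a].integralDomain T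
      hom₁ = Eval₁.eval-isHom φ φ-isHom α
      eval₁ = Eval₁.eval φ φ-isHom α

    abstract
      subst : Carrier → T.Carrier
      subst = Eval₂.eval eval₁ hom₁ β

      subst-isHom : IsHom commutativeRing T subst
      subst-isHom = Eval₂.eval-isHom eval₁ hom₁ β

      subst-κ : ∀ r → subst (κ r) T.≈ φ r
      subst-κ r = T.trans (Eval₂.eval-const eval₁ hom₁ β (R[a].const r)) (Eval₁.eval-const φ φ-isHom α r)

      subst-a : subst 𝑎 T.≈ α
      subst-a = T.trans (Eval₂.eval-const eval₁ hom₁ β R[a].var) (Eval₁.eval-var φ φ-isHom α)

      subst-b : subst 𝑏 T.≈ β
      subst-b = Eval₂.eval-var eval₁ hom₁ β

  module Primes (𝔽 : FractionField domain c′ ℓ′) (h : R.Carrier) (h≉0 : ¬ (h R.≈ R.0#)) where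
    private
      module 𝔽 = FractionField 𝔽
      open 𝔽 using (ι; module ι; _⁻¹)
      open IntegerSolver commutativeRing
      open SetoidReasoning 𝔽.setoid

      κh≉0 : ¬ (κ h ≈ 0#)
      κh≉0 κh≈0 = h≉0 (R[a].at (R[a][b].at κh≈0 0) 0)

      inverse : ι (κ h) 𝔽.* ι (κ h) ⁻¹ 𝔽.≈ 𝔽.1#
      inverse = 𝔽.⁻¹-inverseʳ _ (𝔽.ι-nonzero κh≉0)

    module At = Substitution 𝔽.commutativeRing (ι ∘ κ)
      (∘-isHom R.commutativeRing commutativeRing 𝔽.commutativeRing κ-isHom 𝔽.ι-isHom)

    module _ (α β : 𝔽.Carrier) where
      open At α β
      private module θ = RingMorphisms.IsRingHomomorphism subst-isHom

      module _ (u : Carrier) (θu≈0 : subst u 𝔽.≈ 𝔽.0#) where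
        open Kernel domain 𝔽 u subst subst-isHom θu≈0
        open Quotient commutativeRing u using (_~_; _by_; ≈⇒~)

        prime : Representable 𝑎 → Representable 𝑏 → ∀ {f g} → u ∣ f * g → u ∣ f ⊎ u ∣ g
        prime R-a R-b = split-∣ (generated Representable Representable-resp (λ r → fixed (subst-κ r))
          R-a R-b Representable-+ Representable-*)

        -- Modulo `u`, `f` and `κ h` are inverse to each other, so `κ h` is the unit that carries
        -- `f` to the fixed element 1.
        invertible : ∀ {f} → u ≈ 1# - f * κ h → Representable f
        invertible {f} u≈ = record
          { η = κ h ; ε = f ; g = 1# ; ηε~1 = κh*f~1 ; η-fixed = subst-κ h ; g-fixed = Fixed-1 ; ηf~g = κh*f~1 }
          where
          κh*f~1 : κ h * f ~ 1#
          κh*f~1 = (- 1#) by trans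
            (solve 2 (λ k f → k :* f := :1 :+ (:1 :- f :* k) :* :- :1) refl (κ h) f)
            (+-congˡ {1#} (*-congʳ {x = - 1#} (sym u≈)))

        reducible : ∀ {f} → u ≈ κ h - f → Representable f
        reducible {f} u≈ = record
          { η = 1# ; ε = 1# ; g = κ h ; ηε~1 = ≈⇒~ (*-identityˡ 1#) ; η-fixed = Fixed-1 ; g-fixed = subst-κ h
          ; ηf~g = (- 1#) by trans
              (solve 2 (λ k f → :1 :* f := k :+ (k :- f) :* :- :1) refl (κ h) f)
              (+-congˡ {κ h} (*-congʳ {x = - 1#} (sym u≈))) }

      subst-1-fκh : ∀ f → subst f 𝔽.≈ ι (κ h) ⁻¹ → subst (1# - f * κ h) 𝔽.≈ 𝔽.0#
      subst-1-fκh f eq = begin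
        subst (1# - f * κ h)                       ≈⟨ θ.+-homo 1# (- (f * κ h)) ⟩
        subst 1# 𝔽.+ subst (- (f * κ h))           ≈⟨ 𝔽.+-cong θ.1#-homo (θ.-‿homo (f * κ h)) ⟩
        𝔽.1# 𝔽.- subst (f * κ h)                   ≈⟨ 𝔽.+-congˡ (𝔽.-‿cong (θ.*-homo f (κ h))) ⟩
        𝔽.1# 𝔽.- subst f 𝔽.* subst (κ h)           ≈⟨ 𝔽.+-congˡ (𝔽.-‿cong (𝔽.*-cong eq (subst-κ h))) ⟩
        𝔽.1# 𝔽.- ι (κ h) ⁻¹ 𝔽.* ι (κ h)            ≈⟨ 𝔽.+-congˡ (𝔽.-‿cong (𝔽.trans (𝔽.*-comm _ _) inverse)) ⟩
        𝔽.1# 𝔽.- 𝔽.1#                              ≈⟨ 𝔽.-‿inverseʳ 𝔽.1# ⟩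
        𝔽.0#                                       ∎

      subst-κh-f : ∀ f → subst f 𝔽.≈ ι (κ h) → subst (κ h - f) 𝔽.≈ 𝔽.0#
      subst-κh-f f eq = begin
        subst (κ h - f)                  ≈⟨ θ.+-homo (κ h) (- f) ⟩
        subst (κ h) 𝔽.+ subst (- f)      ≈⟨ 𝔽.+-cong (subst-κ h) (𝔽.trans (θ.-‿homo f) (𝔽.-‿cong eq)) ⟩
        ι (κ h) 𝔽.- ι (κ h)              ≈⟨ 𝔽.-‿inverseʳ _ ⟩
        𝔽.0#                             ∎

    prime-1-ah : ∀ {f g} → 1# - 𝑎 * κ h ∣ f * g → 1# - 𝑎 * κ h ∣ f ⊎ 1# - 𝑎 * κ h ∣ g
    prime-1-ah {f} {g} = prime (ι (κ h) ⁻¹) (ι 𝑏) u (subst-1-fκh _ _ 𝑎 subst-a)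
      (invertible (ι (κ h) ⁻¹) (ι 𝑏) u _ {𝑎} (refl {u})) (Kernel.fixed domain 𝔽 u _ _ _ subst-b) {f} {g}
      where
      u = 1# - 𝑎 * κ h
      open At (ι (κ h) ⁻¹) (ι 𝑏)

    prime-1-bh : ∀ {f g} → 1# - 𝑏 * κ h ∣ f * g → 1# - 𝑏 * κ h ∣ f ⊎ 1# - 𝑏 * κ h ∣ g
    prime-1-bh {f} {g} = prime (ι 𝑎) (ι (κ h) ⁻¹) u (subst-1-fκh _ _ 𝑏 subst-b)
      (Kernel.fixed domain 𝔽 u _ _ _ subst-a) (invertible (ι 𝑎) (ι (κ h) ⁻¹) u _ {𝑏} (refl {u})) {f} {g}
      where
      u = 1# - 𝑏 * κ h
      open At (ι 𝑎) (ι (κ h) ⁻¹)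

    -- Serves negative exponents: `q^N - b` is the numerator of `1 - b q^(-N)`.
    prime-h-b : ∀ {f g} → κ h - 𝑏 ∣ f * g → κ h - 𝑏 ∣ f ⊎ κ h - 𝑏 ∣ g
    prime-h-b {f} {g} = prime (ι 𝑎) (ι (κ h)) u (subst-κh-f _ _ 𝑏 subst-b)
      (Kernel.fixed domain 𝔽 u _ _ _ subst-a) (reducible (ι 𝑎) (ι (κ h)) u _ {𝑏} (refl {u})) {f} {g}
      where
      u = κ h - 𝑏
      open At (ι 𝑎) (ι (κ h))

-- Fractions whose denominators avoid the modulus

module Localization (D : IntegralDomain c ℓ) (𝔽 : FractionField D c′ ℓ′) (E : IntegralDomain c″ ℓ″)
  (ψ₁ ψ₂ : IntegralDomain.Carrier D → IntegralDomain.Carrier E)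
  (ψ₁-isHom : IsHom (IntegralDomain.commutativeRing D) (IntegralDomain.commutativeRing E) ψ₁)
  (ψ₂-isHom : IsHom (IntegralDomain.commutativeRing D) (IntegralDomain.commutativeRing E) ψ₂)
  where
  private
    module D = IntegralDomain D
    module E = IntegralDomain E
    module 𝔽 = FractionField 𝔽
    module ψ₁ = RingMorphisms.IsRingHomomorphism ψ₁-isHom
    module ψ₂ = RingMorphisms.IsRingHomomorphism ψ₂-isHom
  open 𝔽 using (ι; module ι; _⁻¹; _≈_; _+_; _*_; -_; 0#; 1#)
  open SetoidReasoning 𝔽.setoid
  open IntegerSolver 𝔽.commutativeRing
  open RawSemiringDefinitions (Semiring.rawSemiring D.semiring) using (_∣_; _∤_; Coprime)

  -- A substitute for divisibility by neither factor of the modulus. It implies that once each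
  -- factor vanishes at its own specialisation, and it is closed under products simply because `E`
  -- is a domain.
  Avoids : D.Carrier → Set ℓ″
  Avoids d = ¬ (ψ₁ d E.≈ E.0#) × ¬ (ψ₂ d E.≈ E.0#)

  Avoids-1 : Avoids D.1#
  Avoids-1 = (λ eq → E.1≉0 (E.trans (E.sym ψ₁.1#-homo) eq)) , (λ eq → E.1≉0 (E.trans (E.sym ψ₂.1#-homo) eq))

  Avoids-* : ∀ {d e} → Avoids d → Avoids e → Avoids (d D.* e)
  Avoids-* {d} {e} (d₁ , d₂) (e₁ , e₂) =
    (λ eq → E.*-nonzero d₁ e₁ (E.trans (E.sym (ψ₁.*-homo d e)) eq)) ,
    (λ eq → E.*-nonzero d₂ e₂ (E.trans (E.sym (ψ₂.*-homo d e)) eq))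

  Avoids⇒≉0 : ∀ {d} → Avoids d → ¬ (d D.≈ D.0#)
  Avoids⇒≉0 (d₁ , _) d≈0 = d₁ (E.trans (ψ₁.⟦⟧-cong d≈0) ψ₁.0#-homo)

  -- A fraction with one admissible way of writing it. Equality will compare values alone, so `val`
  -- is injective and the ring laws are inherited from `𝔽`.
  record Local : Set (c ⊔ c′ ⊔ ℓ′ ⊔ ℓ″) where
    no-eta-equality
    field
      val     : 𝔽.Carrier
      num den : D.Carrier
      avoids  : Avoids den
      val*den : val * ι den ≈ ι num
  open Local public

  infix 4 _≋_
  record _≋_ (f g : Local) : Set ℓ′ where
    constructor by-val
    field
      val-≈ : val f ≈ val g
  open _≋_ public

  fromPoly : ∀ f x → f ≈ ι x → Local
  fromPoly f x f≈x = record { val = f ; num = x ; den = D.1# ; avoids = Avoids-1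
    ; val*den = 𝔽.trans (𝔽.*-congˡ ι.1#-homo) (𝔽.trans (𝔽.*-identityʳ _) f≈x) }

  ιᴸ : D.Carrier → Local
  ιᴸ x = fromPoly (ι x) x 𝔽.refl

  -- The proofs are abstract so that comparing two elements of Local never unfolds them.
  abstract
    +-val*den : ∀ f g → (val f + val g) * ι (den f D.* den g) ≈ ι (num f D.* den g D.+ num g D.* den f)
    +-val*den f g = begin
      (val f + val g) * ι (den f D.* den g)      ≈⟨ 𝔽.*-congˡ (ι.*-homo _ _) ⟩
      (val f + val g) * (ι (den f) * ι (den g))
        ≈⟨ solve 4 (λ x y d e → (x :+ y) :* (d :* e) := (x :* d) :* e :+ (y :* e) :* d) 𝔽.refl _ _ _ _ ⟩
      val f * ι (den f) * ι (den g) + val g * ι (den g) * ι (den f)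
        ≈⟨ 𝔽.+-cong (𝔽.*-congʳ (val*den f)) (𝔽.*-congʳ (val*den g)) ⟩
      ι (num f) * ι (den g) + ι (num g) * ι (den f)
        ≈⟨ 𝔽.+-cong (ι.*-homo _ _) (ι.*-homo _ _) ⟨
      ι (num f D.* den g) + ι (num g D.* den f)  ≈⟨ ι.+-homo _ _ ⟨
      ι (num f D.* den g D.+ num g D.* den f)    ∎

    *-val*den : ∀ f g → val f * val g * ι (den f D.* den g) ≈ ι (num f D.* num g)
    *-val*den f g = begin
      val f * val g * ι (den f D.* den g)          ≈⟨ 𝔽.*-congˡ (ι.*-homo _ _) ⟩
      val f * val g * (ι (den f) * ι (den g))
        ≈⟨ solve 4 (λ x y d e → (x :* y) :* (d :* e) := (x :* d) :* (y :* e)) 𝔽.refl _ _ _ _ ⟩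
      val f * ι (den f) * (val g * ι (den g))      ≈⟨ 𝔽.*-cong (val*den f) (val*den g) ⟩
      ι (num f) * ι (num g)                        ≈⟨ ι.*-homo _ _ ⟨
      ι (num f D.* num g)                          ∎

    -‿val*den : ∀ f → - val f * ι (den f) ≈ ι (D.- num f)
    -‿val*den f = begin
      - val f * ι (den f)    ≈⟨ solve 2 (λ x d → :- x :* d := :- (x :* d)) 𝔽.refl _ _ ⟩
      - (val f * ι (den f))  ≈⟨ 𝔽.-‿cong (val*den f) ⟩
      - ι (num f)            ≈⟨ ι.-‿homo _ ⟨
      ι (D.- num f)          ∎

  private
    _+ᴸ_ _*ᴸ_ : Local → Local → Local
    f +ᴸ g = record
      { val = val f + val g
      ; num = num f D.* den g D.+ num g D.* den f
      ; den = den f D.* den g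
      ; avoids = Avoids-* (avoids f) (avoids g)
      ; val*den = +-val*den f g
      }
    f *ᴸ g = record
      { val = val f * val g
      ; num = num f D.* num g
      ; den = den f D.* den g
      ; avoids = Avoids-* (avoids f) (avoids g)
      ; val*den = *-val*den f g
      }

    -ᴸ_ : Local → Local
    -ᴸ f = record
      { val = - val f
      ; num = D.- num f
      ; den = den f
      ; avoids = avoids f
      ; val*den = -‿val*den f
      }

    rawRing : RawRing _ _
    rawRing = record
      { Carrier = Local
      ; _≈_ = _≋_
      ; _+_ = _+ᴸ_
      ; _*_ = _*ᴸ_
      ; -_  = -ᴸ_
      ; 0#  = fromPoly 0# D.0# (𝔽.sym ι.0#-homo)
      ; 1#  = fromPoly 1# D.1# (𝔽.sym ι.1#-homo)
      }

    val-isRingMonomorphism : RingMorphisms.IsRingMonomorphism rawRing 𝔽.rawRing val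
    val-isRingMonomorphism = record
      { isRingHomomorphism = record
        { isSemiringHomomorphism = record
          { isNearSemiringHomomorphism = record
            { +-isMonoidHomomorphism = record
              { isMagmaHomomorphism = record
                { isRelHomomorphism = record { cong = val-≈ }
                ; homo = λ f g → 𝔽.refl
                }
              ; ε-homo = 𝔽.refl
              }
            ; *-homo = λ f g → 𝔽.refl
            }
          ; 1#-homo = 𝔽.refl
          }
        ; -‿homo = λ f → 𝔽.refl
        }
      ; injective = by-val
      }

  localRing : CommutativeRing _ _
  localRing = record { isCommutativeRing =
    RingMonomorphism.isCommutativeRing val-isRingMonomorphism 𝔽.isCommutativeRing }

  -- The admissible polynomial becomes the denominator of `f ⁻¹`, which is what makes the inverse an
  -- element of `Local`.
  record Unit (f : 𝔽.Carrier) : Set (c ⊔ ℓ′ ⊔ ℓ″) where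
    field
      poly     : D.Carrier
      nonzero  : Avoids poly
      f≈poly   : f ≈ ι poly

    unit≉0 : ¬ (f ≈ 0#)
    unit≉0 f≈0 = 𝔽.ι-nonzero (Avoids⇒≉0 nonzero) (𝔽.trans (𝔽.sym f≈poly) f≈0)

    inverse : Local
    inverse = record { val = f ⁻¹ ; num = D.1# ; den = poly ; avoids = nonzero
      ; val*den = begin
          f ⁻¹ * ι poly   ≈⟨ 𝔽.*-congˡ f≈poly ⟨
          f ⁻¹ * f        ≈⟨ 𝔽.*-comm _ _ ⟩
          f * f ⁻¹        ≈⟨ 𝔽.⁻¹-inverseʳ f unit≉0 ⟩
          1#              ≈⟨ ι.1#-homo ⟨
          ι D.1#          ∎ }

  Unit-* : ∀ {f g} → Unit f → Unit g → Unit (f * g)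
  Unit-* U V = record { poly = poly U D.* poly V ; nonzero = Avoids-* (nonzero U) (nonzero V)
    ; f≈poly = 𝔽.trans (𝔽.*-cong (f≈poly U) (f≈poly V)) (𝔽.sym (ι.*-homo _ _)) }
    where open Unit

  Unit-1 : Unit 1#
  Unit-1 = record { poly = D.1# ; nonzero = Avoids-1 ; f≈poly = 𝔽.sym ι.1#-homo }

  private
    module ℒ = CommutativeRing localRing
    module 𝕊 = FiniteSeries 𝔽.commutativeRing
  open Signs 𝔽.commutativeRing using (sign²)

  -- Supplies the ratio of consecutive inverted denominators that `Parity` takes as `I-step`.
  ⁻¹-step : ∀ {f g} → Unit f → Unit (f * g) → f ⁻¹ ≈ (f * g) ⁻¹ * g
  ⁻¹-step {f} {g} U V = 𝔽.*-cancelʳ (f * g) (unit≉0 V) (begin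
    f ⁻¹ * (f * g)                ≈⟨ solve 3 (λ i f g → i :* (f :* g) := f :* i :* g) 𝔽.refl _ _ _ ⟩
    f * f ⁻¹ * g                  ≈⟨ 𝔽.*-congʳ (𝔽.⁻¹-inverseʳ f (unit≉0 U)) ⟩
    1# * g                        ≈⟨ 𝔽.*-congʳ (𝔽.⁻¹-inverseʳ (f * g) (unit≉0 V)) ⟨
    f * g * (f * g) ⁻¹ * g        ≈⟨ solve 3 (λ h i g → h :* i :* g := i :* g :* h) 𝔽.refl (f * g) ((f * g) ⁻¹) g ⟩
    (f * g) ⁻¹ * g * (f * g)      ∎)
    where open Unit

  Unit-poch : ∀ p x → (∀ k → Unit (1# 𝔽.- x * p 𝕊.^ k)) → ∀ k → Unit (𝕊.poch p x k)
  Unit-poch p x U zero    = Unit-1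
  Unit-poch p x U (suc k) = Unit-* (Unit-poch p x U k) (U k)

  module Reduction (u : D.Carrier) where
    open Quotient localRing (ιᴸ u) public using (_~_; _by_; ≈⇒~) renaming (commutativeRing to residueRing)
    private
      module K = CommutativeRing residueRing
      module 𝕂 = FiniteSeries residueRing

    -- `val` commutes with the ring operations by computation, so these are propositional equalities
    -- and a result in the quotient can be rewritten directly into one about `series`.
    val-^ : ∀ f k → val (f 𝕂.^ k) ≡ val f 𝕊.^ k
    val-^ f zero    = ≡.refl
    val-^ f (suc k) = ≡.cong (val f *_) (val-^ f k)

    val-poch : ∀ p x k → val (𝕂.poch p x k) ≡ 𝕊.poch (val p) (val x) k
    val-poch p x zero    = ≡.refl
    val-poch p x (suc k) = ≡.cong₂ (λ f g → f * (1# 𝔽.- val x * g)) (val-poch p x k) (val-^ p k)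

    val-Σ : ∀ n {f g} → (∀ k → val (f k) ≡ g k) → val (𝕂.Σ< n f) ≡ 𝕊.Σ< n g
    val-Σ zero    eq = ≡.refl
    val-Σ (suc n) eq = ≡.cong₂ _+_ (val-Σ n eq) (eq n)

    cancel-unit : ∀ f → Unit (val f) → ∀ {g h} → f K.* g ~ f K.* h → g ~ h
    cancel-unit f U {g} {h} eq = K.trans (K.sym (undo g)) (K.trans (K.*-congˡ {Unit.inverse U} eq) (undo h))
      where
      undo : ∀ g → Unit.inverse U K.* (f K.* g) ~ g
      undo g = ≈⇒~ (by-val (begin
        val f ⁻¹ * (val f * val g)   ≈⟨ solve 3 (λ i f g → i :* (f :* g) := f :* i :* g) 𝔽.refl _ _ _ ⟩
        val f * val f ⁻¹ * val g     ≈⟨ 𝔽.*-congʳ (𝔽.⁻¹-inverseʳ _ (Unit.unit≉0 U)) ⟩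
        1# * val g                   ≈⟨ 𝔽.*-identityˡ _ ⟩
        val g                        ∎))

  series : (p w A B : 𝔽.Carrier) → ℕ → 𝔽.Carrier → 𝔽.Carrier
  series p w A B n y = 𝕊.Σ< n λ k →
    𝕊.poch p A k * 𝕊.poch p B k * 𝕊.poch p y k * p 𝕊.^ k * (𝕊.poch p p k * 𝕊.poch (p * p) w k) ⁻¹

  -- The cofactor is in `Local`, so its denominator avoids both factors of the modulus and not only
  -- `u`; combining the two congruences depends on this.
  Alternation : (p w A B : 𝔽.Carrier) (n s : ℕ) (y : 𝔽.Carrier) → D.Carrier → Set _
  Alternation p w A B n s y u =
    ∃[ k ] series p w A B n (- y) ≈ (- 1#) 𝕊.^ s * series p w A B n y + ι u * val k

  module _ (p m w : Local) (pm≈1 : val p * val m ≈ 1#)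
    (p-unit  : ∀ k → Unit (1# 𝔽.- val p * val p 𝕊.^ k))
    (w-unit  : ∀ k → Unit (1# 𝔽.- val w * (val p * val p) 𝕊.^ k))
    (wm-unit : ∀ k → Unit (1# 𝔽.- val w * val m * val p 𝕊.^ k))
    where

    den-unit : ∀ k → Unit (𝕊.poch (val p) (val p) k * 𝕊.poch (val p * val p) (val w) k)
    den-unit k = Unit-* (Unit-poch _ _ p-unit k) (Unit-poch _ _ w-unit k)

    module _ (u : D.Carrier) where
      open Reduction u
      private
        module K = CommutativeRing residueRing
        module 𝕂 = FiniteSeries residueRing

      I : ℕ → Local
      I k = Unit.inverse (den-unit k)

      private
        I-step : ∀ k → I k ~ I (suc k) K.* ((K.1# K.- p K.* p 𝕂.^ k) K.* (K.1# K.- w K.* (p K.* p) 𝕂.^ k))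
        I-step k = ≈⇒~ (by-val (begin
          (P * W) ⁻¹                     ≈⟨ ⁻¹-step (den-unit k) (Unit-* (den-unit k) (Unit-* (p-unit k) (w-unit k))) ⟩
          (P * W * (x * y)) ⁻¹ * (x * y) ≈⟨ 𝔽.*-congʳ inv-cong ⟩
          ((P * x) * (W * y)) ⁻¹ * (x * y)
            ≡⟨ ≡.cong₂ (λ f g → ((P * x) * (W * y)) ⁻¹ * ((1# 𝔽.- val p * f) * (1# 𝔽.- val w * g)))
                 (val-^ p k) (val-^ (p K.* p) k) ⟨
          _ ∎))
          where
          P W x y : 𝔽.Carrier
          P = 𝕊.poch (val p) (val p) k
          W = 𝕊.poch (val p * val p) (val w) k
          x = 1# 𝔽.- val p * val p 𝕊.^ k
          y = 1# 𝔽.- val w * (val p * val p) 𝕊.^ k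
          inv-cong : (P * W * (x * y)) ⁻¹ ≈ ((P * x) * (W * y)) ⁻¹
          inv-cong = 𝔽.⁻¹-cong (Unit.unit≉0 (den-unit (suc k)))
            (solve 4 (λ P W x y → P :* W :* (x :* y) := (P :* x) :* (W :* y)) 𝔽.refl P W x y)

      -- Termination holds only in the quotient by `u`, where `A` is `p^(-s)`; the parity theorem is
      -- applied there and `extract` reads the result back in `𝔽`.
      residue-alternates : ∀ {n s} A B → s < n → A K.* p 𝕂.^ s ~ K.1# → val w ≈ val A * val B * val p →
        ∀ y → Alternation (val p) (val w) (val A) (val B) n s (val y) u
      residue-alternates {n} {s} A B s<n Ap^s~1 w≈ABp y = extract
        (sum-alternates p m w (≈⇒~ (by-val pm≈1)) I I-step cancel {n} {s} {A} {B} s<n Ap^s~1 (≈⇒~ (by-val w≈ABp)) y)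
        where
        open Parity residueRing using (sum-alternates; term)

        cancel : ∀ j {f g} → (K.1# K.- w K.* m K.* p 𝕂.^ j) K.* f ~ (K.1# K.- w K.* m K.* p 𝕂.^ j) K.* g → f ~ g
        cancel j = cancel-unit _ (≡.subst (λ x → Unit (1# 𝔽.- val w * val m * x)) (≡.sym (val-^ p j)) (wm-unit j))

        t : Local → ℕ → Local
        t z k = 𝕂.poch p A k K.* 𝕂.poch p B k K.* 𝕂.poch p z k K.* p 𝕂.^ k K.* I k

        val-sum : ∀ z → val (𝕂.Σ< n (t z)) ≡ series (val p) (val w) (val A) (val B) n (val z)
        val-sum z = val-Σ n λ k → ≡.cong (_* val (I k)) (≡.cong₂ _*_ (≡.cong₂ _*_
          (≡.cong₂ _*_ (val-poch p A k) (val-poch p B k)) (val-poch p z k)) (val-^ p k))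

        extract : 𝕂.Σ< n (t (K.- y)) ~ (K.- K.1#) 𝕂.^ s K.* 𝕂.Σ< n (t y) →
          Alternation (val p) (val w) (val A) (val B) n s (val y) u
        extract (k by eq) = k , ≡.subst₂ _≈_ (val-sum (K.- y))
          (≡.cong₂ (λ e f → e * f + ι u * val k) (val-^ (K.- K.1#) s) (val-sum y)) (val-≈ eq)

  -- Divisibility by the product of two primes

  module Modulus (u₁ u₂ : D.Carrier)
    (ψ₁u₁≈0 : ψ₁ u₁ E.≈ E.0#) (ψ₂u₁≉0 : ¬ (ψ₂ u₁ E.≈ E.0#))
    (ψ₂u₂≈0 : ψ₂ u₂ E.≈ E.0#) (ψ₁u₂≉0 : ¬ (ψ₁ u₂ E.≈ E.0#))
    (split₁ : ∀ {f g} → u₁ ∣ f D.* g → u₁ ∣ f ⊎ u₁ ∣ g)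
    (split₂ : ∀ {f g} → u₂ ∣ f D.* g → u₂ ∣ f ⊎ u₂ ∣ g)
    where
    open IntegerSolver D.commutativeRing using () renaming (solve to solveᴰ; _:=_ to _:=ᴰ_; _:*_ to _:*ᴰ_)

    ψ₁-∤ : ∀ {f} → ¬ (ψ₁ f E.≈ E.0#) → u₁ ∤ f
    ψ₁-∤ f≉0 (k ,∣ eq) = f≉0 (E.trans (ψ₁.⟦⟧-cong (D.sym eq))
      (E.trans (ψ₁.*-homo k u₁) (E.trans (E.*-congˡ ψ₁u₁≈0) (E.zeroʳ _))))

    ψ₂-∤ : ∀ {f} → ¬ (ψ₂ f E.≈ E.0#) → u₂ ∤ f
    ψ₂-∤ f≉0 (k ,∣ eq) = f≉0 (E.trans (ψ₂.⟦⟧-cong (D.sym eq))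
      (E.trans (ψ₂.*-homo k u₂) (E.trans (E.*-congˡ ψ₂u₂≈0) (E.zeroʳ _))))

    u₁≉0 : ¬ (u₁ D.≈ D.0#)
    u₁≉0 eq = ψ₂u₁≉0 (E.trans (ψ₂.⟦⟧-cong eq) ψ₂.0#-homo)

    u₂≉0 : ¬ (u₂ D.≈ D.0#)
    u₂≉0 eq = ψ₁u₂≉0 (E.trans (ψ₁.⟦⟧-cong eq) ψ₁.0#-homo)

    divisor-nonzero : ∀ {z d} → Avoids d → z ∣ d → Avoids z
    divisor-nonzero (d₁ , d₂) (k ,∣ eq) =
      (λ ψz≈0 → d₁ (E.trans (ψ₁.⟦⟧-cong (D.sym eq)) (E.trans (ψ₁.*-homo k _) (E.trans (E.*-congˡ ψz≈0) (E.zeroʳ _))))) ,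
      (λ ψz≈0 → d₂ (E.trans (ψ₂.⟦⟧-cong (D.sym eq)) (E.trans (ψ₂.*-homo k _) (E.trans (E.*-congˡ ψz≈0) (E.zeroʳ _)))))

    -- A divisor `z` of `d` avoids as `d` does, so neither prime divides `z`. In `k z = u₁ u₂` both
    -- primes therefore divide off from `k`, which leaves `j z = 1`.
    coprime : ∀ {d} → Avoids d → Coprime d (u₁ D.* u₂)
    coprime {d} d-avoids {z} z∣d (k ,∣ kz≈u₁u₂) =
      [ peel₁ , (λ u₁∣z → contradiction u₁∣z (ψ₁-∤ (proj₁ z-avoids))) ]′
        (split₁ {k} {z} (u₂ ,∣ D.trans (D.*-comm u₂ u₁) (D.sym kz≈u₁u₂)))
      where
      z-avoids : Avoids z
      z-avoids = divisor-nonzero d-avoids z∣d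
      peel₂ : ∀ {l} → l D.* z D.≈ u₂ → u₂ ∣ l → z ∣ D.1#
      peel₂ {l} lz≈u₂ (j ,∣ ju₂≈l) = j ,∣ D.*-cancelʳ-nonzero u₂ u₂≉0
        (D.trans (solveᴰ 3 (λ j z u → (j :*ᴰ z) :*ᴰ u :=ᴰ (j :*ᴰ u) :*ᴰ z) D.refl j z u₂)
        (D.trans (D.*-congʳ ju₂≈l) (D.trans lz≈u₂ (D.sym (D.*-identityˡ u₂)))))
      peel₁ : u₁ ∣ k → z ∣ D.1#
      peel₁ (l ,∣ lu₁≈k) =
        [ peel₂ lz≈u₂ , (λ u₂∣z → contradiction u₂∣z (ψ₂-∤ (proj₂ z-avoids))) ]′
          (split₂ {l} {z} (D.1# ,∣ D.trans (D.*-identityˡ u₂) (D.sym lz≈u₂)))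
        where
        lz≈u₂ : l D.* z D.≈ u₂
        lz≈u₂ = D.*-cancelʳ-nonzero u₁ u₁≉0
          (D.trans (solveᴰ 3 (λ j z u → (j :*ᴰ z) :*ᴰ u :=ᴰ (j :*ᴰ u) :*ᴰ z) D.refl l z u₁)
          (D.trans (D.*-congʳ lu₁≈k) (D.trans kz≈u₁u₂ (D.*-comm u₁ u₂))))

    -- Cross multiplication shows that `u₂` divides `u₁ (num k) (den l)`. The second specialisation
    -- rules out `u₁` and `den l`, so `u₂` divides `num k`.
    divisible : ∀ {f} → (k l : Local) → f ≈ ι u₁ * val k → f ≈ ι u₂ * val l →
      ∃[ C ] ∃[ d ] Avoids d × f ≈ ι (u₁ D.* u₂) * (ι C * ι d ⁻¹)
    divisible {f} k l f≈u₁k f≈u₂l =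
      [ (λ u₂∣u₁ → contradiction u₂∣u₁ (ψ₂-∤ ψ₂u₁≉0))
      , (λ u₂∣ → [ finish , (λ u₂∣d → contradiction u₂∣d (ψ₂-∤ (proj₂ (avoids l)))) ]′ (split₂ {num k} {den l} u₂∣))
      ]′ (split₂ {u₁} {num k D.* den l} (num l D.* den k ,∣ 𝔽.ι-injective crossed))
      where
      clear : ∀ u (k : Local) → f ≈ ι u * val k → f * ι (den k) ≈ ι u * ι (num k)
      clear u k f≈ = 𝔽.trans (𝔽.*-congʳ f≈) (𝔽.trans (𝔽.*-assoc _ _ _) (𝔽.*-congˡ (val*den k)))

      crossed : ι (num l D.* den k D.* u₂) ≈ ι (u₁ D.* (num k D.* den l))
      crossed = begin
        ι (num l D.* den k D.* u₂)             ≈⟨ 𝔽.trans (ι.*-homo _ _) (𝔽.*-congʳ (ι.*-homo _ _)) ⟩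
        ι (num l) * ι (den k) * ι u₂           ≈⟨ solve 3 (λ n d u → n :* d :* u := u :* n :* d) 𝔽.refl _ _ _ ⟩
        ι u₂ * ι (num l) * ι (den k)           ≈⟨ 𝔽.*-congʳ (clear u₂ l f≈u₂l) ⟨
        f * ι (den l) * ι (den k)              ≈⟨ solve 3 (λ f d e → f :* d :* e := f :* e :* d) 𝔽.refl _ _ _ ⟩
        f * ι (den k) * ι (den l)              ≈⟨ 𝔽.*-congʳ (clear u₁ k f≈u₁k) ⟩
        ι u₁ * ι (num k) * ι (den l)           ≈⟨ 𝔽.*-assoc _ _ _ ⟩
        ι u₁ * (ι (num k) * ι (den l))         ≈⟨ 𝔽.trans (ι.*-homo _ _) (𝔽.*-congˡ (ι.*-homo _ _)) ⟨
        ι (u₁ D.* (num k D.* den l))           ∎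

      finish : u₂ ∣ num k → ∃[ C ] ∃[ d ] Avoids d × f ≈ ι (u₁ D.* u₂) * (ι C * ι d ⁻¹)
      finish (C ,∣ Cu₂≈n) = C , den k , avoids k , 𝔽.*-cancelʳ (ι (den k)) den≉0 (begin
        f * ι (den k)                                      ≈⟨ clear u₁ k f≈u₁k ⟩
        ι u₁ * ι (num k)                                   ≈⟨ 𝔽.*-congˡ (ι.⟦⟧-cong Cu₂≈n) ⟨
        ι u₁ * ι (C D.* u₂)                                ≈⟨ 𝔽.*-congˡ (ι.*-homo _ _) ⟩
        ι u₁ * (ι C * ι u₂)                                ≈⟨ solve 3 (λ u C v → u :* (C :* v) := u :* v :* C :* :1) 𝔽.refl _ _ _ ⟩
        ι u₁ * ι u₂ * ι C * 1#                             ≈⟨ 𝔽.*-congˡ (𝔽.⁻¹-inverseʳ (ι (den k)) den≉0) ⟨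
        ι u₁ * ι u₂ * ι C * (ι (den k) * ι (den k) ⁻¹)     ≈⟨ solve 4 (λ u C d e → u :* C :* (d :* e) := u :* (C :* e) :* d) 𝔽.refl _ _ _ _ ⟩
        ι u₁ * ι u₂ * (ι C * ι (den k) ⁻¹) * ι (den k)     ≈⟨ 𝔽.*-congʳ (𝔽.*-congʳ (ι.*-homo _ _)) ⟨
        ι (u₁ D.* u₂) * (ι C * ι (den k) ⁻¹) * ι (den k)   ∎)
        where
        den≉0 : ¬ (ι (den k) ≈ 0#)
        den≉0 = 𝔽.ι-nonzero (Avoids⇒≉0 (avoids k))

    series-comm : ∀ p w A B n y → series p w A B n y ≈ series p w B A n y
    series-comm p w A B zero    y = 𝔽.refl
    series-comm p w A B (suc n) y = 𝔽.+-cong (series-comm p w A B n y)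
      (𝔽.*-congʳ (𝔽.*-congʳ (𝔽.*-congʳ (𝔽.*-comm _ _))))

    -- The sign changes sides through `ε² = 1`.
    alternation-difference : ∀ {p w A B n s y u} → Alternation p w A B n s y u →
      ∃[ k ] series p w A B n y 𝔽.- (- 1#) 𝕊.^ s * series p w A B n (- y) ≈ ι u * val k
    alternation-difference {s = s} {u = u} (k , eq) = ℒ.- (sign s ℒ.* k) , (begin
      F 𝔽.- ε * _                        ≈⟨ 𝔽.+-congˡ (𝔽.-‿cong (𝔽.*-congˡ eq)) ⟩
      F 𝔽.- ε * (ε * F + ι u * val k)    ≈⟨ solve 4 (λ F ε u k → F :- ε :* (ε :* F :+ u :* k)
                                               := (:1 :- ε :* ε) :* F :+ u :* :- (ε :* k)) 𝔽.refl F ε (ι u) (val k) ⟩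
      (1# 𝔽.- ε * ε) * F + ι u * - (ε * val k)
        ≈⟨ 𝔽.+-congʳ (𝔽.*-congʳ (𝔽.trans (𝔽.+-congˡ (𝔽.-‿cong (sign² s))) (𝔽.-‿inverseʳ 1#))) ⟩
      0# * F + ι u * - (ε * val k)       ≈⟨ solve 2 (λ F x → con (+ 0) :* F :+ x := x) 𝔽.refl F _ ⟩
      ι u * - (ε * val k)                ≡⟨ ≡.cong (λ e → ι u * - (e * val k)) (val-sign s) ⟨
      ι u * - (val (sign s) * val k)     ∎)
      where
      ε = (- 1#) 𝕊.^ s
      F = _
      -- The sign is rebuilt in `Local` because it multiplies the cofactor.
      sign : ℕ → Local
      sign zero    = ℒ.1#
      sign (suc s) = (ℒ.- ℒ.1#) ℒ.* sign s
      val-sign : ∀ s → val (sign s) ≡ (- 1#) 𝕊.^ s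
      val-sign zero    = ≡.refl
      val-sign (suc s) = ≡.cong (- 1# *_) (val-sign s)

    congruent : ∀ {p w A B n s t y} → Alternation p w A B n s y u₁ → Alternation p w B A n t y u₂ →
      (- 1#) 𝕊.^ s ≈ (- 1#) 𝕊.^ t →
      ∃[ C ] ∃[ d ] Avoids d ×
        series p w A B n y 𝔽.- (- 1#) 𝕊.^ s * series p w A B n (- y) ≈ ι (u₁ D.* u₂) * (ι C * ι d ⁻¹)
    congruent {p} {w} {A} {B} {n} {s} {t} {y} alt₁ alt₂ ε-eq = combine
      (alternation-difference {p} {w} {A} {B} {n} {s} {y} alt₁)
      (alternation-difference {p} {w} {B} {A} {n} {t} {y} alt₂)
      where
      f g : 𝔽.Carrier
      f = series p w A B n y 𝔽.- (- 1#) 𝕊.^ s * series p w A B n (- y)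
      g = series p w B A n y 𝔽.- (- 1#) 𝕊.^ t * series p w B A n (- y)
      f≈g : f ≈ g
      f≈g = 𝔽.+-cong (series-comm p w A B n y) (𝔽.-‿cong (𝔽.*-cong ε-eq (series-comm p w A B n (- y))))
      combine : ∃[ k ] f ≈ ι u₁ * val k → ∃[ l ] g ≈ ι u₂ * val l →
        ∃[ C ] ∃[ d ] Avoids d × f ≈ ι (u₁ D.* u₂) * (ι C * ι d ⁻¹)
      combine (k , eq) (l , eq′) = divisible k l eq (𝔽.trans f≈g eq′)

-- The congruence over an abstract coefficient domain

module QSeries (R : IntegralDomain c ℓ) (𝔽 : FractionField (Bivariate.domain R) c′ ℓ′) (E : IntegralDomain c″ ℓ″)
  (φ : IntegralDomain.Carrier R → IntegralDomain.Carrier E)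
  (φ-isHom : IsHom (IntegralDomain.commutativeRing R) (IntegralDomain.commutativeRing E) φ)
  (q₀ : IntegralDomain.Carrier R) where

  open Bivariate R
  private
    module R = IntegralDomain R
    module D = IntegralDomain domain
    module E = IntegralDomain E
    module 𝔽 = FractionField 𝔽
    module Rᵇ = FiniteSeries R.commutativeRing
    module Eᵇ = FiniteSeries E.commutativeRing
    module φ = RingMorphisms.IsRingHomomorphism φ-isHom
    module ψ (α β : E.Carrier) where
      open Substitution E.commutativeRing φ φ-isHom α β public
      open RingMorphisms.IsRingHomomorphism subst-isHom public
  open 𝔽 using (ι; module ι; _⁻¹; _≈_; _+_; _*_; -_; _-_; 0#; 1#)
  open FiniteSeries 𝔽.commutativeRing
  open Exp 𝔽.semiring using (^-homo-*; ^-assocʳ; ^-congˡ)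
  open RawSemiringDefinitions (Semiring.rawSemiring D.semiring) using (_∣_; Coprime)
  open SetoidReasoning 𝔽.setoid
  open IntegerSolver 𝔽.commutativeRing

  a b q : 𝔽.Carrier
  a = ι 𝑎
  b = ι 𝑏
  q = ι (κ q₀)

  ψ : E.Carrier → E.Carrier → D.Carrier → E.Carrier
  ψ α β = ψ.subst α β

  qᴰ : ℕ → D.Carrier
  qᴰ k = κ (q₀ Rᵇ.^ k)

  q^≈ : ∀ k → q ^ k ≈ ι (qᴰ k)
  q^≈ k = 𝔽.sym (^-homo R.commutativeRing 𝔽.commutativeRing
    (∘-isHom R.commutativeRing D.commutativeRing 𝔽.commutativeRing κ-isHom 𝔽.ι-isHom) q₀ k)

  ψ-q : ∀ α β k → ψ α β (qᴰ k) E.≈ φ q₀ Eᵇ.^ k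
  ψ-q α β k = E.trans (ψ.subst-κ α β _) (^-homo R.commutativeRing E.commutativeRing φ-isHom q₀ k)

  ψ-1- : ∀ α β x → ψ α β (D.1# D.- x) E.≈ E.1# E.- ψ α β x
  ψ-1- α β x = E.trans (ψ.+-homo α β _ _) (E.+-cong (ψ.1#-homo α β) (ψ.-‿homo α β x))

  1-0≉0 : ∀ {x} → x E.≈ E.0# → ¬ (E.1# E.- x E.≈ E.0#)
  1-0≉0 {x} x≈0 eq = E.1≉0 (E.trans (E.sym (E.+-identityʳ _)) (E.trans (E.+-congˡ
    (E.trans (E.sym -0≈0) (E.-‿cong (E.sym x≈0)))) eq))
    where -0≈0 = RingProperties.-0#≈0# E.ring

  -- `i` inverts the specialised `q`, which gives `1 - a q^M` a root in `E`. The other assumption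
  -- keeps `(p;p)_k` nonzero.
  module _ (i : E.Carrier) (φq₀*i≈1 : φ q₀ E.* i E.≈ E.1#)
    (φq₀^k≉1 : ∀ k → ¬ (φ q₀ Eᵇ.^ suc k E.≈ E.1#)) where

    φq^k*i^k≈1 : ∀ k → φ q₀ Eᵇ.^ k E.* i Eᵇ.^ k E.≈ E.1#
    φq^k*i^k≈1 zero    = E.*-identityˡ E.1#
    φq^k*i^k≈1 (suc k) = E.trans (IntegerSolver.solve E.commutativeRing 4
      (λ q Q i I → (q ⊗ Q) ⊗ (i ⊗ I) ⊜ (q ⊗ i) ⊗ (Q ⊗ I)) E.refl _ _ _ _)
      (E.trans (E.*-cong φq₀*i≈1 (φq^k*i^k≈1 k)) (E.*-identityˡ E.1#))
      where open IntegerSolver E.commutativeRing using () renaming (_:*_ to _⊗_; _:=_ to _⊜_)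

    φq^k≉0 : ∀ k → ¬ (φ q₀ Eᵇ.^ k E.≈ E.0#)
    φq^k≉0 k eq = E.1≉0 (E.trans (E.sym (φq^k*i^k≈1 k)) (E.trans (E.*-congʳ eq) (E.zeroˡ _)))

    q₀^k≉0 : ∀ k → ¬ (q₀ Rᵇ.^ k R.≈ R.0#)
    q₀^k≉0 k eq = φq^k≉0 k (E.trans (E.sym (^-homo R.commutativeRing E.commutativeRing φ-isHom q₀ k))
      (E.trans (φ.⟦⟧-cong eq) φ.0#-homo))

    ψ-1-fq≈0 : ∀ α β f M → ψ α β f E.≈ i Eᵇ.^ M → ψ α β (D.1# D.- f D.* qᴰ M) E.≈ E.0#
    ψ-1-fq≈0 α β f M eq = E.trans (ψ-1- α β _) (E.trans (E.+-congˡ (E.-‿cong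
      (E.trans (ψ.*-homo α β _ _) (E.trans (E.*-cong eq (ψ-q α β M)) (E.trans (E.*-comm _ _) (φq^k*i^k≈1 M))))))
      (E.-‿inverseʳ E.1#))

    -- The value is 1. This is the purpose of setting one variable to 0: it covers every
    -- `1 - a b q^e`, and it separates the factors of the modulus.
    ψ-1-fg≉0 : ∀ α β f g → ψ α β f E.≈ E.0# → ¬ (ψ α β (D.1# D.- f D.* g) E.≈ E.0#)
    ψ-1-fg≉0 α β f g eq p = 1-0≉0 (E.trans (ψ.*-homo α β f g) (E.trans (E.*-congʳ eq) (E.zeroˡ _)))
      (E.trans (E.sym (ψ-1- α β _)) p)

    -- The factor 1 − b q^N of the modulus as a quotient u / v of polynomials, where N may be negative.
    record Factor (F : 𝔽.Carrier) : Set (c ⊔ ℓ ⊔ ℓ′ ⊔ c″ ⊔ ℓ″) where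
      field
        u v   : D.Carrier
        β     : E.Carrier
        split : ∀ {f g} → u ∣ f D.* g → u ∣ f ⊎ u ∣ g
        -- For every `α`, as its value is fixed only with the exponent `M` of the first factor.
        ψ₁u≉0 : ∀ α → ¬ (ψ α E.0# u E.≈ E.0#)
        ψ₂u≈0 : ψ E.0# β u E.≈ E.0#
        ψv≉0  : ∀ α β → ¬ (ψ α β v E.≈ E.0#)
        Fv≈u  : F * ι v ≈ ι u

    nonnegative : ∀ N {G} → G ≈ q ^ N → Factor (1# - b * G)
    nonnegative N {G} G≈ = record
      { u = D.1# D.- 𝑏 D.* qᴰ N
      ; v = D.1#
      ; β = i Eᵇ.^ N
      ; split = Primes.prime-1-bh 𝔽 (q₀ Rᵇ.^ N) (q₀^k≉0 N)
      ; ψ₁u≉0 = λ α → ψ-1-fg≉0 α E.0# 𝑏 (qᴰ N) (ψ.subst-b α E.0#)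
      ; ψ₂u≈0 = ψ-1-fq≈0 E.0# (i Eᵇ.^ N) 𝑏 N (ψ.subst-b E.0# (i Eᵇ.^ N))
      ; ψv≉0 = λ α β eq → E.1≉0 (E.trans (E.sym (ψ.1#-homo α β)) eq)
      ; Fv≈u = begin
          (1# - b * G) * ι D.1#            ≈⟨ 𝔽.trans (𝔽.*-congˡ ι.1#-homo) (𝔽.*-identityʳ _) ⟩
          1# - b * G                       ≈⟨ 𝔽.+-congˡ (𝔽.-‿cong (𝔽.*-congˡ (𝔽.trans G≈ (q^≈ N)))) ⟩
          1# - b * ι (qᴰ N)                ≈⟨ 𝔽.+-cong ι.1#-homo (𝔽.trans (ι.-‿homo _) (𝔽.-‿cong (ι.*-homo _ _))) ⟨
          ι D.1# + ι (D.- (𝑏 D.* qᴰ N))    ≈⟨ ι.+-homo _ _ ⟨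
          ι (D.1# D.- 𝑏 D.* qᴰ N)          ∎
      }

    negative : ∀ N {G} → G * q ^ N ≈ 1# → Factor (1# - b * G)
    negative N {G} Gq≈1 = record
      { u = qᴰ N D.- 𝑏
      ; v = qᴰ N
      ; β = φ q₀ Eᵇ.^ N
      ; split = Primes.prime-h-b 𝔽 (q₀ Rᵇ.^ N) (q₀^k≉0 N)
      ; ψ₁u≉0 = λ α eq → φq^k≉0 N (E.trans (E.sym (E.+-identityʳ _)) (E.trans
          (E.+-cong (E.sym (ψ-q α E.0# N)) (E.trans (E.sym -0≈0) (E.-‿cong (E.sym (ψ.subst-b α E.0#)))))
          (E.trans (E.sym (ψ-- α E.0#)) eq)))
      ; ψ₂u≈0 = E.trans (ψ-- E.0# (φ q₀ Eᵇ.^ N)) (E.trans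
          (E.+-cong (ψ-q E.0# (φ q₀ Eᵇ.^ N) N) (E.-‿cong (ψ.subst-b E.0# (φ q₀ Eᵇ.^ N)))) (E.-‿inverseʳ _))
      ; ψv≉0 = λ α β eq → φq^k≉0 N (E.trans (E.sym (ψ-q α β N)) eq)
      ; Fv≈u = begin
          (1# - b * G) * ι (qᴰ N)        ≈⟨ 𝔽.*-congˡ (q^≈ N) ⟨
          (1# - b * G) * q ^ N           ≈⟨ solve 3 (λ b G Q → (:1 :- b :* G) :* Q := Q :- b :* (G :* Q)) 𝔽.refl b G (q ^ N) ⟩
          q ^ N - b * (G * q ^ N)        ≈⟨ 𝔽.+-cong (q^≈ N) (𝔽.-‿cong (𝔽.trans (𝔽.*-congˡ Gq≈1) (𝔽.*-identityʳ b))) ⟩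
          ι (qᴰ N) - b                   ≈⟨ 𝔽.+-congˡ (ι.-‿homo 𝑏) ⟨
          ι (qᴰ N) + ι (D.- 𝑏)           ≈⟨ ι.+-homo _ _ ⟨
          ι (qᴰ N D.- 𝑏)                 ∎
      }
      where
      -0≈0 = RingProperties.-0#≈0# E.ring
      ψ-- : ∀ α β → ψ α β (qᴰ N D.- 𝑏) E.≈ ψ α β (qᴰ N) E.- ψ α β 𝑏
      ψ-- α β = E.trans (ψ.+-homo α β _ _) (E.+-congˡ (ψ.-‿homo α β 𝑏))

    -- `g` and `G` stand for `q^(d-r)` and `q^(d-r+dt)`; they are characterised by equations free of
    -- negative exponents.
    module Congruence (d r s t n : ℕ) (0<d : 0 < d) (s<n : s < n) (t<n : t < n)
      (g G : 𝔽.Carrier) (gq^r≈q^d : g * q ^ r ≈ q ^ d) (G≈ : G ≈ g * (q ^ d) ^ t)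
      (factor : Factor (1# - b * G)) (ε-eq : (- 1#) ^ s ≈ (- 1#) ^ t) (x₀ : R.Carrier) where

      private module F = Factor factor

      M : ℕ
      M = r ℕ.+ d ℕ.* s

      u₁ : D.Carrier
      u₁ = D.1# D.- 𝑎 D.* qᴰ M

      α : E.Carrier
      α = i Eᵇ.^ M

      open Localization domain 𝔽 E (ψ α E.0#) (ψ E.0# F.β) (ψ.subst-isHom α E.0#) (ψ.subst-isHom E.0# F.β)
      open Modulus u₁ F.u (ψ-1-fq≈0 α E.0# 𝑎 M (ψ.subst-a α E.0#)) (ψ-1-fg≉0 E.0# F.β 𝑎 (qᴰ M) (ψ.subst-a E.0# F.β))
        F.ψ₂u≈0 (F.ψ₁u≉0 α) (Primes.prime-1-ah 𝔽 (q₀ Rᵇ.^ M) (q₀^k≉0 M)) F.split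

      v-avoids : Avoids F.v
      v-avoids = F.ψv≉0 α E.0# , F.ψv≉0 E.0# F.β

      1-abq-unit : ∀ e {f} → f ≈ a * b * q ^ e → Unit (1# - f)
      1-abq-unit e {f} f≈ = record
        { poly = D.1# D.- 𝑎 D.* 𝑏 D.* qᴰ e
        ; nonzero = ψ-1-fg≉0 α E.0# (𝑎 D.* 𝑏) (qᴰ e)
                      (E.trans (ψ.*-homo α E.0# 𝑎 𝑏) (E.trans (E.*-congˡ (ψ.subst-b α E.0#)) (E.zeroʳ _)))
                  , ψ-1-fg≉0 E.0# F.β (𝑎 D.* 𝑏) (qᴰ e)
                      (E.trans (ψ.*-homo E.0# F.β 𝑎 𝑏) (E.trans (E.*-congʳ (ψ.subst-a E.0# F.β)) (E.zeroˡ _)))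
        ; f≈poly = begin
            1# - f                                  ≈⟨ 𝔽.+-congˡ (𝔽.-‿cong (𝔽.trans f≈ (𝔽.*-congˡ (q^≈ e)))) ⟩
            1# - a * b * ι (qᴰ e)                   ≈⟨ 𝔽.+-cong ι.1#-homo (𝔽.trans (ι.-‿homo _) (𝔽.-‿cong
                                                        (𝔽.trans (ι.*-homo _ _) (𝔽.*-congʳ (ι.*-homo _ _))))) ⟨
            ι D.1# + ι (D.- (𝑎 D.* 𝑏 D.* qᴰ e))     ≈⟨ ι.+-homo _ _ ⟨
            ι (D.1# D.- 𝑎 D.* 𝑏 D.* qᴰ e)           ∎
        }

      1-q-unit : ∀ e {f} → f ≈ q ^ suc e → Unit (1# - f)
      1-q-unit e {f} f≈ = record
        { poly = D.1# D.- qᴰ (suc e)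
        ; nonzero = nonzero α E.0# , nonzero E.0# F.β
        ; f≈poly = begin
            1# - f                           ≈⟨ 𝔽.+-congˡ (𝔽.-‿cong (𝔽.trans f≈ (q^≈ (suc e)))) ⟩
            1# - ι (qᴰ (suc e))              ≈⟨ 𝔽.+-cong ι.1#-homo (ι.-‿homo _) ⟨
            ι D.1# + ι (D.- qᴰ (suc e))      ≈⟨ ι.+-homo _ _ ⟨
            ι (D.1# D.- qᴰ (suc e))          ∎
        }
        where
        open GroupProperties E.+-group using (x∙y⁻¹≈ε⇒x≈y)
        nonzero : ∀ α β → ¬ (ψ α β (D.1# D.- qᴰ (suc e)) E.≈ E.0#)
        nonzero α β eq = φq₀^k≉1 e (E.sym (E.trans (x∙y⁻¹≈ε⇒x≈y _ _ (E.trans (E.sym (ψ-1- α β _)) eq)) (ψ-q α β (suc e))))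

      q-unit : ∀ e → Unit (q ^ e)
      q-unit e = record { poly = qᴰ e ; f≈poly = q^≈ e
        ; nonzero = nonzero α E.0# , nonzero E.0# F.β }
        where
        nonzero : ∀ α β → ¬ (ψ α β (qᴰ e) E.≈ E.0#)
        nonzero α β eq = φq^k≉0 e (E.trans (E.sym (ψ-q α β e)) eq)

      p w A B : 𝔽.Carrier
      p = q ^ d
      w = a * b * q ^ (2 ℕ.* d)
      A = a * q ^ r
      B = b * g

      p*p≈ : p * p ≈ q ^ (2 ℕ.* d)
      p*p≈ = 𝔽.trans (𝔽.sym (^-homo-* q d d)) (𝔽.reflexive (≡.cong (λ e → q ^ (d ℕ.+ e)) (≡.sym (ℕ.+-identityʳ d))))

      pᴸ mᴸ wᴸ Aᴸ Bᴸ xᴸ : Local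
      pᴸ = fromPoly p (qᴰ d) (q^≈ d)
      mᴸ = Unit.inverse (q-unit d)
      wᴸ = fromPoly w (𝑎 D.* 𝑏 D.* qᴰ (2 ℕ.* d)) (𝔽.sym (𝔽.trans (ι.*-homo _ _)
        (𝔽.*-cong (ι.*-homo _ _) (𝔽.sym (q^≈ (2 ℕ.* d))))))
      Aᴸ = fromPoly A (𝑎 D.* qᴰ r) (𝔽.sym (𝔽.trans (ι.*-homo _ _) (𝔽.*-congˡ (𝔽.sym (q^≈ r)))))
      -- Since `d - r` may be negative, `B` is written as `b q^d` over `q^r`.
      Bᴸ = record { val = B ; num = 𝑏 D.* qᴰ d ; den = qᴰ r ; avoids = Unit.nonzero (q-unit r)
        ; val*den = begin
            b * g * ι (qᴰ r)     ≈⟨ 𝔽.*-congˡ (q^≈ r) ⟨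
            b * g * q ^ r        ≈⟨ 𝔽.*-assoc _ _ _ ⟩
            b * (g * q ^ r)      ≈⟨ 𝔽.*-congˡ (𝔽.trans gq^r≈q^d (q^≈ d)) ⟩
            b * ι (qᴰ d)         ≈⟨ ι.*-homo _ _ ⟨
            ι (𝑏 D.* qᴰ d)       ∎ }
      xᴸ = fromPoly (ι (κ x₀)) (κ x₀) 𝔽.refl

      pm≈1 : p * val mᴸ ≈ 1#
      pm≈1 = 𝔽.⁻¹-inverseʳ p (Unit.unit≉0 (q-unit d))

      w≈ABp : w ≈ A * B * p
      w≈ABp = begin
        a * b * q ^ (2 ℕ.* d)        ≈⟨ 𝔽.*-congˡ p*p≈ ⟨
        a * b * (p * p)              ≈⟨ 𝔽.*-congˡ (𝔽.*-congʳ gq^r≈q^d) ⟨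
        a * b * (g * q ^ r * p)      ≈⟨ solve 5 (λ a b g Q p → a :* b :* (g :* Q :* p) := a :* Q :* (b :* g) :* p) 𝔽.refl a b g (q ^ r) p ⟩
        A * B * p                    ∎

      suc-exponent : ∀ k → ∃[ e ] d ℕ.* suc k ≡ suc e
      suc-exponent k = helper 0<d
        where
        helper : ∀ {d} → 0 < d → ∃[ e ] d ℕ.* suc k ≡ suc e
        helper {suc d} _ = _ , ≡.refl

      p-unit : ∀ k → Unit (1# - p * p ^ k)
      p-unit k = let e , eq = suc-exponent k in
        1-q-unit e (𝔽.trans (^-assocʳ q d (suc k)) (𝔽.reflexive (≡.cong (q ^_) eq)))

      w-unit : ∀ k → Unit (1# - w * (p * p) ^ k)
      w-unit k = 1-abq-unit (2 ℕ.* d ℕ.+ 2 ℕ.* d ℕ.* k) (begin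
        a * b * q ^ (2 ℕ.* d) * (p * p) ^ k                  ≈⟨ 𝔽.*-assoc _ _ _ ⟩
        a * b * (q ^ (2 ℕ.* d) * (p * p) ^ k)                ≈⟨ 𝔽.*-congˡ (𝔽.*-congˡ (𝔽.trans (^-congˡ k p*p≈) (^-assocʳ q (2 ℕ.* d) k))) ⟩
        a * b * (q ^ (2 ℕ.* d) * q ^ (2 ℕ.* d ℕ.* k))        ≈⟨ 𝔽.*-congˡ (^-homo-* q (2 ℕ.* d) (2 ℕ.* d ℕ.* k)) ⟨
        a * b * q ^ (2 ℕ.* d ℕ.+ 2 ℕ.* d ℕ.* k)              ∎)

      wm-unit : ∀ k → Unit (1# - w * val mᴸ * p ^ k)
      wm-unit k = 1-abq-unit (d ℕ.* suc k) (begin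
        a * b * q ^ (2 ℕ.* d) * val mᴸ * p ^ k     ≈⟨ 𝔽.*-congʳ (𝔽.*-congʳ (𝔽.*-congˡ p*p≈)) ⟨
        a * b * (p * p) * val mᴸ * p ^ k           ≈⟨ solve 5 (λ a b p m P → a :* b :* (p :* p) :* m :* P := (p :* m) :* (a :* b :* (p :* P)))
                                                       𝔽.refl a b p (val mᴸ) (p ^ k) ⟩
        (p * val mᴸ) * (a * b * p ^ suc k)         ≈⟨ 𝔽.trans (𝔽.*-congʳ pm≈1) (𝔽.*-identityˡ _) ⟩
        a * b * p ^ suc k                          ≈⟨ 𝔽.*-congˡ (^-assocʳ q d (suc k)) ⟩
        a * b * q ^ (d ℕ.* suc k)                  ∎)

      u₁≈ : 1# - a * q ^ M ≈ ι u₁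
      u₁≈ = begin
        1# - a * q ^ M                   ≈⟨ 𝔽.+-congˡ (𝔽.-‿cong (𝔽.*-congˡ (q^≈ M))) ⟩
        1# - a * ι (qᴰ M)                ≈⟨ 𝔽.+-cong ι.1#-homo (𝔽.trans (ι.-‿homo _) (𝔽.-‿cong (ι.*-homo _ _))) ⟨
        ι D.1# + ι (D.- (𝑎 D.* qᴰ M))    ≈⟨ ι.+-homo _ _ ⟨
        ι u₁                             ∎

      private
        module ℒ = CommutativeRing localRing

      alternation₁ : Alternation p w A B n s (ι (κ x₀)) u₁
      alternation₁ = residue-alternates pᴸ mᴸ wᴸ pm≈1 p-unit w-unit wm-unit u₁ {n} {s} Aᴸ Bᴸ s<n
        ((ℒ.- ℒ.1#) by by-val (begin
          A * val (pᴸ ᴷ.^ s)                   ≡⟨ ≡.cong (A *_) (val-^ pᴸ s) ⟩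
          a * q ^ r * p ^ s                    ≈⟨ 𝔽.*-assoc _ _ _ ⟩
          a * (q ^ r * p ^ s)                  ≈⟨ 𝔽.*-congˡ (𝔽.*-congˡ (^-assocʳ q d s)) ⟩
          a * (q ^ r * q ^ (d ℕ.* s))          ≈⟨ 𝔽.*-congˡ (^-homo-* q r (d ℕ.* s)) ⟨
          a * q ^ M                            ≈⟨ solve 1 (λ f → f := :1 :+ (:1 :- f) :* :- :1) 𝔽.refl _ ⟩
          1# + (1# - a * q ^ M) * - 1#         ≈⟨ 𝔽.+-congˡ (𝔽.*-congʳ u₁≈) ⟩
          1# + ι u₁ * - 1#                     ∎))
        w≈ABp xᴸ
        where
        open Reduction u₁
        module ᴷ = FiniteSeries residueRing

      alternation₂ : Alternation p w B A n t (ι (κ x₀)) F.u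
      alternation₂ = residue-alternates pᴸ mᴸ wᴸ pm≈1 p-unit w-unit wm-unit F.u {n} {t} Bᴸ Aᴸ t<n
        -- `1 - b G` is `u / v` for the polynomials of `factor`, so the cofactor carries the inverse
        -- of `v`, which is admissible.
        ((ℒ.- v⁻¹) by by-val (begin
          B * val (pᴸ ᴷ.^ t)                   ≡⟨ ≡.cong (B *_) (val-^ pᴸ t) ⟩
          b * g * p ^ t                        ≈⟨ 𝔽.*-assoc _ _ _ ⟩
          b * (g * p ^ t)                      ≈⟨ 𝔽.*-congˡ G≈ ⟨
          b * G                                ≈⟨ solve 1 (λ f → f := :1 :- (:1 :- f) :* :1) 𝔽.refl _ ⟩
          1# - (1# - b * G) * 1#               ≈⟨ 𝔽.+-congˡ (𝔽.-‿cong (𝔽.*-congˡ (𝔽.⁻¹-inverseʳ _ (Unit.unit≉0 v-unit)))) ⟨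
          1# - (1# - b * G) * (ι F.v * val v⁻¹) ≈⟨ solve 3 (λ f v i → :1 :- f :* (v :* i) := :1 :+ f :* v :* :- i) 𝔽.refl _ _ _ ⟩
          1# + (1# - b * G) * ι F.v * - val v⁻¹ ≈⟨ 𝔽.+-congˡ (𝔽.*-congʳ F.Fv≈u) ⟩
          1# + ι F.u * - val v⁻¹               ∎))
        (𝔽.trans w≈ABp (𝔽.*-congʳ (𝔽.*-comm _ _))) xᴸ
        where
        open Reduction F.u
        module ᴷ = FiniteSeries residueRing
        v-unit : Unit (ι F.v)
        v-unit = record { poly = F.v ; nonzero = v-avoids ; f≈poly = 𝔽.refl }
        v⁻¹ : Local
        v⁻¹ = Unit.inverse v-unit

      open MonoidSum 𝔽.+-monoid using (sum-syntax)

      S : 𝔽.Carrier → 𝔽.Carrier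
      S y = ∑[ k < n ]
        ( poch p A (toℕ k) * poch p B (toℕ k) * poch p y (toℕ k) * q ^ (d ℕ.* toℕ k)
        * (poch p p (toℕ k) * poch (q ^ (2 ℕ.* d)) w (toℕ k)) ⁻¹ )

      poch-base-cong : ∀ {p p′} x k → p ≈ p′ → poch p x k ≈ poch p′ x k
      poch-base-cong x zero    p≈p′ = 𝔽.refl
      poch-base-cong x (suc k) p≈p′ = 𝔽.*-cong (poch-base-cong x k p≈p′)
        (𝔽.+-congˡ (𝔽.-‿cong (𝔽.*-congˡ (^-congˡ k p≈p′))))

      S≈series : ∀ y → S y ≈ series p w A B n y
      S≈series y = 𝔽.trans
        (∑≈Σ< n (λ k → poch p A k * poch p B k * poch p y k * q ^ (d ℕ.* k) * (poch p p k * poch (q ^ (2 ℕ.* d)) w k) ⁻¹))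
        (Σ<-cong n λ k → 𝔽.*-cong (𝔽.*-congˡ (𝔽.sym (^-assocʳ q d k)))
          (𝔽.⁻¹-cong (Unit.unit≉0 (den-unit pᴸ mᴸ wᴸ pm≈1 p-unit w-unit wm-unit k))
            (𝔽.*-congˡ (poch-base-cong w k (𝔽.sym p*p≈)))))

      modulus : (1# - a * q ^ M) * (1# - b * G) ≈ ι (u₁ D.* F.u) * ι F.v ⁻¹
      modulus = begin
        (1# - a * q ^ M) * (1# - b * G)                      ≈⟨ solve 2 (λ f g → f :* g := f :* (g :* :1)) 𝔽.refl _ _ ⟩
        (1# - a * q ^ M) * ((1# - b * G) * 1#)               ≈⟨ 𝔽.*-congˡ (𝔽.*-congˡ (𝔽.⁻¹-inverseʳ _ (𝔽.ι-nonzero (Avoids⇒≉0 v-avoids)))) ⟨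
        (1# - a * q ^ M) * ((1# - b * G) * (ι F.v * ι F.v ⁻¹)) ≈⟨ solve 4 (λ f g v i → f :* (g :* (v :* i)) := f :* (g :* v) :* i) 𝔽.refl _ _ _ _ ⟩
        (1# - a * q ^ M) * ((1# - b * G) * ι F.v) * ι F.v ⁻¹ ≈⟨ 𝔽.*-congʳ (𝔽.*-cong u₁≈ F.Fv≈u) ⟩
        ι u₁ * ι F.u * ι F.v ⁻¹                              ≈⟨ 𝔽.*-congʳ (ι.*-homo _ _) ⟨
        ι (u₁ D.* F.u) * ι F.v ⁻¹                            ∎

      -- The data required by `_≡_[mod′_]`, over an abstract coefficient domain. Both `v` and `e`
      -- avoid the modulus, so `coprime` serves for each.
      result : ∃[ N ] ∃[ v ] ¬ (v D.≈ D.0#) × Coprime N v × (1# - a * q ^ M) * (1# - b * G) ≈ ι N * ι v ⁻¹ ×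
        ∃[ C ] ∃[ e ] ¬ (e D.≈ D.0#) × Coprime e N ×
          S (ι (κ x₀)) - (- 1#) ^ s * S (- ι (κ x₀)) ≈ ι N * (ι C * ι e ⁻¹)
      result = u₁ D.* F.u , F.v , Avoids⇒≉0 v-avoids , (λ {z} z∣N z∣v → coprime v-avoids z∣v z∣N) , modulus ,
        finish (congruent {p} {w} {A} {B} {n} {s} {t} {y} alternation₁ alternation₂ ε-eq)
        where
        y = ι (κ x₀)
        finish : ∃[ C ] ∃[ e ] Avoids e ×
            series p w A B n y - (- 1#) ^ s * series p w A B n (- y) ≈ ι (u₁ D.* F.u) * (ι C * ι e ⁻¹) →
          ∃[ C ] ∃[ e ] ¬ (e D.≈ D.0#) × Coprime e (u₁ D.* F.u) ×
            S y - (- 1#) ^ s * S (- y) ≈ ι (u₁ D.* F.u) * (ι C * ι e ⁻¹)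
        finish (C , e , e-avoids , eq) = C , e , Avoids⇒≉0 e-avoids , coprime e-avoids ,
          𝔽.trans (𝔽.+-cong (S≈series y) (𝔽.-‿cong (𝔽.*-congˡ (S≈series (- y))))) eq

    -- Integer powers of `q`

    _^ᶻ_ : 𝔽.Carrier → ℤ → 𝔽.Carrier
    f ^ᶻ (+ n)    = f ^ n
    f ^ᶻ -[1+ n ] = (f ⁻¹) ^ suc n

    q^k≉0 : ∀ k → ¬ (q ^ k ≈ 0#)
    q^k≉0 k eq = φq^k≉0 k (E.trans (E.sym (ψ-q E.0# E.0# k)) (E.trans (ψ.⟦⟧-cong E.0# E.0#
      (𝔽.ι-injective (𝔽.trans (𝔽.sym (q^≈ k)) (𝔽.trans eq (𝔽.sym ι.0#-homo))))) (ψ.0#-homo E.0# E.0#)))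

    q≉0 : ¬ (q ≈ 0#)
    q≉0 q≈0 = q^k≉0 1 (𝔽.trans (𝔽.*-identityʳ q) q≈0)

    q⁻¹^k*q^k≈1 : ∀ k → (q ⁻¹) ^ k * q ^ k ≈ 1#
    q⁻¹^k*q^k≈1 zero    = 𝔽.*-identityˡ 1#
    q⁻¹^k*q^k≈1 (suc k) = begin
      q ⁻¹ * (q ⁻¹) ^ k * (q * q ^ k)    ≈⟨ solve 4 (λ i I q Q → i :* I :* (q :* Q) := q :* i :* (I :* Q)) 𝔽.refl _ _ _ _ ⟩
      q * q ⁻¹ * ((q ⁻¹) ^ k * q ^ k)    ≈⟨ 𝔽.*-cong (𝔽.⁻¹-inverseʳ q q≉0) (q⁻¹^k*q^k≈1 k) ⟩
      1# * 1#                            ≈⟨ 𝔽.*-identityˡ 1# ⟩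
      1#                                 ∎

    -- Reduces identities between integer powers to natural exponents by multiplying with a power of
    -- `q` that clears the denominator.
    ^ᶻ-* : ∀ j k l → j ℤ.+ + k ≡ + l → (q ^ᶻ j) * q ^ k ≈ q ^ l
    ^ᶻ-* (+ m)    k l eq = 𝔽.trans (𝔽.sym (^-homo-* q m k)) (𝔽.reflexive (≡.cong (q ^_) (ℤ.+-injective eq)))
    ^ᶻ-* -[1+ m ] k l eq = begin
      (q ⁻¹) ^ suc m * q ^ k                  ≡⟨ ≡.cong (λ e → (q ⁻¹) ^ suc m * q ^ e) k≡ ⟩
      (q ⁻¹) ^ suc m * q ^ (suc m ℕ.+ l)      ≈⟨ 𝔽.*-congˡ (^-homo-* q (suc m) l) ⟩
      (q ⁻¹) ^ suc m * (q ^ suc m * q ^ l)    ≈⟨ 𝔽.*-assoc _ _ _ ⟨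
      (q ⁻¹) ^ suc m * q ^ suc m * q ^ l      ≈⟨ 𝔽.*-congʳ (q⁻¹^k*q^k≈1 (suc m)) ⟩
      1# * q ^ l                              ≈⟨ 𝔽.*-identityˡ _ ⟩
      q ^ l                                   ∎
      where
      k≡ : k ≡ suc m ℕ.+ l
      k≡ = ℤ.+-injective (≡.trans (≡.sym (ℤ.+-identityˡ (+ k))) (≡.trans
        (≡.cong (ℤ._+ + k) (≡.sym (ℤ.+-inverseʳ (+ suc m)))) (≡.trans
        (ℤ.+-assoc (+ suc m) -[1+ m ] (+ k)) (≡.cong (λ z → + suc m ℤ.+ z) eq))))

    factor : ∀ j → Factor (1# - b * (q ^ᶻ j))
    factor (+ N)    = nonnegative N 𝔽.refl
    factor -[1+ N ] = negative (suc N) (q⁻¹^k*q^k≈1 (suc N))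

    module Exponents (d r t : ℕ) where
      g G : 𝔽.Carrier
      g = q ^ᶻ (+ d ℤ.- + r)
      G = q ^ᶻ (+ d ℤ.- + r ℤ.+ + (d ℕ.* t))

      private
        cancel-r : ∀ i j → i ℤ.- + r ℤ.+ j ℤ.+ + r ≡ i ℤ.+ j
        cancel-r i j = solveᶻ 3 (λ i r j → i :-ᶻ r :+ᶻ j :+ᶻ r :=ᶻ i :+ᶻ j) ≡.refl i (+ r) j
          where open IntegerSolver ℤ.+-*-commutativeRing using ()
                  renaming (solve to solveᶻ; _:+_ to _:+ᶻ_; _:-_ to _:-ᶻ_; _:=_ to _:=ᶻ_)

      gq^r≈q^d : g * q ^ r ≈ q ^ d
      gq^r≈q^d = ^ᶻ-* (+ d ℤ.- + r) r d (≡.trans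
        (≡.cong (ℤ._+ + r) (≡.sym (ℤ.+-identityʳ (+ d ℤ.- + r)))) (≡.trans (cancel-r (+ d) (+ 0)) (ℤ.+-identityʳ (+ d))))

      G≈ : G ≈ g * (q ^ d) ^ t
      G≈ = 𝔽.*-cancelʳ (q ^ r) (q^k≉0 r) (begin
        G * q ^ r                       ≈⟨ ^ᶻ-* (+ d ℤ.- + r ℤ.+ + (d ℕ.* t)) r (d ℕ.+ d ℕ.* t)
                                             (≡.trans (cancel-r (+ d) (+ (d ℕ.* t))) (≡.sym (ℤ.pos-+ d (d ℕ.* t)))) ⟩
        q ^ (d ℕ.+ d ℕ.* t)             ≈⟨ ^-homo-* q d (d ℕ.* t) ⟩
        q ^ d * q ^ (d ℕ.* t)           ≈⟨ 𝔽.*-cong gq^r≈q^d (^-assocʳ q d t) ⟨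
        g * q ^ r * (q ^ d) ^ t         ≈⟨ solve 3 (λ g Q P → g :* Q :* P := g :* P :* Q) 𝔽.refl _ _ _ ⟩
        g * (q ^ d) ^ t * q ^ r         ∎)

-- The residues s and t

module Residues where
  open IntegerSolver ℤ.+-*-commutativeRing

  IsResidue : ℚ → ℕ → ℕ → Set
  IsResidue y m s = m ℕ.∣ ℤ.∣ ↥ y ℤ.- + s ℤ.* ↧ y ∣

  -- The witness lies in the filtered list, so that list is not empty and the default value 0 of
  -- `⟨_⟩` is not taken.
  residue-spec : ∀ y m → ∃[ s ] s < m × IsResidue y m s → ⟨ y ⟩ m < m × IsResidue y m (⟨ y ⟩ m)
  residue-spec y m (s₀ , s₀<m , p) = go (filter P? (upTo m)) ≡.refl
    where
    P? = λ s → m ℕ.∣? ℤ.∣ ↥ y ℤ.- + s ℤ.* ↧ y ∣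
    go : ∀ xs → filter P? (upTo m) ≡ xs → ⟨ y ⟩ m < m × IsResidue y m (⟨ y ⟩ m)
    go []      eq with () ← ≡.subst (s₀ ∈_) eq (∈-filter⁺ P? (∈-upTo⁺ s₀<m) p)
    go (s ∷ _) eq rewrite eq = let s∈ , q = ∈-filter⁻ P? {s} {upTo m} (≡.subst (s ∈_) (≡.sym eq) (here ≡.refl)) in ∈-upTo⁻ s∈ , q

  inverse-mod : ∀ {m k} → ℕ.Coprime m k → ∃[ v ] + k ℤˢ.∣ v ℤ.* + m ℤ.- + 1
  inverse-mod {m} {k} c with ℕ.coprime-Bézout c
  ... | ℕ.Bézout.+- x y eq = + x , ℤˢ.divides (+ y) (begin
    + x ℤ.* + m ℤ.- + 1        ≡⟨ ≡.cong (ℤ._- + 1) (ℤ.pos-* x m) ⟨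
    + (x ℕ.* m) ℤ.- + 1        ≡⟨ ≡.cong (λ z → + z ℤ.- + 1) eq ⟨
    + (1 ℕ.+ y ℕ.* k) ℤ.- + 1  ≡⟨ ≡.cong (ℤ._- + 1) (ℤ.pos-+ 1 (y ℕ.* k)) ⟩
    + 1 ℤ.+ + (y ℕ.* k) ℤ.- + 1 ≡⟨ ≡.cong (λ z → + 1 ℤ.+ z ℤ.- + 1) (ℤ.pos-* y k) ⟩
    + 1 ℤ.+ + y ℤ.* + k ℤ.- + 1 ≡⟨ solve 2 (λ y k → :1 :+ y :* k :- :1 := y :* k) ≡.refl (+ y) (+ k) ⟩
    + y ℤ.* + k ∎)
    where open ≡.≡-Reasoning
  ... | ℕ.Bézout.-+ x y eq = ℤ.- (+ x) , ℤˢ.divides (ℤ.- (+ y)) (begin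
    ℤ.- (+ x) ℤ.* + m ℤ.- + 1      ≡⟨ solve 2 (λ x m → :- x :* m :- :1 := :- (:1 :+ x :* m)) ≡.refl (+ x) (+ m) ⟩
    ℤ.- (+ 1 ℤ.+ + x ℤ.* + m)      ≡⟨ ≡.cong (λ z → ℤ.- (+ 1 ℤ.+ z)) (ℤ.pos-* x m) ⟨
    ℤ.- (+ (1 ℕ.+ x ℕ.* m))        ≡⟨ ≡.cong (λ z → ℤ.- (+ z)) eq ⟩
    ℤ.- (+ (y ℕ.* k))              ≡⟨ ≡.cong ℤ.-_ (ℤ.pos-* y k) ⟩
    ℤ.- (+ y ℤ.* + k)              ≡⟨ solve 2 (λ y k → :- (y :* k) := :- y :* k) ≡.refl (+ y) (+ k) ⟩
    ℤ.- (+ y) ℤ.* + k ∎)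
    where open ≡.≡-Reasoning

  residue-exists : ∀ y m .{{_ : NonZero m}} → ℕ.Coprime (↧ₙ y) m → ∃[ s ] s < m × IsResidue y m s
  residue-exists y m c = s , ℤ.n%ℕd<d (↥ y ℤ.* v) m , ℤˢ.∣⇒∣ᵤ (≡.subst (+ m ℤˢ.∣_) eq
    (ℤˢ.∣m∣n⇒∣m-n (ℤˢ.∣n⇒∣m*n (↧ y) {↥ y ℤ.* v ℤ.- + s} m∣yv-s) (ℤˢ.∣n⇒∣m*n (↥ y) (proj₂ (inverse-mod c)))))
    where
    open ≡.≡-Reasoning
    v : ℤ
    v = proj₁ (inverse-mod c)
    s : ℕ
    -- The numerator times an inverse `v` of the denominator modulo `m`.
    s = (↥ y ℤ.* v) ℤ.%ℕ m
    m∣yv-s : + m ℤˢ.∣ ↥ y ℤ.* v ℤ.- + s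
    m∣yv-s = ℤˢ.divides ((↥ y ℤ.* v) ℤ./ℕ m) (begin
      ↥ y ℤ.* v ℤ.- + s                                        ≡⟨ ≡.cong (ℤ._- + s) (ℤ.a≡a%ℕn+[a/ℕn]*n (↥ y ℤ.* v) m) ⟩
      + s ℤ.+ (↥ y ℤ.* v) ℤ./ℕ m ℤ.* + m ℤ.- + s               ≡⟨ solve 2 (λ s x → s :+ x :- s := x) ≡.refl (+ s) _ ⟩
      (↥ y ℤ.* v) ℤ./ℕ m ℤ.* + m                               ∎)
    eq : ↧ y ℤ.* (↥ y ℤ.* v ℤ.- + s) ℤ.- ↥ y ℤ.* (v ℤ.* ↧ y ℤ.- + 1) ≡ ↥ y ℤ.- + s ℤ.* ↧ y
    eq = solve 4 (λ d y v s → d :* (y :* v :- s) :- y :* (v :* d :- :1) := y :- s :* d) ≡.refl (↧ y) (↥ y) v (+ s)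

  -- `⟨_⟩` sees the fraction in lowest terms; multiplying by the cancelled gcd `g` returns to `i`
  -- and `d`.
  residue-fraction : ∀ i d m .{{_ : NonZero d}} .{{_ : NonZero m}} → ℕ.gcd d m ≡ 1 →
    let s = ⟨ i ℚ./ d ⟩ m in s < m × + m ℤˢ.∣ i ℤ.- + s ℤ.* + d
  residue-fraction i d m gcd≡1 = proj₁ spec , ≡.subst (+ m ℤˢ.∣_) eq
    (ℤˢ.∣m⇒∣m*n g (ℤˢ.∣ᵤ⇒∣ {+ m} {↥ y ℤ.- + s ℤ.* ↧ y} (proj₂ spec)))
    where
    open ≡.≡-Reasoning
    y : ℚ
    y = i ℚ./ d
    g : ℤ
    g = ℤ.gcd i (+ d)
    s : ℕ
    s = ⟨ y ⟩ m
    ↧∣d : ↧ₙ y ℕ.∣ d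
    ↧∣d = ℤˢ.∣⇒∣ᵤ {↧ y} {+ d} (ℤˢ.divides g (≡.trans (≡.sym (ℚ.↧-/ i d)) (ℤ.*-comm (↧ y) g)))
    coprime : ℕ.Coprime (↧ₙ y) m
    coprime (k∣↧ , k∣m) = ℕ.gcd≡1⇒coprime gcd≡1 (ℕ.∣-trans k∣↧ ↧∣d , k∣m)
    spec : s < m × IsResidue y m s
    spec = residue-spec y m (residue-exists y m coprime)
    eq : (↥ y ℤ.- + s ℤ.* ↧ y) ℤ.* g ≡ i ℤ.- + s ℤ.* + d
    eq = begin
      (↥ y ℤ.- + s ℤ.* ↧ y) ℤ.* g           ≡⟨ solve 4 (λ n s d g → (n :- s :* d) :* g := n :* g :- s :* (d :* g)) ≡.refl (↥ y) (+ s) (↧ y) g ⟩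
      ↥ y ℤ.* g ℤ.- + s ℤ.* (↧ y ℤ.* g)     ≡⟨ ≡.cong₂ (λ a b → a ℤ.- + s ℤ.* b) (ℚ.↥-/ i d) (ℚ.↧-/ i d) ⟩
      i ℤ.- + s ℤ.* + d                     ∎

  even-or-odd : ∀ m → 2 ℕ.∣ m ⊎ 2 ℕ.∣ suc m
  even-or-odd zero    = inj₁ (2 ℕ.∣0)
  even-or-odd (suc m) = Sum.swap (Sum.map₁ (ℕ.∣m∣n⇒∣m+n ℕ.∣-refl) (even-or-odd m))

  between : ∀ {m n} → n ℕ.∣ suc m → suc m < n ℕ.+ n → suc m ≡ n
  between {m} {n} (ℕ.divides 1 eq)             _     = ≡.trans eq (ℕ.*-identityˡ n)
  between {m} {n} (ℕ.divides (suc (suc k)) eq) m<n+n = contradiction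
    (ℕ.≤-trans (ℕ.+-monoʳ-≤ n (ℕ.m≤m+n n (k ℕ.* n))) (ℕ.≤-reflexive (≡.sym eq))) (ℕ.<⇒≱ m<n+n)

  module _ (d n r : ℕ) .{{_ : NonZero d}} .{{_ : NonZero n}} (gcd≡1 : ℕ.gcd d n ≡ 1) where
    private
      s t : ℕ
      s = ⟨ (ℤ.- (+ r)) ℚ./ d ⟩ n
      t = ⟨ (+ r ℤ.- + d) ℚ./ d ⟩ n

    s<n : s < n
    s<n = proj₁ (residue-fraction (ℤ.- (+ r)) d n gcd≡1)

    t<n : t < n
    t<n = proj₁ (residue-fraction (+ r ℤ.- + d) d n gcd≡1)

    -- Modulo `n`, `s d = -r` and `t d = r - d`. Adding gives `d (1 + s + t) = 0`, and `d` is
    -- coprime to `n`.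
    n∣1+s+t : n ℕ.∣ suc (s ℕ.+ t)
    n∣1+s+t = ℕ.coprime-divisor {n} {d} (ℕ.sym (ℕ.gcd≡1⇒coprime gcd≡1)) (ℤˢ.∣⇒∣ᵤ {+ n} (≡.subst (+ n ℤˢ.∣_) eq
      (ℤˢ.∣m⇒∣-m (ℤˢ.∣m∣n⇒∣m+n (proj₂ (residue-fraction (ℤ.- (+ r)) d n gcd≡1))
        (proj₂ (residue-fraction (+ r ℤ.- + d) d n gcd≡1))))))
      where
      open ≡.≡-Reasoning
      eq : ℤ.- ((ℤ.- (+ r) ℤ.- + s ℤ.* + d) ℤ.+ (+ r ℤ.- + d ℤ.- + t ℤ.* + d)) ≡ + (d ℕ.* suc (s ℕ.+ t))
      eq = begin
        ℤ.- ((ℤ.- (+ r) ℤ.- + s ℤ.* + d) ℤ.+ (+ r ℤ.- + d ℤ.- + t ℤ.* + d))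
          ≡⟨ solve 4 (λ r s t d → :- ((:- r :- s :* d) :+ (r :- d :- t :* d)) := d :* (:1 :+ (s :+ t))) ≡.refl (+ r) (+ s) (+ t) (+ d) ⟩
        + d ℤ.* (+ 1 ℤ.+ (+ s ℤ.+ + t))   ≡⟨ ≡.cong (λ z → + d ℤ.* (+ 1 ℤ.+ z)) (ℤ.pos-+ s t) ⟨
        + d ℤ.* + suc (s ℕ.+ t)           ≡⟨ ℤ.pos-* d (suc (s ℕ.+ t)) ⟨
        + (d ℕ.* suc (s ℕ.+ t))           ∎

    1+s+t≡n : suc (s ℕ.+ t) ≡ n
    1+s+t≡n = between n∣1+s+t (ℕ.<-≤-trans (ℕ.n<1+n _)
      (ℕ.≤-trans (ℕ.≤-reflexive (≡.cong suc (≡.sym (ℕ.+-suc s t)))) (ℕ.+-mono-≤ s<n t<n)))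

    2∣s+t : ¬ (2 ℕ.∣ n) → 2 ℕ.∣ s ℕ.+ t
    2∣s+t 2∤n = Sum.[ (λ p → p) , (λ p → contradiction (≡.subst (2 ℕ.∣_) 1+s+t≡n p) 2∤n) ]′ (even-or-odd (s ℕ.+ t))

-- Specialisation to ℚ(x,q,a,b)

open import Defs
open import Data.Nat.Base as ℕ using (ℕ; NonZero)
open import Data.Nat.Divisibility using (_∤_)
open import Data.Nat.GCD using (gcd)
open import Data.Rational.Base using (_/_)
open import Relation.Binary.PropositionalEquality.Core using (_≡_)

private module E = IntegralDomain ℚ-integralDomain

2ℚ : ℚ
2ℚ = + 2 / 1

private module X = Evaluation ℚ-integralDomain E.commutativeRing
private module Q = Evaluation ℚ[x].integralDomain E.commutativeRing

id-isHom : IsHom E.commutativeRing E.commutativeRing (λ x → x)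
id-isHom = isHom E.commutativeRing E.commutativeRing (λ eq → eq) (λ _ _ → ≡.refl) (λ _ _ → ≡.refl) ≡.refl

abstract
  -- Sends `x` to 0 and `q` to 2. The value at `x` is a free choice, as neither the denominators nor
  -- the modulus contain `x`; 2 is invertible and no root of unity.
  φ : ℚ[x][q].Poly → ℚ
  φ = Q.eval (X.eval (λ x → x) id-isHom ℚ.0ℚ) (X.eval-isHom (λ x → x) id-isHom ℚ.0ℚ) 2ℚ

  φ-isHom : IsHom ℚ[x][q].commutativeRing E.commutativeRing φ
  φ-isHom = Q.eval-isHom (X.eval (λ x → x) id-isHom ℚ.0ℚ) (X.eval-isHom (λ x → x) id-isHom ℚ.0ℚ) 2ℚ

  φ-q : φ ℚ[x][q].var ≡ 2ℚ
  φ-q = Q.eval-var (X.eval (λ x → x) id-isHom ℚ.0ℚ) (X.eval-isHom (λ x → x) id-isHom ℚ.0ℚ) 2ℚ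

private module Eᵇ = FiniteSeries E.commutativeRing

1<2 : ℚ.1ℚ ℚ.< 2ℚ
1<2 = ℚ.*<* (ℤ.+<+ (ℕ.s≤s (ℕ.s≤s ℕ.z≤n)))

1≤2^k : ∀ k → ℚ.1ℚ ℚ.≤ 2ℚ Eᵇ.^ k
1≤2^k zero    = ℚ.≤-refl
1≤2^k (suc k) = ℚ.≤-trans (1≤2^k k) (≡.subst₂ ℚ._≤_ (ℚ.*-identityˡ _) ≡.refl
  (ℚ.*-monoʳ-≤-nonNeg (2ℚ Eᵇ.^ k) {{ℚ.nonNegative (ℚ.≤-trans (ℚ.nonNegative⁻¹ ℚ.1ℚ) (1≤2^k k))}} (ℚ.<⇒≤ 1<2)))

2^k≢1 : ∀ k → ¬ (2ℚ Eᵇ.^ suc k ≡ ℚ.1ℚ)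
2^k≢1 k eq = ℚ.<-irrefl ≡.refl (ℚ.<-≤-trans 1<2 (≡.subst (2ℚ ℚ.≤_) eq
   (≡.subst (ℚ._≤ 2ℚ Eᵇ.^ suc k) (ℚ.*-identityʳ 2ℚ) (ℚ.*-monoˡ-≤-nonNeg 2ℚ (1≤2^k k)))))

private
  module T = QSeries ℚ[x][q].integralDomain (fractionField ℚ[x][q][a][b].integralDomain) ℚ-integralDomain
    φ φ-isHom ℚ[x][q].var

φq^k≢1 : ∀ k → ¬ (φ ℚ[x][q].var Eᵇ.^ suc k ≡ ℚ.1ℚ)
φq^k≢1 k = ≡.subst (λ z → ¬ (z Eᵇ.^ suc k ≡ ℚ.1ℚ)) (≡.sym φ-q) (2^k≢1 k)

φq*½≡1 : φ ℚ[x][q].var ℚ.* ℚ.½ ≡ ℚ.1ℚ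
φq*½≡1 = ≡.cong (ℚ._* ℚ.½) φ-q

-- Translation into the notation of the statement

𝕂-ring : CommutativeRing _ _
𝕂-ring = Rational.commutativeRing
private module 𝕂ᵇ = FiniteSeries 𝕂-ring

⟦⟧≡poch : ∀ y p k → ⟦ y ⨾ p ⟧ k ≡ 𝕂ᵇ.poch p y k
⟦⟧≡poch y p zero    = ≡.refl
⟦⟧≡poch y p (suc k) = ≡.cong (_* (1# - y * p ^ k)) (⟦⟧≡poch y p k)

^ᶻ≡ : ∀ j → T._^ᶻ_ ℚ.½ φq*½≡1 φq^k≢1 q j ≡ q ^ᶻ j
^ᶻ≡ (+ n)    = ≡.refl
^ᶻ≡ -[1+ n ] = ≡.refl

qSum : ℕ → ℕ → ℕ → 𝕂 → 𝕂
qSum d n r y = ∑[ k < n ]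
  ( ⟦ a * q ^ r ⨾ q ^ d ⟧ (toℕ k)
  * ⟦ b * q ^ᶻ (+ d ℤ.- + r) ⨾ q ^ d ⟧ (toℕ k)
  * ⟦ y ⨾ q ^ d ⟧ (toℕ k)
  * q ^ (d ℕ.* toℕ k)
  ÷ ( ⟦ q ^ d ⨾ q ^ d ⟧ (toℕ k)
    * ⟦ a * b * q ^ (2 ℕ.* d) ⨾ q ^ (2 ℕ.* d) ⟧ (toℕ k)))

-- The arithmetic of the residues enters only through `s < n`, `t < n` and the parity of `s + t`.
congruence : ∀ d n r s t → 0 ℕ.< d → s ℕ.< n → t ℕ.< n → 2 ℕ.∣ s ℕ.+ t →
  qSum d n r x ≡ (- 1#) ^ s * qSum d n r (- x)
    [mod′ (1# - a * q ^ (r ℕ.+ d ℕ.* s)) * (1# - b * q ^ᶻ (+ d ℤ.- + r ℤ.+ + (d ℕ.* t))) ]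
congruence d n r s t 0<d s<n t<n 2∣s+t = transport result
  where
  j k : ℤ
  j = + d ℤ.- + r
  k = + d ℤ.- + r ℤ.+ + (d ℕ.* t)
  open T.Exponents ℚ.½ φq*½≡1 φq^k≢1 d r t
  open T.Congruence ℚ.½ φq*½≡1 φq^k≢1 d r s t n 0<d s<n t<n g G gq^r≈q^d G≈
    (T.factor ℚ.½ φq*½≡1 φq^k≢1 k) (Signs.sign-parity 𝕂-ring s t 2∣s+t) (ℚ[x][q].const ℚ[x].var)
    using (S; result)

  qSum≡S : ∀ y → S y ≡ qSum d n r y
  qSum≡S y = sum-cong-≗ {n} {λ l → summand (toℕ l)} {λ l → summand′ (toℕ l)} λ l → agree (toℕ l)
    where
    open MonoidSum (CommutativeRing.+-monoid 𝕂-ring) using (sum-cong-≗)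
    open 𝕂ᵇ using (poch)
    summand summand′ : ℕ → 𝕂
    summand l = poch (q ^ d) (a * q ^ r) l * poch (q ^ d) (b * g) l * poch (q ^ d) y l * q ^ (d ℕ.* l)
      ÷ (poch (q ^ d) (q ^ d) l * poch (q ^ (2 ℕ.* d)) (a * b * q ^ (2 ℕ.* d)) l)
    summand′ l = ⟦ a * q ^ r ⨾ q ^ d ⟧ l * ⟦ b * q ^ᶻ j ⨾ q ^ d ⟧ l * ⟦ y ⨾ q ^ d ⟧ l * q ^ (d ℕ.* l)
      ÷ (⟦ q ^ d ⨾ q ^ d ⟧ l * ⟦ a * b * q ^ (2 ℕ.* d) ⨾ q ^ (2 ℕ.* d) ⟧ l)
    agree : ∀ l → summand l ≡ summand′ l
    agree l = ≡.sym (≡.cong₂ _÷_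
      (≡.cong (_* q ^ (d ℕ.* l)) (≡.cong₂ _*_ (≡.cong₂ _*_
        (⟦⟧≡poch (a * q ^ r) (q ^ d) l)
        (≡.trans (≡.cong (λ g → ⟦ b * g ⨾ q ^ d ⟧ l) (≡.sym (^ᶻ≡ j))) (⟦⟧≡poch (b * g) (q ^ d) l)))
        (⟦⟧≡poch y (q ^ d) l)))
      (≡.cong₂ _*_ (⟦⟧≡poch (q ^ d) (q ^ d) l) (⟦⟧≡poch (a * b * q ^ (2 ℕ.* d)) (q ^ (2 ℕ.* d)) l)))

  transport : ∃[ N ] ∃[ v ] ¬ (v P.≈ P.0#) × Coprime N v ×
      (1# - a * q ^ (r ℕ.+ d ℕ.* s)) * (1# - b * G) ≈ ι N ÷ ι v × S x ≡ (- 1#) ^ s * S (- x) [mod N ] →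
    qSum d n r x ≡ (- 1#) ^ s * qSum d n r (- x)
      [mod′ (1# - a * q ^ (r ℕ.+ d ℕ.* s)) * (1# - b * q ^ᶻ k) ]
  transport (N , v , v≉0 , N-v , modulus , cong) = N , v , v≉0 , N-v ,
    ≡.subst (λ G → (1# - a * q ^ (r ℕ.+ d ℕ.* s)) * (1# - b * G) ≈ ι N ÷ ι v) (^ᶻ≡ k) modulus ,
    ≡.subst₂ (λ f g → f ≡ (- 1#) ^ s * g [mod N ]) (qSum≡S x) (qSum≡S (- x)) cong

theorem1p3 :
    ∀ (d n r : ℕ) .{{_ : NonZero d}} .{{_ : NonZero n}} .{{_ : NonZero r}} →
    gcd d n ≡ 1 → 2 ∤ n →
    let
      s : ℕ
      s = ⟨ (ℤ.- (+ r)) / d ⟩ n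
      t : ℕ
      t = ⟨ (+ r ℤ.- + d) / d ⟩ n
      S : 𝕂 → 𝕂
      S y = ∑[ k < n ]
        ( ⟦ a * q ^ r ⨾ q ^ d ⟧ (toℕ k)
        * ⟦ b * q ^ᶻ (+ d ℤ.- + r) ⨾ q ^ d ⟧ (toℕ k)
        * ⟦ y ⨾ q ^ d ⟧ (toℕ k)
        * q ^ (d ℕ.* toℕ k)
        ÷ ( ⟦ q ^ d ⨾ q ^ d ⟧ (toℕ k)
          * ⟦ a * b * q ^ (2 ℕ.* d) ⨾ q ^ (2 ℕ.* d) ⟧ (toℕ k)))
    in
    S x ≡ (- 1#) ^ s * S (- x)
      [mod′ (1# - a * q ^ (r ℕ.+ d ℕ.* s))
          * (1# - b * q ^ᶻ (+ d ℤ.- + r ℤ.+ + (d ℕ.* t))) ]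
theorem1p3 d n r gcd≡1 2∤n = congruence d n r _ _ (ℕ.>-nonZero⁻¹ d) (Residues.s<n d n r gcd≡1) (Residues.t<n d n r gcd≡1)
  (Residues.2∣s+t d n r gcd≡1 2∤n)
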